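{- Let $k\in\mathbb{N}$ and let $f_1,\dots,f_k:\mathbb{N}\to\mathbb{R}$ be functions such that (1) the sequence $(\mathbf{x}_n)_{n\in\mathbb{N}}$ in $\mathbb{R}^k$ given by $\mathbf{x}_n:=(f_1(n),\dots,f_k(n))$ is totally-homogeneously equidistributed mod 1, and (2) $f_1$ is of the form $f_1(n)=\alpha n+\beta$ for some $\alpha,\beta\in\mathbb{R}$ with $\alpha$ irrational. Then the density below exists and $$\mathrm{dens}\big(\{n\in\mathbb{N}:\gcd(n,\lfloor f_1(n)\rfloor,\dots,\lfloor f_k(n)\rfloor)=1\}\big)=\frac{1}{\zeta(k+1)}.$$
   Context: $\mathbb{N}=\{1,2,3,\dots\}$; $\lfloor x\rfloor$ and $\{x\}=x-\lfloor x\rfloor\in[0,1)$ denote the integer and fractional parts of $x\in\mathbb{R}$, and $\{\mathbf{x}\}=(\{x_1\},\dots,\{x_k\})$ for $\mathbf{x}\in\mathbb{R}^k$; $\zeta$ is the Riemann zeta function. The density of $\mathcal{A}\subseteq\mathbb{N}$ is $\mathrm{dens}\,\mathcal{A}:=\lim_{N\to\infty}|\mathcal{A}\cap\{1,\dots,N\}|/N$, when this limit exists. A sequence $(\mathbf{x}_n)_{n\in\mathbb{N}}$ in $\mathbb{R}^k$ is equidistributed mod 1 if for every box $\mathcal{B}=[a_1,b_1)\times\cdots\times[a_k,b_k)\subseteq[0,1)^k$ one has $\mathrm{dens}(\{n\in\mathbb{N}:\{\mathbf{x}_n\}\in\mathcal{B}\})=(b_1-a_1)\cdots(b_k-a_k)$.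 It is totally-homogeneously equidistributed mod 1 if for all $D,b\in\mathbb{N}$ the sequence $\big(\frac{1}{D}\mathbf{x}_{Dn+b}\big)_{n\in\mathbb{N}}$ is equidistributed mod 1. -}

module Defs where

open import Axiom.ExcludedMiddle using (ExcludedMiddle)
open import Data.Integer.Base as ℤ using (ℤ; +_; -[1+_])
import Data.Integer.GCD as ℤ
import Data.Integer.Properties as ℤ
open import Data.List.Base using (applyUpTo; filter; length)
open import Data.Nat.Base as ℕ using (ℕ; zero; suc)
import Data.Nat.Coprimality as ℕ
import Data.Nat.Properties as ℕ
open import Data.Product.Base using (∃-syntax; _×_; _,_; proj₁)
open import Data.Rational.Base as ℚ using (ℚ; mkℚ; 0ℚ; 1ℚ)
import Data.Rational.Properties as ℚ
import Data.Rational.Unnormalised.Base as ℚᵘ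
import Data.Rational.Unnormalised.Properties as ℚᵘ
open import Data.Rational.Solver using (module +-*-Solver)
open import Data.Integer.Tactic.RingSolver using (solve-∀)
import Data.Nat.Tactic.RingSolver as ℕ-Solver
open import Data.Sum.Base using (inj₁; inj₂)
open import Data.Vec.Functional using (Vector; foldr)
open import Level using (0ℓ)
open import Relation.Binary.PropositionalEquality
open import Relation.Nullary using (¬_; yes; no; contradiction)
open import Relation.Unary using (Pred)

module Rational where
  open import Data.Rational.Base using (_+_; _-_; _*_; _≤_; _<_; -_; ∣_∣)

  0<1 : 0ℚ < 1ℚ
  0<1 = ℚ.positive⁻¹ 1ℚ

  0<* : ∀ {p q} → 0ℚ < p → 0ℚ < q → 0ℚ < p * q
  0<* {p} {q} 0<p 0<q = ℚ.positive⁻¹ (p * q) {{ℚ.pos*pos⇒pos p q}}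
    where instance
      _ = ℚ.positive 0<p
      _ = ℚ.positive 0<q

  ∣p-q∣≡∣q-p∣ : ∀ p q → ∣ p - q ∣ ≡ ∣ q - p ∣
  ∣p-q∣≡∣q-p∣ p q = trans (sym (ℚ.∣-p∣≡∣p∣ (p - q))) (cong ∣_∣
    (solve 2 (λ p q → :- (p :- q) := q :- p) refl p q))
    where open +-*-Solver

  p≤∣p∣ : ∀ p → p ≤ ∣ p ∣
  p≤∣p∣ p with ℚ.≤-total 0ℚ p
  ... | inj₁ 0≤p = ℚ.≤-reflexive (sym (ℚ.0≤p⇒∣p∣≡p 0≤p))
  ... | inj₂ p≤0 = ℚ.≤-trans p≤0 (ℚ.0≤∣p∣ p)

  ∣p∣≤ : ∀ {p d} → p ≤ d → - p ≤ d → ∣ p ∣ ≤ d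
  ∣p∣≤ {p} p≤d -p≤d with ℚ.∣p∣≡p∨∣p∣≡-p p
  ... | inj₁ e = subst (_≤ _) (sym e) p≤d
  ... | inj₂ e = subst (_≤ _) (sym e) -p≤d

  ∣p∣≤∣q∣+∣p-q∣ : ∀ p q → ∣ p ∣ ≤ ∣ q ∣ + ∣ p - q ∣
  ∣p∣≤∣q∣+∣p-q∣ p q = subst (λ r → ∣ r ∣ ≤ ∣ q ∣ + ∣ p - q ∣)
    (solve 2 (λ p q → q :+ (p :- q) := p) refl p q) (ℚ.∣p+q∣≤∣p∣+∣q∣ q (p - q))
    where open +-*-Solver

  p≤q+r⇒p-q≤r : ∀ {p q r} → p ≤ q + r → p - q ≤ r
  p≤q+r⇒p-q≤r {p} {q} {r} p≤ = subst (p - q ≤_)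
    (solve 2 (λ q r → q :+ r :- q := r) refl q r) (ℚ.+-monoˡ-≤ (- q) p≤)
    where open +-*-Solver

  ∣∣p∣-∣q∣∣≤∣p-q∣ : ∀ p q → ∣ ∣ p ∣ - ∣ q ∣ ∣ ≤ ∣ p - q ∣
  ∣∣p∣-∣q∣∣≤∣p-q∣ p q = ∣p∣≤ (p≤q+r⇒p-q≤r (∣p∣≤∣q∣+∣p-q∣ p q))
    (subst₂ _≤_ (solve 2 (λ p q → q :- p := :- (p :- q)) refl ∣ p ∣ ∣ q ∣) (∣p-q∣≡∣q-p∣ q p)
      (p≤q+r⇒p-q≤r (∣p∣≤∣q∣+∣p-q∣ q p)))
    where open +-*-Solver

  close : ∀ {a d p q} → a ≤ p → p ≤ a + d → a ≤ q → q ≤ a + d → ∣ p - q ∣ ≤ d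
  close {a} {d} {p} {q} a≤p p≤ a≤q q≤ = ∣p∣≤
    (p≤q+r⇒p-q≤r (ℚ.≤-trans p≤ (ℚ.+-monoˡ-≤ d a≤q)))
    (subst (_≤ d) (solve 2 (λ p q → q :- p := :- (p :- q)) refl p q)
      (p≤q+r⇒p-q≤r (ℚ.≤-trans q≤ (ℚ.+-monoˡ-≤ d a≤p))))
    where open +-*-Solver

  /1≡ : ∀ i → i ℚ./ 1 ≡ mkℚ i 0 (ℕ.sym (ℕ.1-coprimeTo ℤ.∣ i ∣))
  /1≡ i = ℚ.↥p/↧p≡p (mkℚ i 0 (ℕ.sym (ℕ.1-coprimeTo ℤ.∣ i ∣)))

  toℚᵘ-/ : ∀ i d → ℚ.toℚᵘ (i ℚ./ suc d) ℚᵘ.≃ (i ℚᵘ./ suc d)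
  toℚᵘ-/ i d = ℚ.toℚᵘ-fromℚᵘ (ℚᵘ.mkℚᵘ i d)

  below : ∀ q → ∃[ n ] q ≤ (+ n) ℚ./ 1
  below q@(mkℚ i d _) = ℤ.∣ i ∣ , subst (q ≤_) (sym (/1≡ (+ ℤ.∣ i ∣)))
    (ℚ.*≤* (ℤ.≤-trans (ℤ.≤-reflexive (ℤ.*-identityʳ i)) (lemma i)))
    where
    lemma : ∀ i → i ℤ.≤ (+ ℤ.∣ i ∣) ℤ.* (+ suc d)
    lemma (+ n) = subst (+ n ℤ.≤_) (ℤ.pos-* n (suc d)) (ℤ.+≤+ (ℕ.m≤m*n n (suc d)))
    lemma -[1+ n ] = ℤ.-≤+

  1/n<ε : ∀ {ε} → 0ℚ < ε → ∃[ n ] (+ 1) ℚ./ suc n < ε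
  1/n<ε {mkℚ (+ zero) d _} 0<ε = contradiction (ℚ.drop-*<* 0<ε) (ℤ.<-irrefl refl)
  1/n<ε {mkℚ -[1+ _ ] d _} 0<ε with () ← ℚ.drop-*<* 0<ε
  1/n<ε {mkℚ (+ suc m) d _} _ = suc d , ℚ.toℚᵘ-cancel-<
    (ℚᵘ.<-respˡ-≃ (ℚᵘ.≃-sym (toℚᵘ-/ (+ 1) (suc d)))
      (ℚᵘ.*<* (ℤ.+<+ (ℕ.<-≤-trans (ℕ.≤-reflexive (cong suc (ℕ.*-identityˡ (suc d))))
        (ℕ.m≤n*m (suc (suc d)) (suc m))))))

open Rational

Cauchy : (ℕ → ℚ) → Set
Cauchy s = ∀ ε → 0ℚ ℚ.< ε →
  ∃[ N ] (∀ m n → N ℕ.≤ m → N ℕ.≤ n → ℚ.∣ s m ℚ.- s n ∣ ℚ.< ε)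

record ℝ : Set where
  constructor mkℝ
  field
    seq    : ℕ → ℚ
    cauchy : Cauchy seq

open ℝ public

infix  4 _≃_ _<_ _≤_

_≃_ : ℝ → ℝ → Set
x ≃ y = ∀ ε → 0ℚ ℚ.< ε → ∃[ N ] (∀ n → N ℕ.≤ n → ℚ.∣ seq x n ℚ.- seq y n ∣ ℚ.< ε)

_<_ : ℝ → ℝ → Set
x < y = ∃[ ε ] (0ℚ ℚ.< ε × ∃[ N ] (∀ n → N ℕ.≤ n → seq x n ℚ.+ ε ℚ.≤ seq y n))

_≤_ : ℝ → ℝ → Set
x ≤ y = ¬ (y < x)

const-cauchy : ∀ q → Cauchy (λ _ → q)
const-cauchy q ε 0<ε = 0 , λ _ _ _ _ →
  subst (λ r → ℚ.∣ r ∣ ℚ.< ε) (sym (ℚ.+-inverseʳ q)) 0<ε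

neg-cauchy : ∀ {s} → Cauchy s → Cauchy (λ n → ℚ.- s n)
neg-cauchy {s} c ε 0<ε with N , h ← c ε 0<ε = N , λ m n N≤m N≤n →
  subst (ℚ._< ε) (eq (s m) (s n)) (h m n N≤m N≤n)
  where
  open +-*-Solver
  eq : ∀ p q → ℚ.∣ p ℚ.- q ∣ ≡ ℚ.∣ ℚ.- p ℚ.- (ℚ.- q) ∣
  eq p q = trans (∣p-q∣≡∣q-p∣ p q)
    (cong ℚ.∣_∣ (solve 2 (λ p q → q :- p := :- p :- (:- q)) refl p q))

abs-cauchy : ∀ {s} → Cauchy s → Cauchy (λ n → ℚ.∣ s n ∣)
abs-cauchy {s} c ε 0<ε with N , h ← c ε 0<ε = N , λ m n N≤m N≤n →
  ℚ.≤-<-trans (∣∣p∣-∣q∣∣≤∣p-q∣ (s m) (s n)) (h m n N≤m N≤n)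

add-cauchy : ∀ {s t} → Cauchy s → Cauchy t → Cauchy (λ n → s n ℚ.+ t n)
add-cauchy {s} {t} c d ε 0<ε
  with M , g ← c (ℚ.½ ℚ.* ε) (0<* (ℚ.positive⁻¹ ℚ.½) 0<ε)
     | N , h ← d (ℚ.½ ℚ.* ε) (0<* (ℚ.positive⁻¹ ℚ.½) 0<ε)
  = M ℕ.⊔ N , λ m n ≤m ≤n → begin-strict
    ℚ.∣ (s m ℚ.+ t m) ℚ.- (s n ℚ.+ t n) ∣
      ≡⟨ cong ℚ.∣_∣ (solve 4 (λ a b c d → (a :+ b) :- (c :+ d) := (a :- c) :+ (b :- d))
           refl (s m) (t m) (s n) (t n)) ⟩
    ℚ.∣ (s m ℚ.- s n) ℚ.+ (t m ℚ.- t n) ∣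
      ≤⟨ ℚ.∣p+q∣≤∣p∣+∣q∣ (s m ℚ.- s n) (t m ℚ.- t n) ⟩
    ℚ.∣ s m ℚ.- s n ∣ ℚ.+ ℚ.∣ t m ℚ.- t n ∣
      <⟨ ℚ.+-mono-< (g m n (ℕ.m⊔n≤o⇒m≤o M N ≤m) (ℕ.m⊔n≤o⇒m≤o M N ≤n))
                    (h m n (ℕ.m⊔n≤o⇒n≤o M N ≤m) (ℕ.m⊔n≤o⇒n≤o M N ≤n)) ⟩
    ℚ.½ ℚ.* ε ℚ.+ ℚ.½ ℚ.* ε
      ≡⟨ ℚ.*-distribʳ-+ ε ℚ.½ ℚ.½ ⟨
    1ℚ ℚ.* ε
      ≡⟨ ℚ.*-identityˡ ε ⟩
    ε ∎
  where
  open +-*-Solver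
  open ℚ.≤-Reasoning

cauchy-bounded : ∀ {s} → Cauchy s →
  ∃[ B ] (0ℚ ℚ.< B × ∃[ N ] (∀ n → N ℕ.≤ n → ℚ.∣ s n ∣ ℚ.≤ B))
cauchy-bounded {s} c with N , h ← c 1ℚ 0<1 =
  ℚ.∣ s N ∣ ℚ.+ 1ℚ ,
  ℚ.+-mono-≤-< (ℚ.0≤∣p∣ (s N)) 0<1 ,
  N , λ n N≤n → ℚ.≤-trans (∣p∣≤∣q∣+∣p-q∣ (s n) (s N))
    (ℚ.+-monoʳ-≤ ℚ.∣ s N ∣ (ℚ.<⇒≤ (h n N N≤n ℕ.≤-refl)))

mul-close : ∀ {A B δ p q r t} → 0ℚ ℚ.< A → 0ℚ ℚ.< B →
  ℚ.∣ p ∣ ℚ.≤ A → ℚ.∣ t ∣ ℚ.≤ B → ℚ.∣ p ℚ.- q ∣ ℚ.< δ → ℚ.∣ r ℚ.- t ∣ ℚ.< δ →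
  ℚ.∣ p ℚ.* r ℚ.- q ℚ.* t ∣ ℚ.< A ℚ.* δ ℚ.+ δ ℚ.* B
mul-close {A} {B} {δ} {p} {q} {r} {t} 0<A 0<B ∣p∣≤A ∣t∣≤B ∣p-q∣<δ ∣r-t∣<δ = begin-strict
  ℚ.∣ p ℚ.* r ℚ.- q ℚ.* t ∣
    ≡⟨ cong ℚ.∣_∣ (solve 4 (λ p q r t → p :* r :- q :* t := p :* (r :- t) :+ (p :- q) :* t)
         refl p q r t) ⟩
  ℚ.∣ p ℚ.* (r ℚ.- t) ℚ.+ (p ℚ.- q) ℚ.* t ∣
    ≤⟨ ℚ.∣p+q∣≤∣p∣+∣q∣ (p ℚ.* (r ℚ.- t)) ((p ℚ.- q) ℚ.* t) ⟩
  ℚ.∣ p ℚ.* (r ℚ.- t) ∣ ℚ.+ ℚ.∣ (p ℚ.- q) ℚ.* t ∣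
    ≡⟨ cong₂ ℚ._+_ (ℚ.∣p*q∣≡∣p∣*∣q∣ p (r ℚ.- t)) (ℚ.∣p*q∣≡∣p∣*∣q∣ (p ℚ.- q) t) ⟩
  ℚ.∣ p ∣ ℚ.* ℚ.∣ r ℚ.- t ∣ ℚ.+ ℚ.∣ p ℚ.- q ∣ ℚ.* ℚ.∣ t ∣
    ≤⟨ ℚ.+-mono-≤
         (ℚ.*-monoʳ-≤-nonNeg ℚ.∣ r ℚ.- t ∣ {{ℚ.∣-∣-nonNeg (r ℚ.- t)}} ∣p∣≤A)
         (ℚ.*-monoˡ-≤-nonNeg ℚ.∣ p ℚ.- q ∣ {{ℚ.∣-∣-nonNeg (p ℚ.- q)}} ∣t∣≤B) ⟩
  A ℚ.* ℚ.∣ r ℚ.- t ∣ ℚ.+ ℚ.∣ p ℚ.- q ∣ ℚ.* B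
    <⟨ ℚ.+-mono-< (ℚ.*-monoʳ-<-pos A {{ℚ.positive 0<A}} ∣r-t∣<δ)
                  (ℚ.*-monoˡ-<-pos B {{ℚ.positive 0<B}} ∣p-q∣<δ) ⟩
  A ℚ.* δ ℚ.+ δ ℚ.* B ∎
  where
  open +-*-Solver
  open ℚ.≤-Reasoning

split-ε : ∀ {A B ε} → 0ℚ ℚ.< A → 0ℚ ℚ.< B → 0ℚ ℚ.< ε →
  ∃[ δ ] (0ℚ ℚ.< δ × A ℚ.* δ ℚ.+ δ ℚ.* B ≡ ε)
split-ε {A} {B} {ε} 0<A 0<B 0<ε = helper (A ℚ.+ B) refl (ℚ.+-mono-< 0<A 0<B)
  where
  open +-*-Solver
  helper : ∀ C → A ℚ.+ B ≡ C → 0ℚ ℚ.< C → ∃[ δ ] (0ℚ ℚ.< δ × A ℚ.* δ ℚ.+ δ ℚ.* B ≡ ε)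
  helper C A+B≡C 0<C = ε ℚ.* i , 0<* 0<ε (ℚ.positive⁻¹ i {{ℚ.1/pos⇒pos C}}) ,
    trans (solve 4 (λ a b e i → a :* (e :* i) :+ (e :* i) :* b := e :* (i :* (a :+ b)))
            refl A B ε i)
      (trans (cong (λ D → ε ℚ.* (i ℚ.* D)) A+B≡C)
        (trans (cong (ε ℚ.*_) (ℚ.*-inverseˡ C)) (ℚ.*-identityʳ ε)))
    where
    instance
      C-pos : ℚ.Positive C
      C-pos = ℚ.positive 0<C
      C-nonZero : ℚ.NonZero C
      C-nonZero = ℚ.pos⇒nonZero C
    i = ℚ.1/ C

mul-cauchy : ∀ {s t} → Cauchy s → Cauchy t → Cauchy (λ n → s n ℚ.* t n)
mul-cauchy {s} {t} c d ε 0<ε = bounded (cauchy-bounded {s} c) (cauchy-bounded {t} d)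
  where
  Bounded : (ℕ → ℚ) → Set
  Bounded u = ∃[ B ] (0ℚ ℚ.< B × ∃[ N ] (∀ n → N ℕ.≤ n → ℚ.∣ u n ∣ ℚ.≤ B))

  Close : ℚ → (ℕ → ℚ) → Set
  Close δ u = ∃[ N ] (∀ m n → N ℕ.≤ m → N ℕ.≤ n → ℚ.∣ u m ℚ.- u n ∣ ℚ.< δ)

  bounded : Bounded s → Bounded t → Close ε (λ n → s n ℚ.* t n)
  bounded (A , 0<A , I , boundₛ) (B , 0<B , J , boundₜ) = split (split-ε 0<A 0<B 0<ε)
    where
    split : ∃[ δ ] (0ℚ ℚ.< δ × A ℚ.* δ ℚ.+ δ ℚ.* B ≡ ε) → Close ε (λ n → s n ℚ.* t n)
    split (δ , 0<δ , sum≡ε) = conclude (c δ 0<δ) (d δ 0<δ)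
      where
      conclude : Close δ s → Close δ t → Close ε (λ n → s n ℚ.* t n)
      conclude (M , g) (N , h) = (M ℕ.⊔ N) ℕ.⊔ (I ℕ.⊔ J) , λ m n ≤m ≤n →
        let M⊔N≤m = ℕ.m⊔n≤o⇒m≤o (M ℕ.⊔ N) (I ℕ.⊔ J) ≤m
            M⊔N≤n = ℕ.m⊔n≤o⇒m≤o (M ℕ.⊔ N) (I ℕ.⊔ J) ≤n
            I⊔J≤m = ℕ.m⊔n≤o⇒n≤o (M ℕ.⊔ N) (I ℕ.⊔ J) ≤m
            I⊔J≤n = ℕ.m⊔n≤o⇒n≤o (M ℕ.⊔ N) (I ℕ.⊔ J) ≤n
        in subst (ℚ.∣ s m ℚ.* t m ℚ.- s n ℚ.* t n ∣ ℚ.<_) sum≡ε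
          (mul-close {A} {B} {δ} {s m} {s n} {t m} {t n} 0<A 0<B
            (boundₛ m (ℕ.m⊔n≤o⇒m≤o I J I⊔J≤m)) (boundₜ n (ℕ.m⊔n≤o⇒n≤o I J I⊔J≤n))
            (g m n (ℕ.m⊔n≤o⇒m≤o M N M⊔N≤m) (ℕ.m⊔n≤o⇒m≤o M N M⊔N≤n))
            (h m n (ℕ.m⊔n≤o⇒n≤o M N M⊔N≤m) (ℕ.m⊔n≤o⇒n≤o M N M⊔N≤n)))

inverse : ℚ → ℚ
inverse q with q ℚ.≟ 0ℚ
... | yes _  = 0ℚ
... | no q≢0 = (ℚ.1/ q) {{ℚ.≢-nonZero q≢0}}

*-inverse : ∀ {q} → 0ℚ ℚ.< q → inverse q ℚ.* q ≡ 1ℚ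
*-inverse {q} 0<q with q ℚ.≟ 0ℚ
... | yes q≡0 = contradiction (sym q≡0) (ℚ.<⇒≢ 0<q)
... | no  q≢0 = ℚ.*-inverseˡ q {{ℚ.≢-nonZero q≢0}}

inverse-close : ∀ {e ε p q u v} → 0ℚ ℚ.< e → 0ℚ ℚ.< ε → e ℚ.≤ p → e ℚ.≤ q →
  u ℚ.* p ≡ 1ℚ → v ℚ.* q ≡ 1ℚ →
  ℚ.∣ p ℚ.- q ∣ ℚ.< ε ℚ.* (e ℚ.* e) → ℚ.∣ u ℚ.- v ∣ ℚ.< ε
inverse-close {e} {ε} {p} {q} {u} {v} 0<e 0<ε e≤p e≤q up≡1 vq≡1 ∣p-q∣< =
  ℚ.*-cancelʳ-<-nonNeg (p ℚ.* q) (begin-strict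
    ℚ.∣ u ℚ.- v ∣ ℚ.* (p ℚ.* q)
      ≡⟨ cong (ℚ.∣ u ℚ.- v ∣ ℚ.*_) (ℚ.0≤p⇒∣p∣≡p (ℚ.<⇒≤ 0<pq)) ⟨
    ℚ.∣ u ℚ.- v ∣ ℚ.* ℚ.∣ p ℚ.* q ∣
      ≡⟨ ℚ.∣p*q∣≡∣p∣*∣q∣ (u ℚ.- v) (p ℚ.* q) ⟨
    ℚ.∣ (u ℚ.- v) ℚ.* (p ℚ.* q) ∣
      ≡⟨ cong ℚ.∣_∣ (solve 4 (λ u v p q → (u :- v) :* (p :* q) := (u :* p) :* q :- (v :* q) :* p)
           refl u v p q) ⟩
    ℚ.∣ (u ℚ.* p) ℚ.* q ℚ.- (v ℚ.* q) ℚ.* p ∣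
      ≡⟨ cong₂ (λ a b → ℚ.∣ a ℚ.* q ℚ.- b ℚ.* p ∣) up≡1 vq≡1 ⟩
    ℚ.∣ 1ℚ ℚ.* q ℚ.- 1ℚ ℚ.* p ∣
      ≡⟨ cong₂ (λ a b → ℚ.∣ a ℚ.- b ∣) (ℚ.*-identityˡ q) (ℚ.*-identityˡ p) ⟩
    ℚ.∣ q ℚ.- p ∣
      ≡⟨ ∣p-q∣≡∣q-p∣ q p ⟩
    ℚ.∣ p ℚ.- q ∣
      <⟨ ∣p-q∣< ⟩
    ε ℚ.* (e ℚ.* e)
      ≤⟨ ℚ.*-monoˡ-≤-nonNeg ε (ℚ.≤-trans (ℚ.*-monoˡ-≤-nonNeg e e≤q) (ℚ.*-monoʳ-≤-nonNeg q e≤p)) ⟩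
    ε ℚ.* (p ℚ.* q) ∎)
  where
  open +-*-Solver
  open ℚ.≤-Reasoning
  0<p = ℚ.<-≤-trans 0<e e≤p
  0<q = ℚ.<-≤-trans 0<e e≤q
  0<pq = 0<* 0<p 0<q
  instance
    nonNeg-e : ℚ.NonNegative e
    nonNeg-e = ℚ.nonNegative (ℚ.<⇒≤ 0<e)
    nonNeg-ε : ℚ.NonNegative ε
    nonNeg-ε = ℚ.nonNegative (ℚ.<⇒≤ 0<ε)
    nonNeg-q : ℚ.NonNegative q
    nonNeg-q = ℚ.nonNegative (ℚ.<⇒≤ 0<q)
    nonNeg-pq : ℚ.NonNegative (p ℚ.* q)
    nonNeg-pq = ℚ.nonNegative (ℚ.<⇒≤ 0<pq)

inverse-cauchy : ∀ {s e N} → Cauchy s → 0ℚ ℚ.< e → (∀ n → N ℕ.≤ n → e ℚ.≤ s n) →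
  Cauchy (λ n → inverse (s n))
inverse-cauchy {s} {e} {N} c 0<e e≤s ε 0<ε
  with M , h ← c (ε ℚ.* (e ℚ.* e)) (0<* 0<ε (0<* 0<e 0<e))
  = M ℕ.⊔ N , λ m n ≤m ≤n → inverse-close {e} {ε} {s m} {s n} {inverse (s m)} {inverse (s n)} 0<e 0<ε
      (e≤s m (ℕ.m⊔n≤o⇒n≤o M N ≤m)) (e≤s n (ℕ.m⊔n≤o⇒n≤o M N ≤n))
      (*-inverse (ℚ.<-≤-trans 0<e (e≤s m (ℕ.m⊔n≤o⇒n≤o M N ≤m))))
      (*-inverse (ℚ.<-≤-trans 0<e (e≤s n (ℕ.m⊔n≤o⇒n≤o M N ≤n))))
      (h m n (ℕ.m⊔n≤o⇒m≤o M N ≤m) (ℕ.m⊔n≤o⇒m≤o M N ≤n))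

infix  8 -_
infixl 7 _*_
infixl 6 _+_ _-_

fromℚ : ℚ → ℝ
fromℚ q = mkℝ (λ _ → q) (const-cauchy q)

fromℤ : ℤ → ℝ
fromℤ i = fromℚ (i ℚ./ 1)

fromℕ : ℕ → ℝ
fromℕ n = fromℤ (+ n)

0ℝ 1ℝ : ℝ
0ℝ = fromℕ 0
1ℝ = fromℕ 1

_+_ : ℝ → ℝ → ℝ
x + y = mkℝ (λ n → seq x n ℚ.+ seq y n) (add-cauchy {seq x} {seq y} (cauchy x) (cauchy y))

-_ : ℝ → ℝ
- x = mkℝ (λ n → ℚ.- seq x n) (neg-cauchy {seq x} (cauchy x))

_-_ : ℝ → ℝ → ℝ
x - y = x + (- y)

_*_ : ℝ → ℝ → ℝ
x * y = mkℝ (λ n → seq x n ℚ.* seq y n) (mul-cauchy {seq x} {seq y} (cauchy x) (cauchy y))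

∣_∣ : ℝ → ℝ
∣ x ∣ = mkℝ (λ n → ℚ.∣ seq x n ∣) (abs-cauchy {seq x} (cauchy x))

-- The sequence of a positive real may vanish at finitely many places,
-- which is why the total function inverse is used termwise.
recip : (x : ℝ) → 0ℝ < x → ℝ
recip x (e , 0<e , N , h) = mkℝ (λ n → inverse (seq x n))
  (inverse-cauchy {seq x} (cauchy x) 0<e
    (λ n N≤n → subst (ℚ._≤ seq x n) (ℚ.+-identityˡ e) (h n N≤n)))

Irrational : ℝ → Set
Irrational x = ∀ q → ¬ (x ≃ fromℚ q)

ζ-term : (s n : ℕ) → ℚ
ζ-term s n = ((+ 1) ℚ./ (suc n ℕ.^ s)) {{ℕ.m^n≢0 (suc n) s}}

ζ-partial : (s N : ℕ) → ℚ
ζ-partial s zero    = 0ℚ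
ζ-partial s (suc N) = ζ-partial s N ℚ.+ ζ-term s N

0<ζ-term : ∀ s n → 0ℚ ℚ.< ζ-term s n
0<ζ-term s n = ℚ.positive⁻¹ (ζ-term s n) {{ℚ.normalize-pos 1 (suc n ℕ.^ s) {{ℕ.m^n≢0 (suc n) s}}}}

ζ-partial-step : ∀ s n → ζ-partial s n ℚ.≤ ζ-partial s (suc n)
ζ-partial-step s n = subst (ℚ._≤ ζ-partial s (suc n)) (ℚ.+-identityʳ (ζ-partial s n))
  (ℚ.+-monoʳ-≤ (ζ-partial s n) (ℚ.<⇒≤ (0<ζ-term s n)))

ζ-partial-mono : ∀ s m d → ζ-partial s m ℚ.≤ ζ-partial s (d ℕ.+ m)
ζ-partial-mono s m zero    = ℚ.≤-refl
ζ-partial-mono s m (suc d) = ℚ.≤-trans (ζ-partial-mono s m d) (ζ-partial-step s (d ℕ.+ m))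

1/-antimono : ∀ m n .{{_ : ℕ.NonZero m}} .{{_ : ℕ.NonZero n}} → m ℕ.≤ n →
  (+ 1) ℚ./ n ℚ.≤ (+ 1) ℚ./ m
1/-antimono (suc m) (suc n) m≤n = ℚ.toℚᵘ-cancel-≤
  (ℚᵘ.≤-respˡ-≃ (ℚᵘ.≃-sym (toℚᵘ-/ (+ 1) n)) (ℚᵘ.≤-respʳ-≃ (ℚᵘ.≃-sym (toℚᵘ-/ (+ 1) m))
    (ℚᵘ.*≤* (ℤ.+≤+ (ℕ.*-monoʳ-≤ 1 m≤n)))))

telescope₂ : ∀ n → (+ 1) ℚ./ (suc (suc n) ℕ.* suc (suc n)) ℚ.+ (+ 1) ℚ./ suc (suc n)
                   ℚ.≤ (+ 1) ℚ./ suc n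
telescope₂ n = ℚ.toℚᵘ-cancel-≤
  (ℚᵘ.≤-respˡ-≃ (ℚᵘ.≃-sym (ℚᵘ.≃-trans
      (ℚ.toℚᵘ-homo-+ ((+ 1) ℚ./ (m ℕ.* m)) ((+ 1) ℚ./ m))
      (ℚᵘ.+-cong (toℚᵘ-/ (+ 1) (ℕ.pred (m ℕ.* m))) (toℚᵘ-/ (+ 1) (suc n)))))
    (ℚᵘ.≤-respʳ-≃ (ℚᵘ.≃-sym (toℚᵘ-/ (+ 1) n))
      (ℚᵘ.*≤* (ℤ.+≤+ (subst₂ ℕ._≤_ (sym (lhs n)) (sym (rhs n)) (ℕ.m≤m+n _ (suc (suc n))))))))
  where
  m = suc (suc n)
  lhs : ∀ n → let m = suc (suc n) in
    (1 ℕ.* m ℕ.+ 1 ℕ.* (m ℕ.* m)) ℕ.* suc n ≡ m ℕ.* (suc n ℕ.* suc (suc (suc n)))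
  lhs = ℕ-Solver.solve-∀
  rhs : ∀ n → let m = suc (suc n) in
    1 ℕ.* ((m ℕ.* m) ℕ.* m) ≡ m ℕ.* (suc n ℕ.* suc (suc (suc n))) ℕ.+ suc (suc n)
  rhs = ℕ-Solver.solve-∀

telescope : ∀ s .{{_ : ℕ.NonTrivial s}} n →
  ζ-term s (suc n) ℚ.+ (+ 1) ℚ./ suc (suc n) ℚ.≤ (+ 1) ℚ./ suc n
telescope s n = ℚ.≤-trans
  (ℚ.+-monoˡ-≤ ((+ 1) ℚ./ m) (1/-antimono (m ℕ.* m) (m ℕ.^ s) {{_}} {{ℕ.m^n≢0 m s}}
    (subst (ℕ._≤ m ℕ.^ s) (cong (m ℕ.*_) (ℕ.*-identityʳ m))
      (ℕ.^-monoʳ-≤ m (ℕ.nonTrivial⇒n>1 s)))))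
  (telescope₂ n)
  where m = suc (suc n)

ζ-tail : ∀ s .{{_ : ℕ.NonTrivial s}} N d →
  ζ-partial s (d ℕ.+ suc N) ℚ.+ (+ 1) ℚ./ suc (d ℕ.+ N) ℚ.≤ ζ-partial s (suc N) ℚ.+ (+ 1) ℚ./ suc N
ζ-tail s N zero    = ℚ.≤-refl
ζ-tail s N (suc d) = ℚ.≤-trans
  (ℚ.≤-trans (ℚ.≤-reflexive (ℚ.+-assoc (ζ-partial s (d ℕ.+ suc N)) (ζ-term s (d ℕ.+ suc N)) _))
    (ℚ.+-monoʳ-≤ (ζ-partial s (d ℕ.+ suc N))
      (subst (λ i → ζ-term s i ℚ.+ (+ 1) ℚ./ suc (suc (d ℕ.+ N)) ℚ.≤ (+ 1) ℚ./ suc (d ℕ.+ N))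
        (sym (ℕ.+-suc d N)) (telescope s (d ℕ.+ N)))))
  (ζ-tail s N d)

ζ-upper : ∀ s .{{_ : ℕ.NonTrivial s}} N d →
  ζ-partial s (d ℕ.+ suc N) ℚ.≤ ζ-partial s (suc N) ℚ.+ (+ 1) ℚ./ suc N
ζ-upper s N d = ℚ.≤-trans
  (subst (ℚ._≤ ζ-partial s (d ℕ.+ suc N) ℚ.+ (+ 1) ℚ./ suc (d ℕ.+ N))
    (ℚ.+-identityʳ (ζ-partial s (d ℕ.+ suc N)))
    (ℚ.+-monoʳ-≤ (ζ-partial s (d ℕ.+ suc N))
      (ℚ.<⇒≤ (ℚ.positive⁻¹ ((+ 1) ℚ./ suc (d ℕ.+ N)) {{ℚ.normalize-pos 1 (suc (d ℕ.+ N))}}))))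
  (ζ-tail s N d)

ζ-cauchy : ∀ s .{{_ : ℕ.NonTrivial s}} → Cauchy (ζ-partial s)
ζ-cauchy s ε 0<ε with N , 1/N<ε ← 1/n<ε 0<ε = suc N , λ m n ≤m ≤n →
  ℚ.≤-<-trans (close (lower m ≤m) (upper m ≤m) (lower n ≤n) (upper n ≤n)) 1/N<ε
  where
  lower : ∀ m → suc N ℕ.≤ m → ζ-partial s (suc N) ℚ.≤ ζ-partial s m
  lower m N<m = subst (λ i → ζ-partial s (suc N) ℚ.≤ ζ-partial s i) (ℕ.m∸n+n≡m N<m)
    (ζ-partial-mono s (suc N) (m ℕ.∸ suc N))
  upper : ∀ m → suc N ℕ.≤ m → ζ-partial s m ℚ.≤ ζ-partial s (suc N) ℚ.+ (+ 1) ℚ./ suc N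
  upper m N<m = subst (λ i → ζ-partial s i ℚ.≤ ζ-partial s (suc N) ℚ.+ (+ 1) ℚ./ suc N)
    (ℕ.m∸n+n≡m N<m) (ζ-upper s N (m ℕ.∸ suc N))

-- A Cauchy sequence of rationals represents its own limit, so this is
-- the sum of the series ∑ 1/nˢ.
ζ : (s : ℕ) .{{_ : ℕ.NonTrivial s}} → ℝ
ζ s = mkℝ (ζ-partial s) (ζ-cauchy s)

0<ζ : ∀ s .{{_ : ℕ.NonTrivial s}} → 0ℝ < ζ s
0<ζ s = ζ-term s 0 , 0<ζ-term s 0 , 1 , λ n 1≤n →
  subst (λ i → ζ-partial s 1 ℚ.≤ ζ-partial s i) (ℕ.m∸n+n≡m 1≤n) (ζ-partial-mono s 1 (n ℕ.∸ 1))

neg-/1 : ∀ n → ℤ.- (+ n) ℚ./ 1 ≡ ℚ.- ((+ n) ℚ./ 1)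
neg-/1 zero    = refl
neg-/1 (suc _) = refl

suc-/1 : ∀ n → (+ suc n) ℚ./ 1 ≡ (+ n) ℚ./ 1 ℚ.+ 1ℚ
suc-/1 n = ℚ.toℚᵘ-injective (ℚᵘ.≃-trans (toℚᵘ-/ (+ suc n) 0) (ℚᵘ.≃-sym (ℚᵘ.≃-trans
  (ℚ.toℚᵘ-homo-+ ((+ n) ℚ./ 1) 1ℚ)
  (ℚᵘ.≃-trans (ℚᵘ.+-congˡ ℚᵘ.1ℚᵘ (toℚᵘ-/ (+ n) 0)) (ℚᵘ.*≡* (lemma (+ n)))))))
  where
  lemma : ∀ i → (i ℤ.* ℤ.1ℤ ℤ.+ ℤ.1ℤ ℤ.* ℤ.1ℤ) ℤ.* ℤ.1ℤ ≡ (ℤ.1ℤ ℤ.+ i) ℤ.* ℤ.1ℤ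
  lemma = solve-∀

-∣p∣≤p : ∀ p → ℚ.- ℚ.∣ p ∣ ℚ.≤ p
-∣p∣≤p p = subst₂ (λ a b → ℚ.- a ℚ.≤ b) (ℚ.∣-p∣≡∣p∣ p)
  (solve 1 (λ p → :- (:- p) := p) refl p) (ℚ.neg-antimono-≤ (p≤∣p∣ (ℚ.- p)))
  where open +-*-Solver

module _ (x : ℝ) {B : ℚ} {N n : ℕ} (bound : ∀ k → N ℕ.≤ k → ℚ.∣ seq x k ∣ ℚ.≤ B)
         (B≤n : B ℚ.≤ (+ n) ℚ./ 1) where
  open ℚ.≤-Reasoning

  fromℤ-lower : fromℤ (ℤ.- (+ n)) ≤ x
  fromℤ-lower (ε , 0<ε , M , h) = ℚ.<-irrefl refl (begin-strict
    seq x k             ≡⟨ ℚ.+-identityʳ (seq x k) ⟨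
    seq x k ℚ.+ 0ℚ      <⟨ ℚ.+-monoʳ-< (seq x k) 0<ε ⟩
    seq x k ℚ.+ ε       ≤⟨ h k (ℕ.m≤n⊔m N M) ⟩
    ℤ.- (+ n) ℚ./ 1     ≡⟨ neg-/1 n ⟩
    ℚ.- ((+ n) ℚ./ 1)   ≤⟨ ℚ.neg-antimono-≤ B≤n ⟩
    ℚ.- B               ≤⟨ ℚ.neg-antimono-≤ (bound k (ℕ.m≤m⊔n N M)) ⟩
    ℚ.- ℚ.∣ seq x k ∣   ≤⟨ -∣p∣≤p (seq x k) ⟩
    seq x k             ∎)
    where k = N ℕ.⊔ M

  fromℤ-upper : x < fromℤ (ℤ.- (+ n) ℤ.+ + suc (n ℕ.+ n))
  fromℤ-upper = subst (λ i → x < fromℤ i) (sym (lemma (+ n)))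
    (1ℚ , 0<1 , N , λ k N≤k → begin
      seq x k ℚ.+ 1ℚ          ≤⟨ ℚ.+-monoˡ-≤ 1ℚ (p≤∣p∣ (seq x k)) ⟩
      ℚ.∣ seq x k ∣ ℚ.+ 1ℚ    ≤⟨ ℚ.+-monoˡ-≤ 1ℚ (bound k N≤k) ⟩
      B ℚ.+ 1ℚ                ≤⟨ ℚ.+-monoˡ-≤ 1ℚ B≤n ⟩
      (+ n) ℚ./ 1 ℚ.+ 1ℚ      ≡⟨ suc-/1 n ⟨
      (+ suc n) ℚ./ 1         ∎)
    where
    lemma : ∀ i → ℤ.- i ℤ.+ (ℤ.1ℤ ℤ.+ (i ℤ.+ i)) ≡ ℤ.1ℤ ℤ.+ i
    lemma = solve-∀

integer-bounds : ∀ x → ∃[ n ] (fromℤ (ℤ.- (+ n)) ≤ x × x < fromℤ (ℤ.- (+ n) ℤ.+ + suc (n ℕ.+ n)))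
integer-bounds x = bounded (cauchy-bounded {seq x} (cauchy x))
  where
  Goal = ∃[ n ] (fromℤ (ℤ.- (+ n)) ≤ x × x < fromℤ (ℤ.- (+ n) ℤ.+ + suc (n ℕ.+ n)))
  bounded : ∃[ B ] (0ℚ ℚ.< B × ∃[ N ] (∀ k → N ℕ.≤ k → ℚ.∣ seq x k ∣ ℚ.≤ B)) → Goal
  bounded (B , _ , N , bound) = conclude (below B)
    where
    conclude : ∃[ n ] B ℚ.≤ (+ n) ℚ./ 1 → Goal
    conclude (n , B≤n) = n , fromℤ-lower x {B} {N} {n} bound B≤n , fromℤ-upper x {B} {N} {n} bound B≤n

-- The reals have no computable integer part, and membership in an
-- arbitrary set cannot be decided, so the ambient classical logic is made
-- explicit as the parameter em.
module Classical (em : ExcludedMiddle 0ℓ) where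

  floor-search : ∀ x m i → fromℤ i ≤ x → x < fromℤ (i ℤ.+ + m) →
    ∃[ j ] (fromℤ j ≤ x × x < fromℤ (j ℤ.+ ℤ.1ℤ))
  floor-search x zero    i i≤x x<i =
    contradiction (subst (λ j → x < fromℤ j) (ℤ.+-identityʳ i) x<i) i≤x
  floor-search x (suc m) i i≤x x<i+1+m with em {x < fromℤ (i ℤ.+ ℤ.1ℤ)}
  ... | yes x<i+1 = i , i≤x , x<i+1
  ... | no  i+1≤x = floor-search x m (i ℤ.+ ℤ.1ℤ) i+1≤x
    (subst (λ j → x < fromℤ j) (sym (ℤ.+-assoc i ℤ.1ℤ (+ m))) x<i+1+m)

  floor-exists : ∀ x → ∃[ i ] (fromℤ i ≤ x × x < fromℤ (i ℤ.+ ℤ.1ℤ))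
  floor-exists x =
    let n , lower , upper = integer-bounds x
    in floor-search x (suc (n ℕ.+ n)) (ℤ.- (+ n)) lower upper

  ⌊_⌋ : ℝ → ℤ
  ⌊ x ⌋ = proj₁ (floor-exists x)

  frac : ℝ → ℝ
  frac x = x - fromℤ ⌊ x ⌋

  -- Sets of positive integers are predicates on ℕ whose value at 0 is
  -- never consulted: applyUpTo suc N lists 1, …, N.
  count : Pred ℕ 0ℓ → ℕ → ℕ
  count A N = length (filter (λ n → em {A n}) (applyUpTo suc N))

  HasDensity : Pred ℕ 0ℓ → ℝ → Set
  HasDensity A d = ∀ ε → 0ℝ < ε →
    ∃[ N₀ ] (∀ N .{{_ : ℕ.NonZero N}} → N₀ ℕ.≤ N →
      ∣ fromℚ ((+ count A N) ℚ./ N) - d ∣ < ε)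

  -- The side condition says that ∏ [aᵢ , bᵢ) is a box inside [0 , 1)ᵏ;
  -- aᵢ ≤ bᵢ is what makes bᵢ − aᵢ its i-th side length.
  -- As above, sequences (xₙ)_{n ≥ 1} are functions on ℕ whose value at
  -- 0 is irrelevant.
  Equidistributed : ∀ {k} → (ℕ → Vector ℝ k) → Set
  Equidistributed {k} x = (a b : Vector ℝ k) →
    (∀ i → 0ℝ ≤ a i × a i ≤ b i × b i ≤ 1ℝ) →
    HasDensity (λ n → ∀ i → a i ≤ frac (x n i) × frac (x n i) < b i)
               (foldr _*_ 1ℝ (λ i → b i - a i))

  TotallyHomogeneouslyEquidistributed : ∀ {k} → (ℕ → Vector ℝ k) → Set
  TotallyHomogeneouslyEquidistributed x =
    (D b : ℕ) .{{_ : ℕ.NonZero D}} .{{_ : ℕ.NonZero b}} →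
    Equidistributed (λ n i → fromℚ ((+ 1) ℚ./ D) * x (D ℕ.* n ℕ.+ b) i)

  gcdWithFloors : ∀ {k} → ℕ → Vector ℝ k → ℤ
  gcdWithFloors n y = foldr ℤ.gcd (+ n) (λ i → ⌊ y i ⌋)

{-# OPTIONS --safe #-}

-- Put s = k + 1, aₙ = ⌊f₁(n)⌋ and let Gₙ be the gcd in question. Equidistribution of
-- x_{dn+d}/d in the box [0 , 1/d)ᵏ says that d ∣ Gₙ has density d⁻ˢ, since {x/d} < 1/d
-- iff d ∣ ⌊x⌋. Let v_j(g) = ∏_{2 ≤ e ≤ j+1} (1 − [e ∣ g]). Expanding the product by
-- [d ∣ g][e ∣ g] = [lcm(d,e) ∣ g], the mean c of v_j(Gₙ) exists, and since
-- ∑_{d ∣ g} g⁻ˢ = d⁻ˢ ζ(s) the same expansion gives ∑ v_j(g) g⁻ˢ = c ζ(s). That series is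
-- 1 + O(1/j), because v_j is 1 at 1 and vanishes on 2, …, j+1; hence c → 1/ζ(s).
--
-- It remains to see that Gₙ > D is rare for large D, for which the linearity of f₁ is
-- needed. Let n ∈ (N/h , N] and g = gcd(n , aₙ) > D. All the fractions aₙ/n lie in an
-- interval of length O(h/N) about α, and their denominators are n/g. If g > N/h the
-- denominator is below h, which is impossible for large N because α is irrational. For
-- fixed g ≤ N/h the fractions are g²/N²-separated, so there are at most 1 + O(hN/g²) of
-- them, and summing over D < g ≤ N/h leaves N/h + O(hN/D).

module Submission where

open import Axiom.ExcludedMiddle using (ExcludedMiddle)
open import Data.Fin.Base using (Fin; zero; suc)
open import Data.Integer.Base as ℤ using (ℤ; +_; -[1+_]; 1ℤ)
import Data.Integer.Divisibility.Signed as ℤ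
import Data.Integer.Properties as ℤ
open import Data.Integer.Tactic.RingSolver using (solve-∀)
open import Data.List.Base using (applyUpTo; filter; length; _∷ʳ_; _++_; []; _∷_)
import Data.List.Properties as List
open import Data.Nat.Base as ℕ using (ℕ; zero; suc; z≤n; s≤s; NonZero)
import Data.Nat.Divisibility as ℕ
import Data.Nat.DivMod as ℕ
import Data.Nat.GCD as ℕ
import Data.Nat.LCM as ℕ
import Data.Nat.Properties as ℕ
import Data.Nat.Tactic.RingSolver as ℕ-Solver
open import Data.Product.Base using (∃-syntax; _×_; _,_; proj₁; proj₂)
open import Data.Rational.Base as ℚ using (ℚ; 0ℚ; 1ℚ)
import Data.Rational.Properties as ℚ
open import Data.Rational.Solver using (module +-*-Solver)
import Data.Rational.Unnormalised.Base as ℚᵘ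
import Data.Rational.Unnormalised.Properties as ℚᵘ
open import Data.Sum.Base using (inj₁; inj₂)
open import Data.Vec.Functional using (Vector; foldr)
open import Level using (0ℓ)
open import Relation.Binary.PropositionalEquality
open import Relation.Nullary using (¬_; Dec; yes; no; contradiction)
open import Relation.Nullary.Decidable using (_×-dec_)
open import Relation.Unary using (Pred)
open import Defs using (Cauchy; ζ-partial; ζ-term; 0<ζ-term; ζ-upper; ζ-cauchy; ζ-partial-mono; 1/-antimono; module Rational)
open Rational

-- The difficulty is uniformity in d. Equidistribution treats each d separately and without a rate,
-- so only finitely many d can be sieved at once, and the n that slip through need a bound of
-- another kind. It is obtained for gcd(n , aₙ), which Gₙ divides. The sieve runs over all e, prime
-- or not: divisibility indicators are closed under products through lcm, so no factorisation
-- appears, and the mean c is never computed, only recognised again on the ζ side. One parameter h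
-- controls every error. The level D is a function of h alone and serves both as the threshold for
-- large divisors and as the level at which the sieve stops. From α n + β the divisor count retains
-- two facts about integers: |aₙ m - aₘ n| ≤ K (n + m), and for each Q ≥ 1, n divides Q aₙ for no
-- large n. As α is absent from both, the interval is centred at a_N/N. Likewise ζ(s) is handled
-- through partial sums up to a cutoff X that is independent of N.

module Counting where

  -- Counting in ℕ: sums, fibres, rounded quotients.

  open import Data.Nat.Base using (_+_; _*_; _∸_; _≤_; _<_)

  -- Sums run over 1, …, N.
  ∑ : (ℕ → ℕ) → ℕ → ℕ
  ∑ φ zero    = 0
  ∑ φ (suc N) = ∑ φ N + φ (suc N)

  ∑-mono : ∀ {φ ψ} N → (∀ n → 1 ≤ n → n ≤ N → φ n ≤ ψ n) → ∑ φ N ≤ ∑ ψ N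
  ∑-mono zero    φ≤ψ = z≤n
  ∑-mono (suc N) φ≤ψ = ℕ.+-mono-≤ (∑-mono N λ n 1≤n n≤N → φ≤ψ n 1≤n (ℕ.m≤n⇒m≤1+n n≤N))
    (φ≤ψ (suc N) (s≤s z≤n) ℕ.≤-refl)

  ∑-+ : ∀ φ ψ N → ∑ (λ n → φ n + ψ n) N ≡ ∑ φ N + ∑ ψ N
  ∑-+ φ ψ zero    = refl
  ∑-+ φ ψ (suc N) = trans (cong (_+ (φ (suc N) + ψ (suc N))) (∑-+ φ ψ N))
    (interchange (∑ φ N) (∑ ψ N) (φ (suc N)) (ψ (suc N)))
    where
    interchange : ∀ a b c d → (a + b) + (c + d) ≡ (a + c) + (b + d)
    interchange = ℕ-Solver.solve-∀

  ∑-const : ∀ c N → ∑ (λ _ → c) N ≡ N * c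
  ∑-const c zero    = refl
  ∑-const c (suc N) = trans (cong (_+ c) (∑-const c N)) (ℕ.+-comm (N * c) c)

  ∑-swap : ∀ (φ : ℕ → ℕ → ℕ) M N → ∑ (λ n → ∑ (φ n) M) N ≡ ∑ (λ m → ∑ (λ n → φ n m) N) M
  ∑-swap φ M zero    = sym (trans (∑-const 0 M) (ℕ.*-zeroʳ M))
  ∑-swap φ M (suc N) = trans (cong (_+ ∑ (φ (suc N)) M) (∑-swap φ M N))
    (sym (∑-+ (λ m → ∑ (λ n → φ n m) N) (φ (suc N)) M))

  term≤∑ : ∀ φ {j} M → 1 ≤ j → j ≤ M → φ j ≤ ∑ φ M
  term≤∑ φ zero    1≤j j≤0 = contradiction (ℕ.≤-trans 1≤j j≤0) λ ()
  term≤∑ φ (suc M) 1≤j j≤1+M with ℕ.m≤n⇒m<n∨m≡n j≤1+M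
  ... | inj₁ (s≤s j≤M) = ℕ.≤-trans (term≤∑ φ M 1≤j j≤M) (ℕ.m≤m+n _ _)
  ... | inj₂ refl      = ℕ.m≤n+m _ (∑ φ M)

  ind : ∀ {a} {A : Set a} → Dec A → ℕ
  ind (yes _) = 1
  ind (no _)  = 0

  ind-mono : ∀ {a b} {A : Set a} {B : Set b} (A? : Dec A) (B? : Dec B) → (A → B) → ind A? ≤ ind B?
  ind-mono (no _)  B?      f = z≤n
  ind-mono (yes a) (yes b) f = ℕ.≤-refl
  ind-mono (yes a) (no ¬b) f = contradiction (f a) ¬b

  ind-yes : ∀ {a} {A : Set a} (A? : Dec A) → A → ind A? ≡ 1
  ind-yes (yes _) _ = refl
  ind-yes (no ¬a) a = contradiction a ¬a

  ind-no : ∀ {a} {A : Set a} (A? : Dec A) → ¬ A → ind A? ≡ 0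
  ind-no (yes a) ¬a = contradiction a ¬a
  ind-no (no _)  _  = refl

  module _ {p} {P : ℕ → Set p} (P? : ∀ n → Dec (P n)) where

    ∑-ind-unique : ∀ N → (∀ m n → 1 ≤ m → m ≤ N → 1 ≤ n → n ≤ N → P m → P n → m ≡ n) →
      ∑ (λ n → ind (P? n)) N ≤ 1
    ∑-ind-unique zero    unique = z≤n
    ∑-ind-unique (suc N) unique with P? (suc N)
    ... | no  _ = subst (_≤ 1) (sym (ℕ.+-identityʳ _)) (∑-ind-unique N λ m n 1≤m m≤N 1≤n n≤N →
      unique m n 1≤m (ℕ.m≤n⇒m≤1+n m≤N) 1≤n (ℕ.m≤n⇒m≤1+n n≤N))
    ... | yes p = subst (_≤ 1) (ℕ.+-comm 1 _) (s≤s (ℕ.≤-trans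
      (∑-mono N λ n 1≤n n≤N → ℕ.≤-reflexive (ind-no (P? n) λ pn →
        ℕ.<⇒≢ (s≤s n≤N) (unique n (suc N) 1≤n (ℕ.m≤n⇒m≤1+n n≤N) (s≤s z≤n) ℕ.≤-refl pn p)))
      (ℕ.≤-reflexive (trans (∑-const 0 N) (ℕ.*-zeroʳ N)))))

  module _ {p} {P : ℕ → Set p} (P? : ∀ n → Dec (P n)) where

    -- Each n with `P n` is charged to the value `κ n`; exchanging the two sums then counts fibre by
    -- fibre.
    ∑-ind-fibre : ∀ (κ c : ℕ → ℕ) M N →
      (∀ n → 1 ≤ n → n ≤ N → P n → 1 ≤ κ n × κ n ≤ M) →
      (∀ j → 1 ≤ j → j ≤ M → ∑ (λ n → ind (P? n ×-dec (κ n ℕ.≟ j))) N ≤ c j) →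
      ∑ (λ n → ind (P? n)) N ≤ ∑ c M
    ∑-ind-fibre κ c M N κ∈ fibre≤ = begin
      ∑ (λ n → ind (P? n)) N                                       ≤⟨ ∑-mono N pointwise ⟩
      ∑ (λ n → ∑ (λ j → ind (P? n ×-dec (κ n ℕ.≟ j))) M) N         ≡⟨ ∑-swap _ M N ⟩
      ∑ (λ j → ∑ (λ n → ind (P? n ×-dec (κ n ℕ.≟ j))) N) M         ≤⟨ ∑-mono M fibre≤ ⟩
      ∑ c M                                                        ∎
      where
      open ℕ.≤-Reasoning
      pointwise : ∀ n → 1 ≤ n → n ≤ N → ind (P? n) ≤ ∑ (λ j → ind (P? n ×-dec (κ n ℕ.≟ j))) M
      pointwise n 1≤n n≤N with P? n in eq
      ... | no  _ = z≤n
      ... | yes p = let 1≤κ , κ≤M = κ∈ n 1≤n n≤N p in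
        ℕ.≤-trans (ℕ.≤-reflexive (sym (ind-yes (yes p ×-dec (κ n ℕ.≟ κ n)) (p , refl))))
          (term≤∑ (λ j → ind (yes p ×-dec (κ n ℕ.≟ j))) M 1≤κ κ≤M)

    ∑-ind-injective : ∀ (κ : ℕ → ℕ) M N →
      (∀ n → 1 ≤ n → n ≤ N → P n → 1 ≤ κ n × κ n ≤ M) →
      (∀ m n → 1 ≤ m → m ≤ N → 1 ≤ n → n ≤ N → P m → P n → κ m ≡ κ n → m ≡ n) →
      ∑ (λ n → ind (P? n)) N ≤ M
    ∑-ind-injective κ M N κ∈ injective = ℕ.≤-trans
      (∑-ind-fibre κ (λ _ → 1) M N κ∈ λ j _ _ → ∑-ind-unique (λ n → P? n ×-dec (κ n ℕ.≟ j)) N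
        λ m n 1≤m m≤N 1≤n n≤N (pm , κm≡j) (pn , κn≡j) →
          injective m n 1≤m m≤N 1≤n n≤N pm pn (trans κm≡j (sym κn≡j)))
      (ℕ.≤-reflexive (trans (∑-const 1 M) (ℕ.*-identityʳ M)))

  quot : ℕ → ℕ → ℕ
  quot x zero    = 0
  quot x (suc d) = x ℕ./ suc d

  quot*≤ : ∀ x d → quot x d * d ≤ x
  quot*≤ x zero    = z≤n
  quot*≤ x (suc d) = ℕ.m/n*n≤m x (suc d)

  <suc-quot* : ∀ x {d} → 1 ≤ d → x < suc (quot x d) * d
  <suc-quot* x {suc d} _ = subst (_< suc (x ℕ./ suc d) * suc d) (sym (ℕ.m≡m%n+[m/n]*n x (suc d)))
    (ℕ.+-monoˡ-< (x ℕ./ suc d * suc d) (ℕ.m%n<n x (suc d)))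

  *≤⇒≤quot : ∀ {x d q} → 1 ≤ d → q * d ≤ x → q ≤ quot x d
  *≤⇒≤quot {x} {d} {q} 1≤d qd≤x = ℕ.s≤s⁻¹ (ℕ.*-cancelʳ-< d _ _ (ℕ.≤-<-trans qd≤x (<suc-quot* x 1≤d)))

  -- 1/(m+1)² ≤ 1/m − 1/(m+1), which survives rounding down.
  quot-telescope : ∀ x m → 1 ≤ m → quot x (suc m * suc m) + quot x (suc m) ≤ quot x m
  quot-telescope x m 1≤m = *≤⇒≤quot 1≤m (begin
    (u + v) * m             ≡⟨ ℕ.*-distribʳ-+ m u v ⟩
    u * m + v * m           ≤⟨ ℕ.+-monoˡ-≤ (v * m) (ℕ.≤-trans (ℕ.*-monoʳ-≤ u (ℕ.n≤1+n m)) u*1+m≤v) ⟩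
    v + v * m               ≡⟨ ℕ.*-suc v m ⟨
    v * suc m               ≤⟨ quot*≤ x (suc m) ⟩
    x                       ∎)
    where
    open ℕ.≤-Reasoning
    u = quot x (suc m * suc m)
    v = quot x (suc m)
    u*1+m≤v : u * suc m ≤ v
    u*1+m≤v = *≤⇒≤quot (s≤s z≤n) (subst (_≤ x) (sym (ℕ.*-assoc u (suc m) (suc m))) (quot*≤ x (suc m * suc m)))

  -- Telescoping of `quot-telescope`. What remains of the telescope, `quot x (D + J)`, stays on the
  -- left, since subtracting it on the right would be truncated in ℕ.
  ∑-quot-square : ∀ x D J → 1 ≤ D → ∑ (λ j → quot x ((D + j) * (D + j))) J + quot x (D + J) ≤ quot x D
  ∑-quot-square x D zero    1≤D = ℕ.≤-reflexive (cong (quot x) (ℕ.+-identityʳ D))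
  ∑-quot-square x D (suc J) 1≤D rewrite ℕ.+-suc D J = ℕ.≤-trans
    (ℕ.≤-reflexive (ℕ.+-assoc (∑ _ J) _ _))
    (ℕ.≤-trans (ℕ.+-monoʳ-≤ (∑ _ J) (quot-telescope x (D + J) (ℕ.≤-trans 1≤D (ℕ.m≤m+n D J))))
      (∑-quot-square x D J 1≤D))

-- Rarity of large common divisors of n and aₙ.

module LargeDivisors
  (a : ℕ → ℤ) (K : ℕ) (1≤K : 1 ℕ.≤ K)
  (slope : ∀ m n → 1 ℕ.≤ m → 1 ℕ.≤ n →
    ℤ.∣ a n ℤ.* + m ℤ.- a m ℤ.* + n ∣ ℕ.≤ K ℕ.* (n ℕ.+ m))
  (irrational : ∀ Q → 1 ℕ.≤ Q → ∃[ X ] (∀ n → X ℕ.≤ n → ¬ (n ℕ.∣ Q ℕ.* ℤ.∣ a n ∣)))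
  where
  open Counting
  open import Data.Nat.Base using (_+_; _*_; _∸_; _≤_; _<_; _!)

  g : ℕ → ℕ
  g n = ℕ.gcd n ℤ.∣ a n ∣

  large? : ∀ D n → Dec (D < g n)
  large? D n = D ℕ.<? g n

  1≤g : ∀ n → 1 ≤ n → 1 ≤ g n
  1≤g n 1≤n = ℕ.n≢0⇒n>0 (ℕ.gcd[m,n]≢0 n ℤ.∣ a n ∣ (inj₁ (ℕ.m<n⇒n≢0 1≤n)))

  -- When g n = g n′ = g, the difference aₙ/n − aₙ′/n′ is a multiple of g²/(n n′).
  fractions-spaced : ∀ n n′ → 1 ≤ n → g n ≡ g n′ →
    a n ℤ.* + n′ ℤ.< a n′ ℤ.* + n ℤ.+ + (g n * g n) → a n ℤ.* + n′ ℤ.≤ a n′ ℤ.* + n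
  fractions-spaced n n′ 1≤n gn≡gn′ lt = go (g n) refl
    where
    go : ∀ G → g n ≡ G → a n ℤ.* + n′ ℤ.≤ a n′ ℤ.* + n
    go G gn≡G
      with ℕ.divides q n≡  ← subst (ℕ._∣ n) gn≡G (ℕ.gcd[m,n]∣m n ℤ.∣ a n ∣)
         | ℕ.divides q′ n′≡ ← subst (ℕ._∣ n′) (trans (sym gn≡gn′) gn≡G) (ℕ.gcd[m,n]∣m n′ ℤ.∣ a n′ ∣)
         | ℤ.divides p a≡ ← ℤ.∣ᵤ⇒∣ {+ G} {a n} (subst (ℕ._∣ ℤ.∣ a n ∣) gn≡G (ℕ.gcd[m,n]∣n n ℤ.∣ a n ∣))
         | ℤ.divides p′ a′≡ ← ℤ.∣ᵤ⇒∣ {+ G} {a n′} (subst (ℕ._∣ ℤ.∣ a n′ ∣) (trans (sym gn≡gn′) gn≡G) (ℕ.gcd[m,n]∣n n′ ℤ.∣ a n′ ∣))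
      = subst₂ ℤ._≤_ (sym an′≡) (sym a′n≡)
          (ℤ.*-monoʳ-≤-nonNeg (+ (G * G)) pq′≤p′q)
      where
      rearrange : ∀ p q g → (p ℤ.* g) ℤ.* (q ℤ.* g) ≡ (p ℤ.* q) ℤ.* (g ℤ.* g)
      rearrange = solve-∀
      an′≡ : a n ℤ.* + n′ ≡ (p ℤ.* + q′) ℤ.* + (G * G)
      an′≡ = trans (cong₂ ℤ._*_ a≡ (trans (cong +_ n′≡) (ℤ.pos-* q′ G)))
        (trans (rearrange p (+ q′) (+ G)) (cong ((p ℤ.* + q′) ℤ.*_) (sym (ℤ.pos-* G G))))
      a′n≡ : a n′ ℤ.* + n ≡ (p′ ℤ.* + q) ℤ.* + (G * G)
      a′n≡ = trans (cong₂ ℤ._*_ a′≡ (trans (cong +_ n≡) (ℤ.pos-* q G)))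
        (trans (rearrange p′ (+ q) (+ G)) (cong ((p′ ℤ.* + q) ℤ.*_) (sym (ℤ.pos-* G G))))
      factor : ∀ x y → x ℤ.* y ℤ.+ y ≡ (ℤ.1ℤ ℤ.+ x) ℤ.* y
      factor = solve-∀
      pq′<1+p′q : p ℤ.* + q′ ℤ.< ℤ.1ℤ ℤ.+ p′ ℤ.* + q
      pq′<1+p′q = ℤ.*-cancelʳ-<-nonNeg (+ (G * G)) (subst₂ ℤ._<_ an′≡
        (trans (cong₂ ℤ._+_ a′n≡ (cong (λ G → + (G * G)) gn≡G)) (factor (p′ ℤ.* + q) (+ (G * G)))) lt)
      pq′≤p′q : p ℤ.* + q′ ℤ.≤ p′ ℤ.* + q
      pq′≤p′q = subst (p ℤ.* + q′ ℤ.≤_) (ℤ.pred-suc (p′ ℤ.* + q)) (ℤ.i<j⇒i≤pred[j] pq′<1+p′q)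

  -- n′ gcd(n , aₙ) = gcd(n n′ , n′ aₙ) = gcd(n n′ , n aₙ′) = n gcd(n′ , aₙ′), and the common gcd
  -- cancels. So among the n with a given gcd, the value of aₙ/n determines n.
  equal-fractions : ∀ n n′ → 1 ≤ n → g n ≡ g n′ → a n ℤ.* + n′ ≡ a n′ ℤ.* + n → n ≡ n′
  equal-fractions n n′ 1≤n gn≡gn′ an′≡a′n =
    sym (ℕ.*-cancelʳ-≡ n′ n (g n) {{ℕ.>-nonZero (1≤g n 1≤n)}} (begin
      n′ * g n                             ≡⟨ ℕ.c*gcd[m,n]≡gcd[cm,cn] n′ n ℤ.∣ a n ∣ ⟩
      ℕ.gcd (n′ * n) (n′ * ℤ.∣ a n ∣)      ≡⟨ cong₂ ℕ.gcd (ℕ.*-comm n′ n) absolute ⟩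
      ℕ.gcd (n * n′) (n * ℤ.∣ a n′ ∣)      ≡⟨ ℕ.c*gcd[m,n]≡gcd[cm,cn] n n′ ℤ.∣ a n′ ∣ ⟨
      n * g n′                             ≡⟨ cong (n *_) gn≡gn′ ⟨
      n * g n                              ∎))
    where
    open ≡-Reasoning
    absolute : n′ * ℤ.∣ a n ∣ ≡ n * ℤ.∣ a n′ ∣
    absolute = begin
      n′ * ℤ.∣ a n ∣           ≡⟨ ℕ.*-comm n′ _ ⟩
      ℤ.∣ a n ∣ * n′           ≡⟨ ℤ.abs-* (a n) (+ n′) ⟨
      ℤ.∣ a n ℤ.* + n′ ∣       ≡⟨ cong ℤ.∣_∣ an′≡a′n ⟩
      ℤ.∣ a n′ ℤ.* + n ∣       ≡⟨ ℤ.abs-* (a n′) (+ n) ⟩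
      ℤ.∣ a n′ ∣ * n           ≡⟨ ℕ.*-comm _ n ⟩
      n * ℤ.∣ a n′ ∣           ∎

  module _ (h : ℕ) (1≤h : 1 ≤ h) where

    -- For N/h < n ≤ N one has K (n + N) ≤ 2 K N ≤ 2 K h n, so `H` gives |aₙ N - a_N n| ≤ H n. `D`
    -- makes 2 H N / D equal to N/h, the size wanted for the sum of 2 H N / g² over g > D.
    H D : ℕ
    H = 2 * K * h
    D = 2 * H * h

    module _ (N : ℕ) (1≤N : 1 ≤ N) where

      diff : ℕ → ℤ
      diff n = a n ℤ.* + N ℤ.- a N ℤ.* + n

      -- offset n / (N n) is the position of aₙ/n in an interval of length 2H/N about a_N/N.
      offset : ℕ → ℕ
      offset n = ℤ.∣ diff n ℤ.+ + (H * n) ∣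

      -- The interval is cut into cells of length g²/N², the spacing of the fractions with gcd g,
      -- and this is the index of the cell of aₙ/n: `offset n` / (N n) divided by g²/N², rounded
      -- down. The cells depend on g, so indices are compared only between n of equal gcd.
      bucket : ℕ → ℕ
      bucket n = quot (offset n * N) (n * (g n * g n))

      module _ (n : ℕ) (1≤n : 1 ≤ n) (n≤N : n ≤ N) (N<hn : N < h * n) where

        ∣diff∣≤ : ℤ.∣ diff n ∣ ≤ H * n
        ∣diff∣≤ = begin
          ℤ.∣ diff n ∣      ≤⟨ slope N n 1≤N 1≤n ⟩
          K * (n + N)       ≤⟨ ℕ.*-monoʳ-≤ K (ℕ.+-monoˡ-≤ N n≤N) ⟩
          K * (N + N)       ≤⟨ ℕ.*-monoʳ-≤ K (ℕ.+-mono-≤ (ℕ.<⇒≤ N<hn) (ℕ.<⇒≤ N<hn)) ⟩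
          K * (h * n + h * n)  ≡⟨ regroup K h n ⟩
          H * n             ∎
          where
          open ℕ.≤-Reasoning
          regroup : ∀ K h n → K * (h * n + h * n) ≡ 2 * K * h * n
          regroup = ℕ-Solver.solve-∀

        offset≤ : offset n ≤ 2 * H * n
        offset≤ = begin
          offset n                        ≤⟨ ℤ.∣i+j∣≤∣i∣+∣j∣ (diff n) (+ (H * n)) ⟩
          ℤ.∣ diff n ∣ + H * n            ≤⟨ ℕ.+-monoˡ-≤ (H * n) ∣diff∣≤ ⟩
          H * n + H * n                   ≡⟨ regroup H n ⟩
          2 * H * n                       ∎
          where
          open ℕ.≤-Reasoning
          regroup : ∀ H n → H * n + H * n ≡ 2 * H * n
          regroup = ℕ-Solver.solve-∀

        -- The summand `H * n` outweighs `diff n`, so taking the absolute value in `offset` changes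
        -- nothing.
        +offset≡ : + offset n ≡ diff n ℤ.+ + (H * n)
        +offset≡ = ℤ.0≤i⇒+∣i∣≡i (lemma (diff n) ∣diff∣≤)
          where
          lemma : ∀ i {m} → ℤ.∣ i ∣ ≤ m → ℤ.0ℤ ℤ.≤ i ℤ.+ + m
          lemma (+ k)    _   = ℤ.+≤+ z≤n
          lemma -[1+ k ] {m} k<m = subst (ℤ.0ℤ ℤ.≤_) (sym (ℤ.⊖-≥ k<m)) (ℤ.+≤+ z≤n)

        1≤den : 1 ≤ n * (g n * g n)
        1≤den = ℕ.*-mono-≤ 1≤n (ℕ.*-mono-≤ (1≤g n 1≤n) (1≤g n 1≤n))

        bucket≤ : bucket n ≤ quot (2 * H * N) (g n * g n)
        bucket≤ = *≤⇒≤quot (ℕ.*-mono-≤ (1≤g n 1≤n) (1≤g n 1≤n))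
          (ℕ.*-cancelʳ-≤ _ _ n {{ℕ.>-nonZero 1≤n}} (begin
            bucket n * (g n * g n) * n     ≡⟨ swap (bucket n) (g n * g n) n ⟩
            bucket n * (n * (g n * g n))   ≤⟨ quot*≤ (offset n * N) (n * (g n * g n)) ⟩
            offset n * N                   ≤⟨ ℕ.*-monoˡ-≤ N offset≤ ⟩
            2 * H * n * N                  ≡⟨ swap′ (2 * H) n N ⟩
            2 * H * N * n                  ∎))
          where
          open ℕ.≤-Reasoning
          swap : ∀ b G n → b * G * n ≡ b * (n * G)
          swap = ℕ-Solver.solve-∀
          swap′ : ∀ b G n → b * G * n ≡ b * n * G
          swap′ = ℕ-Solver.solve-∀

      module _ (n n′ : ℕ) (1≤n : 1 ≤ n) (n≤N : n ≤ N) (N<hn : N < h * n)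
               (1≤n′ : 1 ≤ n′) (n′≤N : n′ ≤ N) (N<hn′ : N < h * n′)
               (gn≡gn′ : g n ≡ g n′) (bucket≡ : bucket n ≡ bucket n′) where

        -- Two positions in one cell differ by less than g²/N². After multiplication by N n n′ the
        -- margin is n n′ g²/N, which is at most N g² because n and n′ are at most N.
        offsets-close : offset n * n′ < offset n′ * n + N * (g n * g n)
        offsets-close = ℕ.*-cancelʳ-< N _ _ (begin-strict
          offset n * n′ * N
            ≡⟨ swap (offset n) n′ N ⟩
          offset n * N * n′
            <⟨ ℕ.*-monoˡ-< n′ {{ℕ.>-nonZero 1≤n′}} (<suc-quot* (offset n * N) (1≤den n 1≤n n≤N N<hn)) ⟩
          suc (bucket n) * (n * (g n * g n)) * n′
            ≡⟨ cong (λ b → suc b * (n * (g n * g n)) * n′) bucket≡ ⟩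
          suc (bucket n′) * (n * (g n * g n)) * n′
            ≡⟨ expand (bucket n′) n (g n * g n) n′ ⟩
          bucket n′ * (n′ * (g n * g n)) * n + n * n′ * (g n * g n)
            ≡⟨ cong (λ G → bucket n′ * (n′ * (G * G)) * n + n * n′ * (g n * g n)) gn≡gn′ ⟩
          bucket n′ * (n′ * (g n′ * g n′)) * n + n * n′ * (g n * g n)
            ≤⟨ ℕ.+-mono-≤ (ℕ.*-monoˡ-≤ n (quot*≤ (offset n′ * N) (n′ * (g n′ * g n′))))
                          (ℕ.*-monoˡ-≤ (g n * g n) (ℕ.*-mono-≤ n≤N n′≤N)) ⟩
          offset n′ * N * n + N * N * (g n * g n)
            ≡⟨ collect (offset n′) N n (g n * g n) ⟩
          (offset n′ * n + N * (g n * g n)) * N ∎)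
          where
          open ℕ.≤-Reasoning
          swap : ∀ b G n → b * G * n ≡ b * n * G
          swap = ℕ-Solver.solve-∀
          expand : ∀ b n G n′ → suc b * (n * G) * n′ ≡ b * (n′ * G) * n + n * n′ * G
          expand = ℕ-Solver.solve-∀
          collect : ∀ o N n G → o * N * n + N * N * G ≡ (o * n + N * G) * N
          collect = ℕ-Solver.solve-∀

        same-bucket≤ : a n ℤ.* + n′ ℤ.≤ a n′ ℤ.* + n
        same-bucket≤ = fractions-spaced n n′ 1≤n gn≡gn′
          (ℤ.*-cancelʳ-<-nonNeg (+ N) (subst₂ ℤ._<_ lhs rhs
            (ℤ.+-monoˡ-< shift (ℤ.+<+ offsets-close))))
          where
          -- The terms in `a N` and `H` are the same in both cross products. Removing them leaves
          -- the cross products of aₙ/n and aₙ′/n′ times N, and N cancels.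
          shift = a N ℤ.* + n ℤ.* + n′ ℤ.- + H ℤ.* + n ℤ.* + n′
          cancel : ∀ x y N n n′ H →
            (x ℤ.* N ℤ.- y ℤ.* n ℤ.+ H ℤ.* n) ℤ.* n′ ℤ.+ (y ℤ.* n ℤ.* n′ ℤ.- H ℤ.* n ℤ.* n′) ≡ x ℤ.* n′ ℤ.* N
          cancel = solve-∀
          cancel′ : ∀ x y N n n′ H G →
            (x ℤ.* N ℤ.- y ℤ.* n′ ℤ.+ H ℤ.* n′) ℤ.* n ℤ.+ N ℤ.* G ℤ.+ (y ℤ.* n ℤ.* n′ ℤ.- H ℤ.* n ℤ.* n′) ≡
            (x ℤ.* n ℤ.+ G) ℤ.* N
          cancel′ = solve-∀
          +offset*≡ : ∀ m m′ 1≤m m≤N N<hm → + (offset m * m′) ≡ (diff m ℤ.+ + H ℤ.* + m) ℤ.* + m′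
          +offset*≡ m m′ 1≤m m≤N N<hm = trans (ℤ.pos-* (offset m) m′) (cong (ℤ._* + m′)
            (trans (+offset≡ m 1≤m m≤N N<hm) (cong (ℤ._+_ (diff m)) (ℤ.pos-* H m))))
          lhs : + (offset n * n′) ℤ.+ shift ≡ a n ℤ.* + n′ ℤ.* + N
          lhs = trans (cong (ℤ._+ shift) (+offset*≡ n n′ 1≤n n≤N N<hn))
            (cancel (a n) (a N) (+ N) (+ n) (+ n′) (+ H))
          rhs : + (offset n′ * n + N * (g n * g n)) ℤ.+ shift ≡ (a n′ ℤ.* + n ℤ.+ + (g n * g n)) ℤ.* + N
          rhs = trans (cong (ℤ._+ shift) (cong₂ ℤ._+_ (+offset*≡ n′ n 1≤n′ n′≤N N<hn′) (ℤ.pos-* N (g n * g n))))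
            (cancel′ (a n′) (a N) (+ N) (+ n) (+ n′) (+ H) (+ (g n * g n)))

      bucket-injective : ∀ n n′ → 1 ≤ n → n ≤ N → N < h * n → 1 ≤ n′ → n′ ≤ N → N < h * n′ →
        g n ≡ g n′ → bucket n ≡ bucket n′ → n ≡ n′
      bucket-injective n n′ 1≤n n≤N N<hn 1≤n′ n′≤N N<hn′ gn≡gn′ bucket≡ =
        equal-fractions n n′ 1≤n gn≡gn′ (ℤ.≤-antisym
          (same-bucket≤ n n′ 1≤n n≤N N<hn 1≤n′ n′≤N N<hn′ gn≡gn′ bucket≡)
          (same-bucket≤ n′ n 1≤n′ n′≤N N<hn′ 1≤n n≤N N<hn (sym gn≡gn′) (sym bucket≡)))

      -- If g n > N/h then aₙ/n has a denominator below h.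
      gcd≤ : ∀ n → 1 ≤ n → n ≤ N → ¬ (n ℕ.∣ h ! * ℤ.∣ a n ∣) → g n ≤ quot N h
      gcd≤ n 1≤n n≤N n∤ with g n * h ℕ.≤? N
      ... | yes gh≤N = *≤⇒≤quot 1≤h gh≤N
      ... | no  gh≰N = contradiction n∣ n∤
        where
        n∣ : n ℕ.∣ h ! * ℤ.∣ a n ∣
        n∣ with ℕ.divides q n≡ ← ℕ.gcd[m,n]∣m n ℤ.∣ a n ∣ = ℕ.∣-trans
          (subst (ℕ._∣ q * ℤ.∣ a n ∣) (sym n≡) (ℕ.*-monoʳ-∣ q (ℕ.gcd[m,n]∣n n ℤ.∣ a n ∣)))
          (ℕ.*-monoˡ-∣ ℤ.∣ a n ∣ (ℕ.∣-trans (q∣q! q 1≤q) (ℕ.m≤n⇒m!∣n! (ℕ.<⇒≤ q<h))))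
          where
          q∣q! : ∀ q → 1 ≤ q → q ℕ.∣ q !
          q∣q! (suc q) _ = ℕ.m∣m*n (q !)
          1≤q : 1 ≤ q
          1≤q = ℕ.n≢0⇒n>0 λ q≡0 → ℕ.m<n⇒n≢0 1≤n (trans n≡ (cong (_* g n) q≡0))
          q<h : q < h
          q<h = ℕ.*-cancelʳ-< (g n) q h (ℕ.≤-<-trans (subst (_≤ N) n≡ n≤N)
            (subst (N <_) (ℕ.*-comm (g n) h) (ℕ.≰⇒> gh≰N)))

      1≤H : 1 ≤ H
      1≤H = ℕ.*-mono-≤ {1} {2 * K} (ℕ.*-mono-≤ {1} {2} (s≤s z≤n) 1≤K) 1≤h

      1≤D : 1 ≤ D
      1≤D = ℕ.*-mono-≤ {1} {2 * H} (ℕ.*-mono-≤ {1} {2} (s≤s z≤n) 1≤H) 1≤h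

      quot-D≤ : quot (2 * H * N) D ≤ quot N h
      quot-D≤ = *≤⇒≤quot 1≤h (ℕ.*-cancelʳ-≤ _ _ (2 * H) {{ℕ.>-nonZero (ℕ.*-mono-≤ {1} {2} (s≤s z≤n) 1≤H)}}
        (subst₂ _≤_ (regroup (quot (2 * H * N) D) (2 * H) h) (ℕ.*-comm (2 * H) N) (quot*≤ (2 * H * N) D)))
        where
        regroup : ∀ q H h → q * (H * h) ≡ q * h * H
        regroup = ℕ-Solver.solve-∀

      late-and-large? : ∀ n → Dec (D < g n × N < h * n)
      late-and-large? n = large? D n ×-dec (N ℕ.<? h * n)

      module _ (n∤ : ∀ n → N < h * n → ¬ (n ℕ.∣ h ! * ℤ.∣ a n ∣)) where

        -- For g = D + j there are at most 1 + 2 H N / g² cells, each with at most one n. The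
        -- successor moves the indices 0, 1, ... into the range of `∑`, which starts at 1.
        same-gcd-count : ∀ j → ∑ (λ n → ind (late-and-large? n ×-dec (g n ∸ D ℕ.≟ j))) N
          ≤ 1 + quot (2 * H * N) ((D + j) * (D + j))
        same-gcd-count j = ∑-ind-injective _ (λ n → suc (bucket n)) _ N
          (λ n 1≤n n≤N p → s≤s z≤n , s≤s (subst (λ G → bucket n ≤ quot (2 * H * N) (G * G)) (gcd≡ p)
            (bucket≤ n 1≤n n≤N (proj₂ (proj₁ p)))))
          λ m n 1≤m m≤N 1≤n n≤N p q κ≡ → bucket-injective m n 1≤m m≤N (proj₂ (proj₁ p)) 1≤n n≤N (proj₂ (proj₁ q))
            (trans (gcd≡ p) (sym (gcd≡ q))) (ℕ.suc-injective κ≡)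
          where
          gcd≡ : ∀ {n} → (D < g n × N < h * n) × g n ∸ D ≡ j → g n ≡ D + j
          gcd≡ ((D<g , _) , refl) = sym (ℕ.m+[n∸m]≡n (ℕ.<⇒≤ D<g))

        -- Fibres are indexed by j = g - D, which is at most N/h. The summands 1 give one N/h; the
        -- quotients by squares telescope to 2 H N / D, which is the other.
        late-and-large-count : ∑ (λ n → ind (late-and-large? n)) N ≤ quot N h + quot N h
        late-and-large-count = begin
          ∑ (λ n → ind (late-and-large? n)) N
            ≤⟨ ∑-ind-fibre late-and-large? (λ n → g n ∸ D) c (quot N h) N
                 (λ n 1≤n n≤N (D<g , N<hn) → ℕ.m<n⇒0<n∸m D<g ,
                   ℕ.≤-trans (ℕ.m∸n≤m (g n) D) (gcd≤ n 1≤n n≤N (n∤ n N<hn)))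
                 (λ j _ _ → same-gcd-count j) ⟩
          ∑ c (quot N h)
            ≡⟨ ∑-+ (λ _ → 1) _ (quot N h) ⟩
          ∑ (λ _ → 1) (quot N h) + ∑ (λ j → quot (2 * H * N) ((D + j) * (D + j))) (quot N h)
            ≤⟨ ℕ.+-mono-≤ (ℕ.≤-reflexive (trans (∑-const 1 (quot N h)) (ℕ.*-identityʳ _)))
                 (ℕ.≤-trans (ℕ.≤-trans (ℕ.m≤m+n _ _) (∑-quot-square (2 * H * N) D (quot N h) 1≤D)) quot-D≤) ⟩
          quot N h + quot N h ∎
          where
          open ℕ.≤-Reasoning
          c = λ j → 1 + quot (2 * H * N) ((D + j) * (D + j))

        early-count : ∑ (λ n → ind (h * n ℕ.≤? N)) N ≤ quot N h
        early-count = ∑-ind-injective (λ n → h * n ℕ.≤? N) (λ n → n) (quot N h) N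
          (λ n 1≤n _ hn≤N → 1≤n , *≤⇒≤quot 1≤h (subst (_≤ N) (ℕ.*-comm h n) hn≤N))
          (λ _ _ _ _ _ _ _ _ m≡n → m≡n)

        -- There are three shares of N/h: one for the n ≤ N/h, whatever their gcd, and two for the
        -- later ones. Multiplying by h keeps the bound in ℕ.
        large-count : h * ∑ (λ n → ind (large? D n)) N ≤ 3 * N
        large-count = begin
          h * ∑ (λ n → ind (large? D n)) N
            ≤⟨ ℕ.*-monoʳ-≤ h (∑-mono N λ n _ _ → split n) ⟩
          h * ∑ (λ n → ind (h * n ℕ.≤? N) + ind (late-and-large? n)) N
            ≡⟨ cong (h *_) (∑-+ _ _ N) ⟩
          h * (∑ (λ n → ind (h * n ℕ.≤? N)) N + ∑ (λ n → ind (late-and-large? n)) N)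
            ≤⟨ ℕ.*-monoʳ-≤ h (ℕ.+-mono-≤ early-count late-and-large-count) ⟩
          h * (quot N h + (quot N h + quot N h))
            ≡⟨ regroup h (quot N h) ⟩
          3 * (quot N h * h)
            ≤⟨ ℕ.*-monoʳ-≤ 3 (quot*≤ N h) ⟩
          3 * N ∎
          where
          open ℕ.≤-Reasoning
          regroup : ∀ h q → h * (q + (q + q)) ≡ 3 * (q * h)
          regroup = ℕ-Solver.solve-∀
          split : ∀ n → ind (large? D n) ≤ ind (h * n ℕ.≤? N) + ind (late-and-large? n)
          split n with h * n ℕ.≤? N
          ... | yes hn≤N = ℕ.≤-trans (ind-mono (large? D n) (yes hn≤N) λ _ → hn≤N) (ℕ.m≤m+n 1 _)
          ... | no  hn≰N = ind-mono (large? D n) (late-and-large? n) λ D<g → D<g , ℕ.≰⇒> hn≰N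

  -- The conclusion `h ≤ D` is for the sieve: stopped at this same `D`, it has an error 1/(D+1),
  -- which must not exceed 1/h.
  large-gcd-rare : ∀ h → 1 ≤ h → ∃[ D ] (h ≤ D ×
    ∃[ N₀ ] (∀ N → 1 ≤ N → N₀ ≤ N → h * ∑ (λ n → ind (large? D n)) N ≤ 3 * N))
  large-gcd-rare h 1≤h
    -- Every denominator below h divides h!, so one application excludes them all. The index `h * X`
    -- ensures n > X for every n > N/h.
    with X , n∤ ← irrational (h !) (ℕ.n≢0⇒n>0 (ℕ.≢-nonZero⁻¹ (h !) {{ℕ._!≢0 h}})) =
    D h 1≤h ,
    ℕ.≤-trans (ℕ.≤-reflexive (sym (ℕ.*-identityˡ h)))
      (ℕ.*-monoˡ-≤ h (ℕ.*-mono-≤ {1} {2} {1} (s≤s z≤n) (1≤H h 1≤h 1 ℕ.≤-refl))) ,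
    h * X ,
    λ N 1≤N hX≤N → large-count h 1≤h N 1≤N λ n N<hn →
      n∤ n (ℕ.<⇒≤ (ℕ.*-cancelˡ-< h X n (ℕ.≤-<-trans hX≤N N<hn)))

-- Integers and their reciprocals in ℚ, and o-notation.

module RationalArithmetic where
  open import Data.Rational.Base using (_+_; _-_; _*_; _≤_; _<_; -_; ∣_∣)
  open +-*-Solver using (solve; _:+_; _:*_; :-_; _:-_; _:=_)

  opaque
    ι : ℤ → ℚ
    ι i = i ℚ./ 1

    ι-+ : ∀ i j → ι (i ℤ.+ j) ≡ ι i + ι j
    ι-+ i j = ℚ.toℚᵘ-injective (ℚᵘ.≃-trans (toℚᵘ-/ (i ℤ.+ j) 0) (ℚᵘ.≃-sym (ℚᵘ.≃-trans
      (ℚ.toℚᵘ-homo-+ (ι i) (ι j))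
      (ℚᵘ.≃-trans (ℚᵘ.+-cong (toℚᵘ-/ i 0) (toℚᵘ-/ j 0)) (ℚᵘ.*≡* (identity i j))))))
      where
      identity : ∀ i j → (i ℤ.* ℤ.1ℤ ℤ.+ j ℤ.* ℤ.1ℤ) ℤ.* ℤ.1ℤ ≡ (i ℤ.+ j) ℤ.* ℤ.1ℤ
      identity = solve-∀

    ι-* : ∀ i j → ι (i ℤ.* j) ≡ ι i * ι j
    ι-* i j = ℚ.toℚᵘ-injective (ℚᵘ.≃-trans (toℚᵘ-/ (i ℤ.* j) 0) (ℚᵘ.≃-sym (ℚᵘ.≃-trans
      (ℚ.toℚᵘ-homo-* (ι i) (ι j))
      (ℚᵘ.≃-trans (ℚᵘ.*-cong (toℚᵘ-/ i 0) (toℚᵘ-/ j 0)) (ℚᵘ.*≡* refl)))))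

    ι-mono-≤ : ∀ {i j} → i ℤ.≤ j → ι i ≤ ι j
    ι-mono-≤ {i} {j} i≤j = ℚ.toℚᵘ-cancel-≤
      (ℚᵘ.≤-respˡ-≃ (ℚᵘ.≃-sym (toℚᵘ-/ i 0)) (ℚᵘ.≤-respʳ-≃ (ℚᵘ.≃-sym (toℚᵘ-/ j 0))
        (ℚᵘ.*≤* (ℤ.*-monoʳ-≤-nonNeg ℤ.1ℤ i≤j))))

    ι-mono-< : ∀ {i j} → i ℤ.< j → ι i < ι j
    ι-mono-< {i} {j} i<j = ℚ.toℚᵘ-cancel-<
      (ℚᵘ.<-respˡ-≃ (ℚᵘ.≃-sym (toℚᵘ-/ i 0)) (ℚᵘ.<-respʳ-≃ (ℚᵘ.≃-sym (toℚᵘ-/ j 0))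
        (ℚᵘ.*<* (ℤ.*-monoʳ-<-pos ℤ.1ℤ i<j))))

    ι-cancel-≤ : ∀ {i j} → ι i ≤ ι j → i ℤ.≤ j
    ι-cancel-≤ ιi≤ιj = ℤ.≮⇒≥ λ j<i → ℚ.<-irrefl refl (ℚ.<-≤-trans (ι-mono-< j<i) ιi≤ιj)

    ι-neg : ∀ i → ι (ℤ.- i) ≡ - ι i
    ι-neg i = begin
      ι (ℤ.- i)                       ≡⟨ solve 2 (λ x y → x := (x :+ y) :- y) refl (ι (ℤ.- i)) (ι i) ⟩
      ι (ℤ.- i) + ι i - ι i           ≡⟨ cong (_- ι i) (ι-+ (ℤ.- i) i) ⟨
      ι (ℤ.- i ℤ.+ i) - ι i           ≡⟨ cong (λ j → ι j - ι i) (ℤ.+-inverseˡ i) ⟩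
      0ℚ - ι i                        ≡⟨ ℚ.+-identityˡ (- ι i) ⟩
      - ι i                           ∎
      where open ≡-Reasoning

    ι-∣∣ : ∀ i → ι (+ ℤ.∣ i ∣) ≡ ∣ ι i ∣
    ι-∣∣ (+ n)    = sym (ℚ.0≤p⇒∣p∣≡p (ι-mono-≤ {+ 0} {+ n} (ℤ.+≤+ z≤n)))
    ι-∣∣ -[1+ n ] = trans (sym (ℚ.0≤p⇒∣p∣≡p (ι-mono-≤ {+ 0} {+ suc n} (ℤ.+≤+ z≤n))))
      (trans (sym (ℚ.∣-p∣≡∣p∣ (ι (+ suc n)))) (cong ∣_∣ (sym (ι-neg (+ suc n)))))

  ν : ℕ → ℚ
  ν n = ι (+ n)

  opaque
    unfolding ι

    ν-+ : ∀ m n → ν (m ℕ.+ n) ≡ ν m + ν n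
    ν-+ m n = ι-+ (+ m) (+ n)

    ν-* : ∀ m n → ν (m ℕ.* n) ≡ ν m * ν n
    ν-* m n = trans (cong ι (ℤ.pos-* m n)) (ι-* (+ m) (+ n))

    ν-mono-≤ : ∀ {m n} → m ℕ.≤ n → ν m ≤ ν n
    ν-mono-≤ m≤n = ι-mono-≤ (ℤ.+≤+ m≤n)

    0≤ν : ∀ n → 0ℚ ≤ ν n
    0≤ν n = ν-mono-≤ {0} {n} z≤n

    1≤ν : ∀ {n} → 1 ℕ.≤ n → 1ℚ ≤ ν n
    1≤ν {n} = ν-mono-≤ {1} {n}

    ι≡/1 : ∀ i → ι i ≡ i ℚ./ 1
    ι≡/1 i = refl

    ν-0 : ν 0 ≡ 0ℚ
    ν-0 = refl

    ν-1 : ν 1 ≡ 1ℚ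
    ν-1 = refl

    rcp : (n : ℕ) .{{_ : ℕ.NonZero n}} → ℚ
    rcp n = + 1 ℚ./ n

    /≡*rcp : ∀ i n .{{_ : ℕ.NonZero n}} → i ℚ./ n ≡ ι i * rcp n
    /≡*rcp i (suc n) = ℚ.toℚᵘ-injective (ℚᵘ.≃-trans (toℚᵘ-/ i n) (ℚᵘ.≃-sym (ℚᵘ.≃-trans
      (ℚ.toℚᵘ-homo-* (ι i) (rcp (suc n)))
      (ℚᵘ.≃-trans (ℚᵘ.*-cong (toℚᵘ-/ i 0) (toℚᵘ-/ (+ 1) n)) (ℚᵘ.*≡* (identity i (+ suc n)))))))
      where
      identity : ∀ i n → i ℤ.* ℤ.1ℤ ℤ.* n ≡ i ℤ.* (ℤ.1ℤ ℤ.* n)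
      identity = solve-∀

    ν*rcp : ∀ n .{{_ : ℕ.NonZero n}} → ν n * rcp n ≡ 1ℚ
    ν*rcp (suc n) = trans (sym (/≡*rcp (+ suc n) (suc n))) (ℚ.toℚᵘ-injective
      (ℚᵘ.≃-trans (toℚᵘ-/ (+ suc n) n) (ℚᵘ.*≡* (trans (ℤ.*-identityʳ (+ suc n)) (sym (ℤ.*-identityˡ (+ suc n)))))))

    0<rcp : ∀ n .{{_ : ℕ.NonZero n}} → 0ℚ < rcp n
    0<rcp n = ℚ.positive⁻¹ (rcp n) {{ℚ.normalize-pos 1 n}}

    rcp≡1/ : ∀ n .{{_ : ℕ.NonZero n}} → rcp n ≡ + 1 ℚ./ n
    rcp≡1/ n = refl

    rcp-antimono : ∀ m n .{{_ : ℕ.NonZero m}} .{{_ : ℕ.NonZero n}} → m ℕ.≤ n → rcp n ≤ rcp m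
    rcp-antimono = 1/-antimono

    rcp≤1 : ∀ n .{{_ : ℕ.NonZero n}} → rcp n ≤ 1ℚ
    rcp≤1 n = 1/-antimono 1 n (ℕ.>-nonZero⁻¹ n)

    rcp-small : ∀ {ε} → 0ℚ < ε → ∃[ n ] rcp (suc n) < ε
    rcp-small = 1/n<ε

  inverse-unique : ∀ x y z → x * y ≡ 1ℚ → x * z ≡ 1ℚ → y ≡ z
  inverse-unique x y z xy≡1 xz≡1 = begin
    y              ≡⟨ ℚ.*-identityʳ y ⟨
    y * 1ℚ         ≡⟨ cong (y *_) xz≡1 ⟨
    y * (x * z)    ≡⟨ solve 3 (λ x y z → y :* (x :* z) := z :* (x :* y)) refl x y z ⟩
    z * (x * y)    ≡⟨ cong (z *_) xy≡1 ⟩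
    z * 1ℚ         ≡⟨ ℚ.*-identityʳ z ⟩
    z              ∎
    where open ≡-Reasoning

  *-mono-≤ : ∀ {p q r t} → 0ℚ ≤ r → 0ℚ ≤ q → p ≤ q → r ≤ t → p * r ≤ q * t
  *-mono-≤ {p} {q} {r} 0≤r 0≤q p≤q r≤t = ℚ.≤-trans
    (ℚ.*-monoʳ-≤-nonNeg r {{ℚ.nonNegative 0≤r}} p≤q)
    (ℚ.*-monoˡ-≤-nonNeg q {{ℚ.nonNegative 0≤q}} r≤t)

  *-monoˡ : ∀ r {p q} → 0ℚ ≤ r → p ≤ q → r * p ≤ r * q
  *-monoˡ r 0≤r = ℚ.*-monoˡ-≤-nonNeg r {{ℚ.nonNegative 0≤r}}

  0≤* : ∀ {p q} → 0ℚ ≤ p → 0ℚ ≤ q → 0ℚ ≤ p * q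
  0≤* {p} {q} 0≤p 0≤q = subst (_≤ p * q) (ℚ.*-zeroʳ p) (*-monoˡ p 0≤p 0≤q)

  p≤p+q : ∀ {p q} → 0ℚ ≤ q → p ≤ p + q
  p≤p+q {p} {q} 0≤q = subst (_≤ p + q) (ℚ.+-identityʳ p) (ℚ.+-monoʳ-≤ p 0≤q)

  ∣-∣-triangle : ∀ p q r → ∣ p - r ∣ ≤ ∣ p - q ∣ + ∣ q - r ∣
  ∣-∣-triangle p q r = subst (λ x → ∣ x ∣ ≤ ∣ p - q ∣ + ∣ q - r ∣)
    (solve 3 (λ p q r → (p :- q) :+ (q :- r) := p :- r) refl p q r)
    (ℚ.∣p+q∣≤∣p∣+∣q∣ (p - q) (q - r))

  ∣p∣≤⇒p≤ : ∀ {p d} → ∣ p ∣ ≤ d → p ≤ d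
  ∣p∣≤⇒p≤ {p} = ℚ.≤-trans (p≤∣p∣ p)

  ½*ε+½*ε : ∀ ε → ℚ.½ * ε + ℚ.½ * ε ≡ ε
  ½*ε+½*ε ε = trans (sym (ℚ.*-distribʳ-+ ε ℚ.½ ℚ.½)) (ℚ.*-identityˡ ε)

  0<½*ε : ∀ {ε} → 0ℚ < ε → 0ℚ < ℚ.½ * ε
  0<½*ε = 0<* (ℚ.positive⁻¹ ℚ.½)

  infix 4 _∈o_

  -- Landau's a = o(w). With w = `ν` it expresses errors o(N) in counts, with the constant weight
  -- `1ʷ` convergence to 0.
  _∈o_ : (ℕ → ℚ) → (ℕ → ℚ) → Set
  a ∈o w = ∀ ε → 0ℚ < ε → ∃[ N₀ ] (∀ N → N₀ ℕ.≤ N → ∣ a N ∣ ≤ ε * w N)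

  o-cong : ∀ {a b w} → (∀ N → a N ≡ b N) → a ∈o w → b ∈o w
  o-cong a≡b a∈o ε 0<ε with N₀ , h ← a∈o ε 0<ε =
    N₀ , λ N N₀≤N → subst (λ x → ∣ x ∣ ≤ _) (a≡b N) (h N N₀≤N)

  o-≤ : ∀ {a b w} → (∀ N → ∣ b N ∣ ≤ ∣ a N ∣) → a ∈o w → b ∈o w
  o-≤ b≤a a∈o ε 0<ε with N₀ , h ← a∈o ε 0<ε =
    N₀ , λ N N₀≤N → ℚ.≤-trans (b≤a N) (h N N₀≤N)

  o-+ : ∀ {a b w} → a ∈o w → b ∈o w → (λ N → a N + b N) ∈o w
  o-+ {a} {b} {w} a∈o b∈o ε 0<ε
    with M , h ← a∈o (ℚ.½ * ε) (0<½*ε 0<ε)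
       | N , k ← b∈o (ℚ.½ * ε) (0<½*ε 0<ε) =
    M ℕ.⊔ N , λ n ≤n → begin
      ∣ a n + b n ∣                        ≤⟨ ℚ.∣p+q∣≤∣p∣+∣q∣ (a n) (b n) ⟩
      ∣ a n ∣ + ∣ b n ∣                    ≤⟨ ℚ.+-mono-≤ (h n (ℕ.m⊔n≤o⇒m≤o M N ≤n)) (k n (ℕ.m⊔n≤o⇒n≤o M N ≤n)) ⟩
      ℚ.½ * ε * w n + ℚ.½ * ε * w n        ≡⟨ ℚ.*-distribʳ-+ (w n) (ℚ.½ * ε) (ℚ.½ * ε) ⟨
      (ℚ.½ * ε + ℚ.½ * ε) * w n            ≡⟨ cong (_* w n) (½*ε+½*ε ε) ⟩
      ε * w n                              ∎
    where open ℚ.≤-Reasoning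

  o-neg : ∀ {a w} → a ∈o w → (λ N → - a N) ∈o w
  o-neg {a} = o-≤ λ N → ℚ.≤-reflexive (ℚ.∣-p∣≡∣p∣ (a N))

  o-- : ∀ {a b w} → a ∈o w → b ∈o w → (λ N → a N - b N) ∈o w
  o-- a∈o b∈o = o-+ a∈o (o-neg b∈o)

  archimedean : ∀ ε c → 0ℚ < ε → ∃[ N₀ ] (∀ N → N₀ ℕ.≤ N → ν c ≤ ε * ν N)
  archimedean ε c 0<ε with m , 1/m<ε ← rcp-small 0<ε = c ℕ.* suc m , λ N N₀≤N → begin
    ν c                                 ≡⟨ ℚ.*-identityʳ (ν c) ⟨
    ν c * 1ℚ                            ≡⟨ cong (ν c *_) (ν*rcp (suc m)) ⟨
    ν c * (ν (suc m) * rcp (suc m))     ≡⟨ solve 3 (λ x y z → x :* (y :* z) := z :* (x :* y)) refl (ν c) (ν (suc m)) (rcp (suc m)) ⟩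
    rcp (suc m) * (ν c * ν (suc m))     ≡⟨ cong (rcp (suc m) *_) (ν-* c (suc m)) ⟨
    rcp (suc m) * ν (c ℕ.* suc m)       ≤⟨ *-mono-≤ (0≤ν (c ℕ.* suc m)) (ℚ.<⇒≤ 0<ε) (ℚ.<⇒≤ 1/m<ε) (ν-mono-≤ N₀≤N) ⟩
    ε * ν N                             ∎
    where open ℚ.≤-Reasoning

  bounded∈o : ∀ {a} c → (∀ N → ∣ a N ∣ ≤ ν c) → a ∈o ν
  bounded∈o c a≤c ε 0<ε =
    let N₀ , h = archimedean ε c 0<ε in N₀ , λ N N₀≤N → ℚ.≤-trans (a≤c N) (h N N₀≤N)

  infixr 8 _^ℚ_

  _^ℚ_ : ℚ → ℕ → ℚ
  q ^ℚ zero  = 1ℚ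
  q ^ℚ suc k = q * q ^ℚ k

-- Rational sums over 1, ..., N.

module RationalSums where
  open import Data.Rational.Base using (_+_; _-_; _*_; _≤_; _<_; -_; ∣_∣)
  open +-*-Solver using (solve; _:+_; _:*_; :-_; _:-_; _:=_)
  open RationalArithmetic
  open Counting

  ∑ℚ : (ℕ → ℚ) → ℕ → ℚ
  ∑ℚ φ zero    = 0ℚ
  ∑ℚ φ (suc N) = ∑ℚ φ N + φ (suc N)

  ∑ℚ-cong : ∀ {φ ψ} N → (∀ n → 1 ℕ.≤ n → φ n ≡ ψ n) → ∑ℚ φ N ≡ ∑ℚ ψ N
  ∑ℚ-cong zero    φ≡ψ = refl
  ∑ℚ-cong (suc N) φ≡ψ = cong₂ _+_ (∑ℚ-cong N φ≡ψ) (φ≡ψ (suc N) (s≤s z≤n))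

  ∑ℚ-mono : ∀ {φ ψ} N → (∀ n → 1 ℕ.≤ n → φ n ≤ ψ n) → ∑ℚ φ N ≤ ∑ℚ ψ N
  ∑ℚ-mono zero    φ≤ψ = ℚ.≤-refl
  ∑ℚ-mono (suc N) φ≤ψ = ℚ.+-mono-≤ (∑ℚ-mono N φ≤ψ) (φ≤ψ (suc N) (s≤s z≤n))

  ∑ℚ-+ : ∀ φ ψ N → ∑ℚ (λ n → φ n + ψ n) N ≡ ∑ℚ φ N + ∑ℚ ψ N
  ∑ℚ-+ φ ψ zero    = refl
  ∑ℚ-+ φ ψ (suc N) = trans (cong (_+ (φ (suc N) + ψ (suc N))) (∑ℚ-+ φ ψ N))
    (solve 4 (λ a b c d → (a :+ b) :+ (c :+ d) := (a :+ c) :+ (b :+ d)) refl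
      (∑ℚ φ N) (∑ℚ ψ N) (φ (suc N)) (ψ (suc N)))

  ∑ℚ-- : ∀ φ ψ N → ∑ℚ (λ n → φ n - ψ n) N ≡ ∑ℚ φ N - ∑ℚ ψ N
  ∑ℚ-- φ ψ zero    = refl
  ∑ℚ-- φ ψ (suc N) = trans (cong (_+ (φ (suc N) - ψ (suc N))) (∑ℚ-- φ ψ N))
    (solve 4 (λ a b c d → (a :- b) :+ (c :- d) := (a :+ c) :- (b :+ d)) refl
      (∑ℚ φ N) (∑ℚ ψ N) (φ (suc N)) (ψ (suc N)))

  ∑ℚ-scale : ∀ c φ N → ∑ℚ (λ n → c * φ n) N ≡ c * ∑ℚ φ N
  ∑ℚ-scale c φ zero    = sym (ℚ.*-zeroʳ c)
  ∑ℚ-scale c φ (suc N) = trans (cong (_+ c * φ (suc N)) (∑ℚ-scale c φ N))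
    (sym (ℚ.*-distribˡ-+ c (∑ℚ φ N) (φ (suc N))))

  ∑ℚ-ν : ∀ φ N → ∑ℚ (λ n → ν (φ n)) N ≡ ν (∑ φ N)
  ∑ℚ-ν φ zero    = sym ν-0
  ∑ℚ-ν φ (suc N) = trans (cong (_+ ν (φ (suc N))) (∑ℚ-ν φ N)) (sym (ν-+ (∑ φ N) (φ (suc N))))

  ∑ℚ-shift : ∀ φ N → φ 1 + ∑ℚ (λ n → φ (suc n)) N ≡ ∑ℚ φ (suc N)
  ∑ℚ-shift φ zero    = ℚ.+-comm (φ 1) 0ℚ
  ∑ℚ-shift φ (suc N) = trans (sym (ℚ.+-assoc (φ 1) _ _)) (cong (_+ φ (suc (suc N))) (∑ℚ-shift φ N))

-- Divisibility indicators and sums over multiples.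

module Divisors where
  open import Data.Rational.Base using (_+_; _-_; _*_; _≤_; _<_; -_; ∣_∣)
  open +-*-Solver using (solve; _:+_; _:*_; :-_; _:-_; _:=_)
  open RationalArithmetic
  open RationalSums
  open Counting

  dvd : ℕ → ℕ → ℚ
  dvd d n = ν (ind (d ℕ.∣? n))

  dvd-yes : ∀ {d n} → d ℕ.∣ n → dvd d n ≡ 1ℚ
  dvd-yes {d} {n} d∣n = trans (cong ν (ind-yes (d ℕ.∣? n) d∣n)) ν-1

  dvd-no : ∀ {d n} → ¬ (d ℕ.∣ n) → dvd d n ≡ 0ℚ
  dvd-no {d} {n} d∤n = trans (cong ν (ind-no (d ℕ.∣? n) d∤n)) ν-0

  dvd-lcm : ∀ d e n → dvd d n * dvd e n ≡ dvd (ℕ.lcm d e) n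
  dvd-lcm d e n with d ℕ.∣? n
  ... | no  d∤n = trans (cong (_* dvd e n) ν-0) (trans (ℚ.*-zeroˡ (dvd e n))
    (sym (dvd-no λ lcm∣n → d∤n (ℕ.∣-trans (ℕ.m∣lcm[m,n] d e) lcm∣n))))
  ... | yes d∣n with e ℕ.∣? n
  ...   | yes e∣n = trans (cong₂ _*_ ν-1 ν-1) (sym (dvd-yes (ℕ.lcm-least d∣n e∣n)))
  ...   | no  e∤n = trans (cong (ν 1 *_) ν-0) (trans (ℚ.*-zeroʳ (ν 1))
    (sym (dvd-no λ lcm∣n → e∤n (ℕ.∣-trans (ℕ.n∣lcm[m,n] d e) lcm∣n))))

  module _ (d : ℕ) (1≤d : 1 ℕ.≤ d) (φ : ℕ → ℚ) where

    private
      S : ℕ → ℚ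
      S = ∑ℚ (λ n → dvd d n * φ n)

    ∑ℚ-gap : ∀ q r → r ℕ.< d → S (q ℕ.* d ℕ.+ r) ≡ S (q ℕ.* d)
    ∑ℚ-gap q zero    _   = cong S (ℕ.+-identityʳ (q ℕ.* d))
    ∑ℚ-gap q (suc r) r<d rewrite ℕ.+-suc (q ℕ.* d) r = trans
      (cong₂ _+_ (∑ℚ-gap q r (ℕ.<⇒≤ r<d)) (trans (cong (_* φ (suc (q ℕ.* d ℕ.+ r))) (dvd-no d∤)) (ℚ.*-zeroˡ (φ (suc (q ℕ.* d ℕ.+ r))))))
      (ℚ.+-identityʳ _)
      where
      d∤ : ¬ (d ℕ.∣ suc (q ℕ.* d ℕ.+ r))
      d∤ d∣ = ℕ.<⇒≱ r<d (ℕ.∣⇒≤ (ℕ.∣m+n∣m⇒∣n (subst (d ℕ.∣_) (sym (ℕ.+-suc (q ℕ.* d) r)) d∣) (ℕ.n∣m*n q)))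

    ∑ℚ-multiples* : ∀ q → S (q ℕ.* d) ≡ ∑ℚ (λ m → φ (d ℕ.* m)) q
    ∑ℚ-multiples* zero    = refl
    ∑ℚ-multiples* (suc q) = trans (cong S index≡) (cong₂ _+_
      (trans (∑ℚ-gap q (ℕ.pred d) pred<) (∑ℚ-multiples* q))
      (trans (cong₂ (λ c n → c * φ n) (trans (cong (dvd d) last≡) (dvd-yes (ℕ.m∣m*n (suc q)))) last≡)
        (ℚ.*-identityˡ _)))
      where
      suc-pred : suc (ℕ.pred d) ≡ d
      suc-pred = ℕ.suc-pred d {{ℕ.>-nonZero 1≤d}}
      pred< : ℕ.pred d ℕ.< d
      pred< = ℕ.≤-reflexive suc-pred
      index≡ : suc q ℕ.* d ≡ suc (q ℕ.* d ℕ.+ ℕ.pred d)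
      index≡ = trans (ℕ.+-comm d (q ℕ.* d)) (trans (cong (ℕ._+_ (q ℕ.* d)) (sym suc-pred)) (ℕ.+-suc (q ℕ.* d) (ℕ.pred d)))
      last≡ : suc (q ℕ.* d ℕ.+ ℕ.pred d) ≡ d ℕ.* suc q
      last≡ = trans (sym index≡) (ℕ.*-comm (suc q) d)

    -- Nothing is added between consecutive multiples of d, so only ⌊N/d⌋ matters. This serves both
    -- sides of the comparison: the weights n⁻ˢ, and the indicator that d divides all floors.
    ∑ℚ-multiples : ∀ N → S N ≡ ∑ℚ (λ m → φ (d ℕ.* m)) (quot N d)
    ∑ℚ-multiples N = trans (cong S (sym (ℕ.m+[n∸m]≡n (quot*≤ N d))))
      (trans (∑ℚ-gap (quot N d) (N ℕ.∸ quot N d ℕ.* d)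
          (ℕ.+-cancelˡ-< (quot N d ℕ.* d) _ _ (subst₂ ℕ._<_ (sym (ℕ.m+[n∸m]≡n (quot*≤ N d)))
            (ℕ.+-comm d (quot N d ℕ.* d)) (<suc-quot* N 1≤d))))
        (∑ℚ-multiples* (quot N d)))

  -- ⌊N/d⌋ passes every threshold as N grows and is at most N, so an error o(⌊N/d⌋) is o(N).
  o-quot : ∀ {a} d → 1 ℕ.≤ d → a ∈o ν → (λ N → a (quot N d)) ∈o ν
  o-quot {a} d 1≤d a∈o ε 0<ε with N₀ , h ← a∈o ε 0<ε = N₀ ℕ.* d , λ N ≤N →
    ℚ.≤-trans (h (quot N d) (*≤⇒≤quot 1≤d ≤N))
      (*-monoˡ ε (ℚ.<⇒≤ 0<ε) (ν-mono-≤ (ℕ.≤-trans (ℕ.m≤m*n (quot N d) d {{ℕ.>-nonZero 1≤d}}) (quot*≤ N d))))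

-- The weights n⁻ˢ and the partial sums of ζ(s).

module Zeta (s : ℕ) .{{_ : ℕ.NonTrivial s}} where
  open import Data.Rational.Base using (_+_; _-_; _*_; _≤_; _<_; -_; ∣_∣)
  open +-*-Solver using (solve; _:+_; _:*_; :-_; _:-_; _:=_)
  open RationalArithmetic
  open RationalSums
  open Counting
  open Divisors

  opaque
    -- This is n⁻ˢ for n ≥ 1: the predecessor compensates for `ζ-term` being indexed from 0.
    τ : ℕ → ℚ
    τ n = ζ-term s (ℕ.pred n)

    τ≡ : ∀ n → τ (suc n) ≡ ζ-term s n
    τ≡ n = refl

    ν*τ : ∀ n → 1 ℕ.≤ n → ν (n ℕ.^ s) * τ n ≡ 1ℚ
    ν*τ (suc n) _ = trans (cong (ν (suc n ℕ.^ s) *_) (sym (rcp≡1/ (suc n ℕ.^ s) {{ℕ.m^n≢0 (suc n) s}})))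
      (ν*rcp (suc n ℕ.^ s) {{ℕ.m^n≢0 (suc n) s}})

    0≤τ : ∀ n → 0ℚ ≤ τ n
    0≤τ n = ℚ.<⇒≤ (0<ζ-term s (ℕ.pred n))

  opaque
    Z : ℕ → ℚ
    Z = ζ-partial s

    Z≡ : ∀ n → Z n ≡ ζ-partial s n
    Z≡ n = refl

    Z-0 : Z 0 ≡ 0ℚ
    Z-0 = refl

    Z-suc : ∀ n → Z (suc n) ≡ Z n + τ (suc n)
    Z-suc n = cong (_+_ (ζ-partial s n)) (sym (τ≡ n))

    Z-cauchy : Cauchy Z
    Z-cauchy = ζ-cauchy s

    Z-upper : ∀ j e → Z (e ℕ.+ suc j) ≤ Z (suc j) + rcp (suc j)
    Z-upper j e = subst (λ x → ζ-partial s (e ℕ.+ suc j) ≤ ζ-partial s (suc j) + x) (sym (rcp≡1/ (suc j)))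
      (ζ-upper s j e)

    Z-mono : ∀ e → Z 1 ≤ Z (e ℕ.+ 1)
    Z-mono = ζ-partial-mono s 1

  τ-* : ∀ m n → 1 ℕ.≤ m → 1 ℕ.≤ n → τ (m ℕ.* n) ≡ τ m * τ n
  τ-* m n 1≤m 1≤n = inverse-unique (ν ((m ℕ.* n) ℕ.^ s)) _ _ (ν*τ (m ℕ.* n) (ℕ.*-mono-≤ 1≤m 1≤n)) (begin
    ν ((m ℕ.* n) ℕ.^ s) * (τ m * τ n)
      ≡⟨ cong (λ k → ν k * (τ m * τ n)) (^-* s) ⟩
    ν (m ℕ.^ s ℕ.* n ℕ.^ s) * (τ m * τ n)
      ≡⟨ cong (_* (τ m * τ n)) (ν-* (m ℕ.^ s) (n ℕ.^ s)) ⟩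
    ν (m ℕ.^ s) * ν (n ℕ.^ s) * (τ m * τ n)
      ≡⟨ solve 4 (λ a b c d → a :* b :* (c :* d) := (a :* c) :* (b :* d)) refl (ν (m ℕ.^ s)) (ν (n ℕ.^ s)) (τ m) (τ n) ⟩
    (ν (m ℕ.^ s) * τ m) * (ν (n ℕ.^ s) * τ n)
      ≡⟨ cong₂ _*_ (ν*τ m 1≤m) (ν*τ n 1≤n) ⟩
    1ℚ ∎)
    where
    open ≡-Reasoning
    ^-* : ∀ s → (m ℕ.* n) ℕ.^ s ≡ m ℕ.^ s ℕ.* n ℕ.^ s
    ^-* zero    = refl
    ^-* (suc s) = trans (cong (ℕ._*_ (m ℕ.* n)) (^-* s)) (interchange m n (m ℕ.^ s) (n ℕ.^ s))
      where
      interchange : ∀ a b c d → a ℕ.* b ℕ.* (c ℕ.* d) ≡ a ℕ.* c ℕ.* (b ℕ.* d)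
      interchange = ℕ-Solver.solve-∀

  ∑ℚ-τ : ∀ N → ∑ℚ τ N ≡ Z N
  ∑ℚ-τ zero    = sym Z-0
  ∑ℚ-τ (suc N) = trans (cong (_+ τ (suc N)) (∑ℚ-τ N)) (sym (Z-suc N))

  τ-1 : τ 1 ≡ 1ℚ
  τ-1 = trans (sym (ℚ.*-identityˡ (τ 1))) (trans (cong (_* τ 1) (trans (sym ν-1) (cong ν (sym (ℕ.^-zeroˡ s))))) (ν*τ 1 ℕ.≤-refl))

  1≤Z : ∀ X → 1 ℕ.≤ X → 1ℚ ≤ Z X
  1≤Z X 1≤X = subst₂ _≤_ (trans (Z-suc 0) (trans (cong₂ _+_ Z-0 τ-1) (ℚ.+-identityˡ 1ℚ)))
    (cong Z (ℕ.m∸n+n≡m 1≤X)) (Z-mono (X ℕ.∸ 1))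

  1ʷ : ℕ → ℚ
  1ʷ _ = 1ℚ

  -- By multiplicativity the weights of the multiples of d up to X add up to d⁻ˢ Z(⌊X/d⌋), and
  -- Z(⌊X/d⌋) - Z(X) tends to 0 because the partial sums are Cauchy.
  dvd-ζ-mean : ∀ d → 1 ℕ.≤ d → (λ X → ∑ℚ (λ n → dvd d n * τ n) X - τ d * Z X) ∈o 1ʷ
  dvd-ζ-mean d 1≤d = o-cong pointwise small
    where
    pointwise : ∀ X → τ d * (Z (quot X d) - Z X) ≡ ∑ℚ (λ n → dvd d n * τ n) X - τ d * Z X
    pointwise X = begin
      τ d * (Z (quot X d) - Z X)
        ≡⟨ solve 3 (λ x y z → x :* (y :- z) := x :* y :- x :* z) refl (τ d) (Z (quot X d)) (Z X) ⟩
      τ d * Z (quot X d) - τ d * Z X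
        ≡⟨ cong (_- τ d * Z X) (begin
             τ d * Z (quot X d)          ≡⟨ cong (τ d *_) (∑ℚ-τ (quot X d)) ⟨
             τ d * ∑ℚ τ (quot X d)                 ≡⟨ ∑ℚ-scale (τ d) τ (quot X d) ⟨
             ∑ℚ (λ m → τ d * τ m) (quot X d)       ≡⟨ ∑ℚ-cong (quot X d) (λ m 1≤m → sym (τ-* d m 1≤d 1≤m)) ⟩
             ∑ℚ (λ m → τ (d ℕ.* m)) (quot X d)     ≡⟨ ∑ℚ-multiples d 1≤d τ X ⟨
             ∑ℚ (λ n → dvd d n * τ n) X            ∎) ⟩
      ∑ℚ (λ n → dvd d n * τ n) X - τ d * Z X ∎
      where open ≡-Reasoning

    τ≤1 : τ d ≤ 1ℚ
    τ≤1 = subst (_≤ 1ℚ) (ℚ.*-identityˡ (τ d)) (subst (1ℚ * τ d ≤_) (ν*τ d 1≤d)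
      (ℚ.*-monoʳ-≤-nonNeg (τ d) {{ℚ.nonNegative (0≤τ d)}} (1≤ν (ℕ.m^n>0 d {{ℕ.>-nonZero 1≤d}} s))))

    open ℚ.≤-Reasoning

    small : (λ X → τ d * (Z (quot X d) - Z X)) ∈o 1ʷ
    small ε 0<ε with N , h ← Z-cauchy ε 0<ε = N ℕ.* d , λ X Nd≤X → let δ = Z (quot X d) - Z X in begin
      ∣ τ d * δ ∣          ≡⟨ ℚ.∣p*q∣≡∣p∣*∣q∣ (τ d) δ ⟩
      ∣ τ d ∣ * ∣ δ ∣      ≡⟨ cong (_* ∣ δ ∣) (ℚ.0≤p⇒∣p∣≡p (0≤τ d)) ⟩
      τ d * ∣ δ ∣          ≤⟨ *-mono-≤ (ℚ.0≤∣p∣ δ) (ℚ.<⇒≤ 0<1) τ≤1 (ℚ.<⇒≤ (h (quot X d) X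
                                (*≤⇒≤quot 1≤d Nd≤X) (ℕ.≤-trans (ℕ.m≤m*n N d {{ℕ.>-nonZero 1≤d}}) Nd≤X))) ⟩
      1ℚ * ε               ≡⟨ ℚ.*-comm 1ℚ ε ⟩
      ε * 1ℚ               ∎

  -- The finite sieve and its mean.

  module Sieve (G : ℕ → ℕ)
    (divisors : ∀ d → 1 ℕ.≤ d → (λ N → ∑ℚ (λ n → dvd d (G n)) N - τ d * ν N) ∈o ν) where

    -- Asking for the same constant in both limits ties the density to ζ without Möbius inversion.
    HasMean : (ℕ → ℚ) → Set
    HasMean v = ∃[ c ] ((λ N → ∑ℚ (λ n → v (G n)) N - c * ν N) ∈o ν ×
                        (λ X → ∑ℚ (λ n → v n * τ n) X - c * Z X) ∈o 1ʷ)

    HasMean-cong : ∀ v w → (∀ n → v n ≡ w n) → HasMean v → HasMean w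
    HasMean-cong v w v≡w (c , A , B) = c ,
      o-cong (λ N → cong (_- c * ν N) (∑ℚ-cong N λ n _ → v≡w (G n))) A ,
      o-cong (λ X → cong (_- c * Z X) (∑ℚ-cong X λ n _ → cong (_* τ n) (v≡w n))) B

    HasMean-- : ∀ v w → HasMean v → HasMean w → HasMean (λ n → v n - w n)
    HasMean-- v w (c , A , B) (c′ , A′ , B′) = c - c′ ,
      o-cong (λ N → trans (regroup (S v N) (S w N) c c′ (ν N))
        (cong (_- (c - c′) * ν N) (sym (∑ℚ-- (λ n → v (G n)) (λ n → w (G n)) N)))) (o-- A A′) ,
      o-cong (λ X → trans (regroup (W v X) (W w X) c c′ (Z X)) (cong (_- (c - c′) * Z X)
        (trans (sym (∑ℚ-- (λ n → v n * τ n) (λ n → w n * τ n) X))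
          (∑ℚ-cong X λ n _ → factor (v n) (w n) (τ n))))) (o-- B B′)
      where
      S W : (ℕ → ℚ) → ℕ → ℚ
      S v = ∑ℚ (λ n → v (G n))
      W v = ∑ℚ (λ n → v n * τ n)
      regroup : ∀ a b c c′ z → (a - c * z) - (b - c′ * z) ≡ (a - b) - (c - c′) * z
      regroup = solve 5 (λ a b c c′ z → (a :- c :* z) :- (b :- c′ :* z) := (a :- b) :- (c :- c′) :* z) refl
      factor : ∀ v w t → v * t - w * t ≡ (v - w) * t
      factor = solve 3 (λ v w t → v :* t :- w :* t := (v :- w) :* t) refl

    -- Composite e are sieved out as well, so that the factor e = n alone shows the vanishing at
    -- each n in 2, ..., j+1.
    sifted : ℕ → ℕ → ℚ
    sifted zero    n = 1ℚ
    sifted (suc j) n = sifted j n * (1ℚ - dvd (2 ℕ.+ j) n)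

    -- The extra factor [d ∣ n] closes the induction: v_{j+1} [d ∣ n] = v_j [d ∣ n] - v_j
    -- [lcm(j+2 , d) ∣ n], and both terms have the same shape at level j.
    sifted-dvd-mean : ∀ j d → 1 ℕ.≤ d → HasMean (λ n → sifted j n * dvd d n)
    sifted-dvd-mean zero    d 1≤d = HasMean-cong (dvd d) _ (λ n → sym (ℚ.*-identityˡ (dvd d n)))
      (τ d , divisors d 1≤d , dvd-ζ-mean d 1≤d)
    sifted-dvd-mean (suc j) d 1≤d = HasMean-cong _ _ expand (HasMean--
      (λ n → sifted j n * dvd d n) (λ n → sifted j n * dvd (ℕ.lcm (2 ℕ.+ j) d) n)
      (sifted-dvd-mean j d 1≤d)
      (sifted-dvd-mean j (ℕ.lcm (2 ℕ.+ j) d) 1≤lcm))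
      where
      1≤lcm : 1 ℕ.≤ ℕ.lcm (2 ℕ.+ j) d
      1≤lcm = ℕ.n≢0⇒n>0 λ lcm≡0 → ℕ.m<n⇒n≢0 (ℕ.*-mono-≤ {1} {2 ℕ.+ j} (s≤s z≤n) 1≤d)
        (ℕ.0∣⇒≡0 (subst (ℕ._∣ (2 ℕ.+ j) ℕ.* d) lcm≡0
          (ℕ.lcm-least {2 ℕ.+ j} {d} (ℕ.m∣m*n d) (ℕ.n∣m*n (2 ℕ.+ j)))))
      expand : ∀ n → sifted j n * dvd d n - sifted j n * dvd (ℕ.lcm (2 ℕ.+ j) d) n ≡ sifted (suc j) n * dvd d n
      expand n = begin
        x * dvd d n - x * dvd (ℕ.lcm (2 ℕ.+ j) d) n
          ≡⟨ cong (λ z → x * dvd d n - x * z) (dvd-lcm (2 ℕ.+ j) d n) ⟨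
        x * dvd d n - x * (dvd (2 ℕ.+ j) n * dvd d n)
          ≡⟨ cong (λ z → z - x * (dvd (2 ℕ.+ j) n * dvd d n)) (cong (_* dvd d n) (ℚ.*-identityʳ x)) ⟨
        x * 1ℚ * dvd d n - x * (dvd (2 ℕ.+ j) n * dvd d n)
          ≡⟨ solve 4 (λ x o a b → x :* o :* b :- x :* (a :* b) := x :* (o :- a) :* b) refl x 1ℚ (dvd (2 ℕ.+ j) n) (dvd d n) ⟩
        x * (1ℚ - dvd (2 ℕ.+ j) n) * dvd d n ∎
        where
        open ≡-Reasoning
        x = sifted j n

    sifted-mean : ∀ j → HasMean (sifted j)
    sifted-mean j = HasMean-cong (λ n → sifted j n * dvd 1 n) (sifted j)
      (λ n → trans (cong (sifted j n *_) (dvd-yes (ℕ.1∣ n))) (ℚ.*-identityʳ (sifted j n)))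
      (sifted-dvd-mean j 1 ℕ.≤-refl)

    1-dvd∈ : ∀ d n → 0ℚ ≤ 1ℚ - dvd d n × 1ℚ - dvd d n ≤ 1ℚ
    1-dvd∈ d n with d ℕ.∣? n
    ... | yes _ rewrite ν-1 = ℚ.≤-refl , ℚ.<⇒≤ 0<1
    ... | no  _ rewrite ν-0 = ℚ.<⇒≤ 0<1 , ℚ.≤-refl

    0≤sifted : ∀ j n → 0ℚ ≤ sifted j n
    0≤sifted zero    n = ℚ.<⇒≤ 0<1
    0≤sifted (suc j) n = 0≤* (0≤sifted j n) (proj₁ (1-dvd∈ (2 ℕ.+ j) n))

    sifted≤1 : ∀ j n → sifted j n ≤ 1ℚ
    sifted≤1 zero    n = ℚ.≤-refl
    sifted≤1 (suc j) n = *-mono-≤ (proj₁ (1-dvd∈ (2 ℕ.+ j) n)) (ℚ.<⇒≤ 0<1) (sifted≤1 j n) (proj₂ (1-dvd∈ (2 ℕ.+ j) n))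

    sifted-1 : ∀ j → sifted j 1 ≡ 1ℚ
    sifted-1 zero    = refl
    sifted-1 (suc j) = trans (cong₂ (λ x y → x * (1ℚ - y)) (sifted-1 j) (dvd-no {2 ℕ.+ j} {1} λ d∣1 →
      contradiction (ℕ.∣1⇒≡1 d∣1) λ ())) refl

    sifted-0 : ∀ j n → 2 ℕ.≤ n → n ℕ.≤ suc j → sifted j n ≡ 0ℚ
    sifted-0 zero    n 2≤n n≤1   = contradiction (ℕ.≤-trans 2≤n n≤1) λ { (s≤s ()) }
    sifted-0 (suc j) n 2≤n n≤2+j with ℕ.m≤n⇒m<n∨m≡n n≤2+j
    ... | inj₁ (s≤s n≤1+j) = trans (cong (_* _) (sifted-0 j n 2≤n n≤1+j)) (ℚ.*-zeroˡ (1ℚ - dvd (2 ℕ.+ j) n))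
    ... | inj₂ refl = trans (cong (λ x → sifted j (2 ℕ.+ j) * (1ℚ - x)) (dvd-yes (ℕ.∣-refl {2 ℕ.+ j})))
      (ℚ.*-zeroʳ (sifted j (2 ℕ.+ j)))

    [1]≤sifted : ∀ j n → ν (ind (n ℕ.≟ 1)) ≤ sifted j n
    [1]≤sifted j n with n ℕ.≟ 1
    ... | yes refl = ℚ.≤-reflexive (trans ν-1 (sym (sifted-1 j)))
    ... | no  _    = ℚ.≤-trans (ℚ.≤-reflexive ν-0) (0≤sifted j n)

    -- Apart from 1, only n > j+1 survive. There v_j is merely bounded by 1, and the rarity of large
    -- Gₙ has to make up for it.
    sifted≤ : ∀ j n → 1 ℕ.≤ n → sifted j n ≤ ν (ind (n ℕ.≟ 1)) + ν (ind (suc j ℕ.<? n))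
    sifted≤ j n 1≤n with n ℕ.≟ 1
    ... | yes refl rewrite ν-1 = ℚ.≤-trans (sifted≤1 j 1) (p≤p+q (0≤ν _))
    ... | no  n≢1 with suc j ℕ.<? n
    ...   | yes _ rewrite ν-0 | ν-1 = sifted≤1 j n
    ...   | no j≮n rewrite ν-0 = ℚ.≤-reflexive (sifted-0 j n (ℕ.≤∧≢⇒< 1≤n (λ 1≡n → n≢1 (sym 1≡n))) (ℕ.≮⇒≥ j≮n))

    module _ (j : ℕ) where

      private
        T : ℕ → ℚ
        T = ∑ℚ (λ n → sifted j n * τ n)

      T≡1 : ∀ m → m ℕ.≤ j → T (suc m) ≡ 1ℚ
      T≡1 zero    _   = trans (ℚ.+-identityˡ _) (trans (cong₂ _*_ (sifted-1 j) τ-1) refl)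
      T≡1 (suc m) m<j = trans (cong₂ _+_ (T≡1 m (ℕ.<⇒≤ m<j))
        (trans (cong (_* τ (2 ℕ.+ m)) (sifted-0 j (2 ℕ.+ m) (s≤s (s≤s z≤n)) (s≤s m<j))) (ℚ.*-zeroˡ (τ (2 ℕ.+ m)))))
        (ℚ.+-identityʳ 1ℚ)

      1≤T : ∀ e → 1ℚ ≤ T (e ℕ.+ suc j)
      1≤T zero    = ℚ.≤-reflexive (sym (T≡1 j ℕ.≤-refl))
      1≤T (suc e) = ℚ.≤-trans (1≤T e) (p≤p+q (0≤* (0≤sifted j _) (0≤τ (suc (e ℕ.+ suc j)))))

      -- Past j+1 every term of `T` is at most the corresponding term of `Z`. With `Z (suc j)` on
      -- the left the induction starts from an equality.
      T≤ : ∀ e → T (e ℕ.+ suc j) + Z (suc j) ≤ 1ℚ + Z (e ℕ.+ suc j)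
      T≤ zero    = ℚ.≤-reflexive (cong (_+ Z (suc j)) (T≡1 j ℕ.≤-refl))
      T≤ (suc e) = begin
        T n + sifted j (suc n) * τ (suc n) + z
          ≡⟨ solve 3 (λ a b c → a :+ b :+ c := a :+ c :+ b) refl (T n) (sifted j (suc n) * τ (suc n)) z ⟩
        T n + z + sifted j (suc n) * τ (suc n)
          ≤⟨ ℚ.+-mono-≤ (T≤ e) (ℚ.*-monoʳ-≤-nonNeg (τ (suc n)) {{ℚ.nonNegative (0≤τ (suc n))}} (sifted≤1 j (suc n))) ⟩
        1ℚ + Z n + 1ℚ * τ (suc n)
          ≡⟨ cong (_+_ (1ℚ + Z n)) (ℚ.*-identityˡ (τ (suc n))) ⟩
        1ℚ + Z n + τ (suc n)
          ≡⟨ trans (ℚ.+-assoc 1ℚ (Z n) (τ (suc n))) (cong (_+_ 1ℚ) (sym (Z-suc n))) ⟩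
        1ℚ + Z (suc n) ∎
        where
        open ℚ.≤-Reasoning
        n = e ℕ.+ suc j
        z = Z (suc j)

      -- The terms up to j+1 add up to exactly 1, and the later ones to at most the tail of ζ(s)
      -- beyond j+1, which `Z-upper` bounds by 1/(j+1).
      T-close : ∀ X → suc j ℕ.≤ X → ∣ 1ℚ - T X ∣ ≤ rcp (suc j)
      T-close X j<X = subst (λ X → ∣ 1ℚ - T X ∣ ≤ rcp (suc j)) (ℕ.m∸n+n≡m j<X)
        (close {1ℚ} {rcp (suc j)} ℚ.≤-refl (p≤p+q (ℚ.<⇒≤ (0<rcp (suc j)))) (1≤T e) upper)
        where
        e = X ℕ.∸ suc j
        open ℚ.≤-Reasoning
        upper : T (e ℕ.+ suc j) ≤ 1ℚ + rcp (suc j)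
        upper = begin
          T (e ℕ.+ suc j)
            ≡⟨ solve 2 (λ a b → a := a :+ b :- b) refl (T (e ℕ.+ suc j)) (Z (suc j)) ⟩
          T (e ℕ.+ suc j) + Z (suc j) - Z (suc j)
            ≤⟨ ℚ.+-monoˡ-≤ (- Z (suc j)) (ℚ.≤-trans (T≤ e) (ℚ.+-monoʳ-≤ 1ℚ (Z-upper j e))) ⟩
          1ℚ + (Z (suc j) + rcp (suc j)) - Z (suc j)
            ≡⟨ solve 3 (λ o a b → o :+ (a :+ b) :- a := o :+ b) refl 1ℚ (Z (suc j)) (rcp (suc j)) ⟩
          1ℚ + rcp (suc j) ∎

    module _ (1≤G : ∀ n → 1 ℕ.≤ n → 1 ℕ.≤ G n)
      (rare : ∀ h → 1 ℕ.≤ h → ∃[ D ] (h ℕ.≤ D ×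
        ∃[ N₀ ] (∀ N → 1 ℕ.≤ N → N₀ ℕ.≤ N → h ℕ.* ∑ (λ n → ind (D ℕ.<? G n)) N ℕ.≤ 3 ℕ.* N))) where

      C : ℕ → ℕ
      C = ∑ (λ n → ind (G n ℕ.≟ 1))

      module _ (j N : ℕ) where

        ∑sifted-lower : ν (C N) ≤ ∑ℚ (λ n → sifted j (G n)) N
        ∑sifted-lower = subst (_≤ ∑ℚ (λ n → sifted j (G n)) N) (∑ℚ-ν _ N)
          (∑ℚ-mono N λ n _ → [1]≤sifted j (G n))

        ∑sifted-upper : ∑ℚ (λ n → sifted j (G n)) N ≤ ν (C N) + ν (∑ (λ n → ind (suc j ℕ.<? G n)) N)
        ∑sifted-upper = ℚ.≤-trans (∑ℚ-mono N λ n 1≤n → sifted≤ j (G n) (1≤G n 1≤n))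
          (ℚ.≤-reflexive (trans (∑ℚ-+ _ _ N) (cong₂ _+_ (∑ℚ-ν _ N) (∑ℚ-ν _ N))))

      module _ (h : ℕ) (1≤h : 1 ℕ.≤ h) where
        private
          instance
            nonZero-h : ℕ.NonZero h
            nonZero-h = ℕ.>-nonZero 1≤h
          r = rcp h
          0≤r : 0ℚ ≤ r
          0≤r = ℚ.<⇒≤ (0<rcp h)

        scale-down : ∀ {T N} → h ℕ.* T ℕ.≤ 3 ℕ.* N → ν T ≤ (r + r + r) * ν N
        scale-down {T} {N} hT≤3N = begin
          ν T                        ≡⟨ ℚ.*-identityˡ (ν T) ⟨
          1ℚ * ν T                   ≡⟨ cong (_* ν T) (trans (ℚ.*-comm r (ν h)) (ν*rcp h)) ⟨
          r * ν h * ν T              ≡⟨ ℚ.*-assoc r (ν h) (ν T) ⟩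
          r * (ν h * ν T)            ≡⟨ cong (r *_) (ν-* h T) ⟨
          r * ν (h ℕ.* T)            ≤⟨ *-monoˡ r 0≤r (ν-mono-≤ hT≤3N) ⟩
          r * ν (3 ℕ.* N)            ≡⟨ cong (r *_) triple ⟩
          r * (ν N + ν N + ν N)      ≡⟨ solve 2 (λ r n → r :* (n :+ n :+ n) := (r :+ r :+ r) :* n) refl r (ν N) ⟩
          (r + r + r) * ν N          ∎
          where
          open ℚ.≤-Reasoning
          triple : ν (3 ℕ.* N) ≡ ν N + ν N + ν N
          triple = trans (cong ν (trans (cong (λ k → N ℕ.+ (N ℕ.+ k)) (ℕ.+-identityʳ N)) (sym (ℕ.+-assoc N N N))))
            (trans (ν-+ (N ℕ.+ N) N) (cong (_+ ν N) (ν-+ N N)))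

        -- The sieve is stopped at j = D. Of the six copies of r = 1/h, three pay for Gₙ > D, one
        -- for the mean of v_D(Gₙ), and two for |c - u|: `T-close` and the limit on the ζ side take
        -- one each. `N₀` and `X₀` are separate because only c links the two limits.
        density-near : ∃[ N₀ ] ∃[ X₀ ] (∀ N X u → 1 ℕ.≤ N → N₀ ℕ.≤ N → X₀ ℕ.≤ X → u * Z X ≡ 1ℚ →
          ∣ ν (C N) - u * ν N ∣ ≤ (r + r + r + r + r + r) * ν N)
        density-near
          with D , h≤D , N₁ , few ← rare h 1≤h
          with c , A , B ← sifted-mean D
          with N₂ , A-near ← A r (0<rcp h)
          with X₁ , B-near ← B r (0<rcp h) =
          N₁ ℕ.⊔ N₂ , X₁ ℕ.⊔ suc D , λ N X u 1≤N ≤N ≤X uζ≡1 →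
            near {D} {c} {h≤D} N X u
              (few N 1≤N (ℕ.m⊔n≤o⇒m≤o N₁ N₂ ≤N))
              (A-near N (ℕ.m⊔n≤o⇒n≤o N₁ N₂ ≤N))
              (B-near X (ℕ.m⊔n≤o⇒m≤o X₁ (suc D) ≤X))
              (ℕ.m⊔n≤o⇒n≤o X₁ (suc D) ≤X) uζ≡1
          where
          open ℚ.≤-Reasoning
          near : ∀ {D c} {h≤D : h ℕ.≤ D} N X u →
            h ℕ.* ∑ (λ n → ind (D ℕ.<? G n)) N ℕ.≤ 3 ℕ.* N →
            ∣ ∑ℚ (λ n → sifted D (G n)) N - c * ν N ∣ ≤ r * ν N →
            ∣ ∑ℚ (λ n → sifted D n * τ n) X - c * Z X ∣ ≤ r * 1ℚ →
            suc D ℕ.≤ X → u * Z X ≡ 1ℚ →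
            ∣ ν (C N) - u * ν N ∣ ≤ (r + r + r + r + r + r) * ν N
          near {D} {c} {h≤D} N X u few A-near B-near D<X uζ≡1 = begin
            ∣ ν (C N) - u * ν N ∣
              ≤⟨ ∣-∣-triangle (ν (C N)) M (u * ν N) ⟩
            ∣ ν (C N) - M ∣ + ∣ M - u * ν N ∣
              ≤⟨ ℚ.+-monoʳ-≤ ∣ ν (C N) - M ∣ (∣-∣-triangle M (c * ν N) (u * ν N)) ⟩
            ∣ ν (C N) - M ∣ + (∣ M - c * ν N ∣ + ∣ c * ν N - u * ν N ∣)
              ≤⟨ ℚ.+-mono-≤ C-near (ℚ.+-mono-≤ A-near c-near) ⟩
            (r + r + r) * ν N + (r * ν N + (r + r) * ν N)
              ≡⟨ solve 2 (λ r n → (r :+ r :+ r) :* n :+ (r :* n :+ (r :+ r) :* n) := (r :+ r :+ r :+ r :+ r :+ r) :* n) refl r (ν N) ⟩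
            (r + r + r + r + r + r) * ν N ∎
            where
            M = ∑ℚ (λ n → sifted D (G n)) N
            z = Z X
            t = ∑ℚ (λ n → sifted D n * τ n) X
            C-near : ∣ ν (C N) - M ∣ ≤ (r + r + r) * ν N
            C-near = close {ν (C N)} ℚ.≤-refl (p≤p+q (0≤* (ℚ.+-mono-≤ (ℚ.+-mono-≤ 0≤r 0≤r) 0≤r) (0≤ν N)))
              (∑sifted-lower D N)
              (ℚ.≤-trans (∑sifted-upper D N) (ℚ.+-monoʳ-≤ (ν (C N)) (ℚ.≤-trans
                -- Sieving by 2, ..., D+1 leaves Gₙ > D+1, a little less than the Gₙ > D that `rare`
                -- counts.
                (ν-mono-≤ (∑-mono N λ n _ _ → ind-mono (suc D ℕ.<? G n) (D ℕ.<? G n) ℕ.<⇒≤))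
                (scale-down few))))
            1≤z : 1ℚ ≤ z
            1≤z = 1≤Z X (ℕ.≤-trans (s≤s z≤n) D<X)
            zc-near : ∣ 1ℚ - c * z ∣ ≤ r + r
            zc-near = ℚ.≤-trans (∣-∣-triangle 1ℚ t (c * z)) (ℚ.+-mono-≤
              (ℚ.≤-trans (T-close D X D<X) (rcp-antimono h (suc D) (ℕ.m≤n⇒m≤1+n h≤D)))
              (ℚ.≤-trans B-near (ℚ.≤-reflexive (ℚ.*-identityʳ r))))
            -- As z ≥ 1, |u - c| ≤ |u z - c z| = |1 - c z|, which spares a division by z.
            u-c-near : ∣ c - u ∣ ≤ r + r
            u-c-near = begin
              ∣ c - u ∣              ≡⟨ ∣p-q∣≡∣q-p∣ c u ⟩
              ∣ u - c ∣              ≡⟨ ℚ.*-identityʳ _ ⟨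
              ∣ u - c ∣ * 1ℚ         ≤⟨ *-monoˡ ∣ u - c ∣ (ℚ.0≤∣p∣ _) 1≤z ⟩
              ∣ u - c ∣ * z          ≡⟨ cong (∣ u - c ∣ *_) (ℚ.0≤p⇒∣p∣≡p (ℚ.≤-trans (ℚ.<⇒≤ 0<1) 1≤z)) ⟨
              ∣ u - c ∣ * ∣ z ∣      ≡⟨ ℚ.∣p*q∣≡∣p∣*∣q∣ (u - c) z ⟨
              ∣ (u - c) * z ∣        ≡⟨ cong ∣_∣ (solve 3 (λ u c z → (u :- c) :* z := u :* z :- c :* z) refl u c z) ⟩
              ∣ u * z - c * z ∣      ≡⟨ cong (λ x → ∣ x - c * z ∣) uζ≡1 ⟩
              ∣ 1ℚ - c * z ∣         ≤⟨ zc-near ⟩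
              r + r                  ∎
            c-near : ∣ c * ν N - u * ν N ∣ ≤ (r + r) * ν N
            c-near = begin
              ∣ c * ν N - u * ν N ∣  ≡⟨ cong ∣_∣ (solve 3 (λ c u n → c :* n :- u :* n := (c :- u) :* n) refl c u (ν N)) ⟩
              ∣ (c - u) * ν N ∣      ≡⟨ ℚ.∣p*q∣≡∣p∣*∣q∣ (c - u) (ν N) ⟩
              ∣ c - u ∣ * ∣ ν N ∣    ≡⟨ cong (∣ c - u ∣ *_) (ℚ.0≤p⇒∣p∣≡p (0≤ν N)) ⟩
              ∣ c - u ∣ * ν N        ≤⟨ ℚ.*-monoʳ-≤-nonNeg (ν N) {{ℚ.nonNegative (0≤ν N)}} u-c-near ⟩
              (r + r) * ν N          ∎

open import Defs
open RationalArithmetic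
open RationalSums
open Counting
open Divisors
open +-*-Solver using (solve; _:+_; _:*_; :-_; _:-_; _:=_)

-- Comparing reals with rationals.

module RealOrder where

  <-fromℚ-weaken : ∀ x {p q} → x < fromℚ p → p ℚ.≤ q → x < fromℚ q
  <-fromℚ-weaken x (ε , 0<ε , N , h) p≤q = ε , 0<ε , N , λ t N≤t → ℚ.≤-trans (h t N≤t) p≤q

  <-fromℤ-weaken : ∀ x {i j} → x < fromℤ i → i ℤ.≤ j → x < fromℤ j
  <-fromℤ-weaken x {i} {j} x<i i≤j = <-fromℚ-weaken x x<i
    (subst₂ ℚ._≤_ (ι≡/1 i) (ι≡/1 j) (ι-mono-≤ i≤j))

  fromℤ-≤-< : ∀ x {i j} → fromℤ i ≤ x → x < fromℤ j → i ℤ.< j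
  fromℤ-≤-< x {i} {j} i≤x x<j = ℤ.≰⇒> λ j≤i → i≤x (<-fromℤ-weaken x x<j j≤i)

  -‿<⇒<+ : ∀ x {p q} → x - fromℚ p < fromℚ q → x < fromℚ (p ℚ.+ q)
  -‿<⇒<+ x {p} {q} (ε , 0<ε , N , h) = ε , 0<ε , N , λ t N≤t →
    subst (ℚ._≤ p ℚ.+ q) (solve 3 (λ p x e → p :+ (x :- p :+ e) := x :+ e) refl p (seq x t) ε)
      (ℚ.+-monoʳ-≤ p (h t N≤t))

  <+⇒-‿< : ∀ x {p q} → x < fromℚ (p ℚ.+ q) → x - fromℚ p < fromℚ q
  <+⇒-‿< x {p} {q} (ε , 0<ε , N , h) = ε , 0<ε , N , λ t N≤t →
    subst₂ ℚ._≤_ (solve 3 (λ p x e → (x :+ e) :- p := x :- p :+ e) refl p (seq x t) ε)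
      (solve 2 (λ p q → (p :+ q) :- p := q) refl p q)
      (ℚ.+-monoˡ-≤ (ℚ.- p) (h t N≤t))

  *-mono-<-fromℚ : ∀ x {r q} → 0ℚ ℚ.< r → x < fromℚ q → fromℚ r * x < fromℚ (r ℚ.* q)
  *-mono-<-fromℚ x {r} {q} 0<r (ε , 0<ε , N , h) = r ℚ.* ε , 0<* 0<r 0<ε , N , λ t N≤t →
    subst (ℚ._≤ r ℚ.* q) (ℚ.*-distribˡ-+ r (seq x t) ε) (*-monoˡ r (ℚ.<⇒≤ 0<r) (h t N≤t))

  *-cancel-<-fromℚ : ∀ x {c r q} → 0ℚ ℚ.< c → c ℚ.* r ≡ 1ℚ → fromℚ r * x < fromℚ q → x < fromℚ (c ℚ.* q)
  *-cancel-<-fromℚ x {c} {r} {q} 0<c cr≡1 (ε , 0<ε , N , h) = c ℚ.* ε , 0<* 0<c 0<ε , N , λ t N≤t →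
    subst (ℚ._≤ c ℚ.* q)
      (trans (solve 4 (λ c r x e → c :* (r :* x :+ e) := (c :* r) :* x :+ c :* e) refl c r (seq x t) ε)
        (cong (ℚ._+ c ℚ.* ε) (trans (cong (ℚ._* seq x t) cr≡1) (ℚ.*-identityˡ (seq x t)))))
      (*-monoˡ c (ℚ.<⇒≤ 0<c) (h t N≤t))

-- Floors of x and of x/d.

module FloorProperties (em : ExcludedMiddle 0ℓ) where
  open Classical em
  open RealOrder

  ⌊⌋≤ : ∀ x → fromℤ ⌊ x ⌋ ≤ x
  ⌊⌋≤ x = proj₁ (proj₂ (floor-exists x))

  <⌊⌋+1 : ∀ x → x < fromℤ (⌊ x ⌋ ℤ.+ 1ℤ)
  <⌊⌋+1 x = proj₂ (proj₂ (floor-exists x))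

  floor-unique : ∀ x i → fromℤ i ≤ x → x < fromℤ (i ℤ.+ 1ℤ) → ⌊ x ⌋ ≡ i
  floor-unique x i i≤x x<i+1 = ℤ.≤-antisym
    (≤-from-< ⌊ x ⌋ i (fromℤ-≤-< x (⌊⌋≤ x) x<i+1)) (≤-from-< i ⌊ x ⌋ (fromℤ-≤-< x i≤x (<⌊⌋+1 x)))
    where
    ≤-from-< : ∀ i j → i ℤ.< j ℤ.+ 1ℤ → i ℤ.≤ j
    ≤-from-< i j i<j+1 = subst (i ℤ.≤_) (trans (cong ℤ.pred (ℤ.+-comm j 1ℤ)) (ℤ.pred-suc j)) (ℤ.i<j⇒i≤pred[j] i<j+1)

  module _ (d : ℕ) .{{_ : NonZero d}} (x : ℝ) where
    private
      r = rcp d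
      y = fromℚ r * x
      0<r : 0ℚ ℚ.< r
      0<r = 0<rcp d
      νr : ν d ℚ.* r ≡ 1ℚ
      νr = ν*rcp d
      0<νd : 0ℚ ℚ.< ν d
      0<νd = ℚ.<-≤-trans 0<1 (1≤ν (ℕ.>-nonZero⁻¹ d))
      r≤1 : r ℚ.≤ 1ℚ
      r≤1 = rcp≤1 d

    scaled : ∀ j → ν d ℚ.* (j ℚ./ 1) ≡ j ℤ.* + d ℚ./ 1
    scaled j = trans (cong (ν d ℚ.*_) (sym (ι≡/1 j)))
      (trans (sym (ι-* (+ d) j)) (trans (cong ι (ℤ.*-comm (+ d) j)) (ι≡/1 (j ℤ.* + d))))

    unscaled : ∀ j → r ℚ.* (j ℤ.* + d ℚ./ 1) ≡ j ℚ./ 1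
    unscaled j = trans (cong (r ℚ.*_) (sym (scaled j)))
      (trans (solve 3 (λ r n q → r :* (n :* q) := (n :* r) :* q) refl r (ν d) (j ℚ./ 1))
        (trans (cong (ℚ._* (j ℚ./ 1)) νr) (ℚ.*-identityˡ (j ℚ./ 1))))

    +1-/1 : ∀ j → (j ℤ.+ 1ℤ) ℚ./ 1 ≡ j ℚ./ 1 ℚ.+ 1ℚ
    +1-/1 j = trans (sym (ι≡/1 (j ℤ.+ 1ℤ))) (trans (ι-+ j 1ℤ) (cong₂ ℚ._+_ (ι≡/1 j) ν-1))

    x<⇒y< : ∀ j → x < fromℤ (j ℤ.* + d) → y < fromℤ j
    x<⇒y< j x< = <-fromℚ-weaken y (*-mono-<-fromℚ x 0<r x<) (ℚ.≤-reflexive (unscaled j))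

    y<⇒x< : ∀ j → y < fromℤ j → x < fromℤ (j ℤ.* + d)
    y<⇒x< j y< = <-fromℚ-weaken x (*-cancel-<-fromℚ x 0<νd νr y<) (ℚ.≤-reflexive (scaled j))

    -- With j = ⌊x/d⌋, the bounds j ≤ x/d < j + 1/d scale to jd ≤ x < jd + 1, whence ⌊x⌋ = jd.
    frac<⇒∣⌊⌋ : frac y < fromℚ r → d ℕ.∣ ℤ.∣ ⌊ x ⌋ ∣
    frac<⇒∣⌊⌋ frac< = ℤ.∣⇒∣ᵤ {+ d} (ℤ.divides j (floor-unique x (j ℤ.* + d)
      (λ x<jd → ⌊⌋≤ y (x<⇒y< j x<jd))
      (<-fromℚ-weaken x (*-cancel-<-fromℚ x 0<νd νr (-‿<⇒<+ y frac<)) (ℚ.≤-reflexive (begin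
        ν d ℚ.* (j ℚ./ 1 ℚ.+ r)               ≡⟨ ℚ.*-distribˡ-+ (ν d) (j ℚ./ 1) r ⟩
        ν d ℚ.* (j ℚ./ 1) ℚ.+ ν d ℚ.* r       ≡⟨ cong₂ ℚ._+_ (scaled j) νr ⟩
        j ℤ.* + d ℚ./ 1 ℚ.+ 1ℚ                ≡⟨ +1-/1 (j ℤ.* + d) ⟨
        (j ℤ.* + d ℤ.+ 1ℤ) ℚ./ 1              ∎)))))
      where
      open ≡-Reasoning
      j = ⌊ y ⌋

    module _ (j : ℤ) (⌊x⌋≡ : ⌊ x ⌋ ≡ j ℤ.* + d) where

      jd≤x : fromℤ (j ℤ.* + d) ≤ x
      jd≤x = subst (λ i → fromℤ i ≤ x) ⌊x⌋≡ (⌊⌋≤ x)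

      j≤y : fromℤ j ≤ y
      j≤y y<j = jd≤x (y<⇒x< j y<j)

      x<jd+1 : x < fromℤ (j ℤ.* + d ℤ.+ 1ℤ)
      x<jd+1 = subst (λ i → x < fromℤ (i ℤ.+ 1ℤ)) ⌊x⌋≡ (<⌊⌋+1 x)

      shrink : r ℚ.* ((j ℤ.* + d ℤ.+ 1ℤ) ℚ./ 1) ≡ j ℚ./ 1 ℚ.+ r
      shrink = begin
        r ℚ.* ((j ℤ.* + d ℤ.+ 1ℤ) ℚ./ 1)           ≡⟨ cong (r ℚ.*_) (+1-/1 (j ℤ.* + d)) ⟩
        r ℚ.* (j ℤ.* + d ℚ./ 1 ℚ.+ 1ℚ)             ≡⟨ ℚ.*-distribˡ-+ r (j ℤ.* + d ℚ./ 1) 1ℚ ⟩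
        r ℚ.* (j ℤ.* + d ℚ./ 1) ℚ.+ r ℚ.* 1ℚ       ≡⟨ cong₂ ℚ._+_ (unscaled j) (ℚ.*-identityʳ r) ⟩
        j ℚ./ 1 ℚ.+ r                              ∎
        where open ≡-Reasoning

      y<j+r : y < fromℚ (j ℚ./ 1 ℚ.+ r)
      y<j+r = <-fromℚ-weaken y (*-mono-<-fromℚ x 0<r x<jd+1) (ℚ.≤-reflexive shrink)

      ⌊y⌋≡j : ⌊ y ⌋ ≡ j
      ⌊y⌋≡j = floor-unique y j j≤y (<-fromℚ-weaken y y<j+r
        (subst (j ℚ./ 1 ℚ.+ r ℚ.≤_) (sym (+1-/1 j)) (ℚ.+-monoʳ-≤ (j ℚ./ 1) r≤1)))

      0≤frac : 0ℝ ≤ frac y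
      0≤frac frac<0 = ⌊⌋≤ y (<-fromℚ-weaken y (-‿<⇒<+ y {⌊ y ⌋ ℚ./ 1} {0ℚ} frac<0)
        (ℚ.≤-reflexive (ℚ.+-identityʳ (⌊ y ⌋ ℚ./ 1))))

      frac< : frac y < fromℚ r
      frac< = <+⇒-‿< y {⌊ y ⌋ ℚ./ 1} {r} (subst (λ i → y < fromℚ (i ℚ./ 1 ℚ.+ r)) (sym ⌊y⌋≡j) y<j+r)

    -- If ⌊x⌋ = jd, then j ≤ x/d < j + 1/d ≤ j + 1, so ⌊x/d⌋ = j and less than 1/d is left over.
    ∣⌊⌋⇒frac∈ : d ℕ.∣ ℤ.∣ ⌊ x ⌋ ∣ → 0ℝ ≤ frac y × frac y < fromℚ r
    ∣⌊⌋⇒frac∈ d∣ = let ℤ.divides j ⌊x⌋≡ = ℤ.∣ᵤ⇒∣ {+ d} d∣ in 0≤frac j ⌊x⌋≡ , frac< j ⌊x⌋≡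

  -- The hypothesis is a negation and gives no bound directly. But if some late approximant were
  -- below j - 1, then, all late approximants being within 1/2 of it, they would stay below j - 1/2,
  -- and x < j would follow.
  eventually-≥ : ∀ x j → fromℤ j ≤ x → ∃[ T ] (∀ t → T ℕ.≤ t → ℚ.- (seq x t ℚ.- ι j) ℚ.≤ 1ℚ)
  eventually-≥ x j j≤x = from-half ℚ.½ (ℚ.positive⁻¹ ℚ.½) (½*ε+½*ε 1ℚ) (cauchy x (ℚ.½ ℚ.* 1ℚ) (0<½*ε 0<1))
    where
    open ℚ.≤-Reasoning
    from-half : ∀ h → 0ℚ ℚ.< h → h ℚ.* 1ℚ ℚ.+ h ℚ.* 1ℚ ≡ 1ℚ →
      ∃[ N ] (∀ m n → N ℕ.≤ m → N ℕ.≤ n → ℚ.∣ seq x m ℚ.- seq x n ∣ ℚ.< h ℚ.* 1ℚ) →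
      ∃[ T ] (∀ t → T ℕ.≤ t → ℚ.- (seq x t ℚ.- ι j) ℚ.≤ 1ℚ)
    from-half h 0<h h+h≡1 (N , near) = N , λ t N≤t → ℚ.≮⇒≥ λ 1< →
      j≤x (h , 0<h , N , λ u N≤u → below-j t N≤t 1< u N≤u)
      where
      half-sum : h ℚ.+ h ≡ 1ℚ
      half-sum = trans (sym (cong₂ ℚ._+_ (ℚ.*-identityʳ h) (ℚ.*-identityʳ h))) h+h≡1
      below-j : ∀ t → N ℕ.≤ t → 1ℚ ℚ.< ℚ.- (seq x t ℚ.- ι j) → ∀ u → N ℕ.≤ u → seq x u ℚ.+ h ℚ.≤ j ℚ./ 1
      below-j t N≤t 1< u N≤u = begin
        seq x u ℚ.+ h
          ≡⟨ solve 3 (λ u t h → u :+ h := (u :- t) :+ (t :+ h)) refl (seq x u) (seq x t) h ⟩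
        (seq x u ℚ.- seq x t) ℚ.+ (seq x t ℚ.+ h)
          ≤⟨ ℚ.+-monoˡ-≤ (seq x t ℚ.+ h) (∣p∣≤⇒p≤ (ℚ.≤-trans (ℚ.<⇒≤ (near u t N≤u N≤t)) (ℚ.≤-reflexive (ℚ.*-identityʳ h)))) ⟩
        h ℚ.+ (seq x t ℚ.+ h)
          ≡⟨ solve 3 (λ h t j → h :+ (t :+ h) := (h :+ h) :+ (t :- j) :+ j) refl h (seq x t) (ι j) ⟩
        (h ℚ.+ h) ℚ.+ (seq x t ℚ.- ι j) ℚ.+ ι j
          ≡⟨ cong (λ o → o ℚ.+ (seq x t ℚ.- ι j) ℚ.+ ι j) half-sum ⟩
        1ℚ ℚ.+ (seq x t ℚ.- ι j) ℚ.+ ι j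
          ≤⟨ ℚ.+-monoˡ-≤ (ι j) (ℚ.+-monoˡ-≤ (seq x t ℚ.- ι j) (ℚ.<⇒≤ 1<)) ⟩
        ℚ.- (seq x t ℚ.- ι j) ℚ.+ (seq x t ℚ.- ι j) ℚ.+ ι j
          ≡⟨ solve 2 (λ t j → :- (t :- j) :+ (t :- j) :+ j := j) refl (seq x t) (ι j) ⟩
        ι j
          ≡⟨ ι≡/1 j ⟩
        j ℚ./ 1 ∎

  eventually-≤ : ∀ x j → x < fromℤ (j ℤ.+ 1ℤ) → ∃[ T ] (∀ t → T ℕ.≤ t → seq x t ℚ.- ι j ℚ.≤ 1ℚ)
  eventually-≤ x j (ε , 0<ε , M , above) = M , λ t M≤t → p≤q+r⇒p-q≤r {seq x t} {ι j} (begin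
    seq x t                     ≤⟨ p≤p+q (ℚ.<⇒≤ 0<ε) ⟩
    seq x t ℚ.+ ε               ≤⟨ above t M≤t ⟩
    (j ℤ.+ 1ℤ) ℚ./ 1            ≡⟨ ι≡/1 (j ℤ.+ 1ℤ) ⟨
    ι (j ℤ.+ 1ℤ)                ≡⟨ trans (ι-+ j 1ℤ) (cong (ℚ._+_ (ι j)) ν-1) ⟩
    ι j ℚ.+ 1ℚ                  ∎)
    where open ℚ.≤-Reasoning

  floor-near : ∀ x → ∃[ T ] (∀ t → T ℕ.≤ t → ℚ.∣ seq x t ℚ.- ι ⌊ x ⌋ ∣ ℚ.≤ 1ℚ)
  floor-near x =
    let M , upper = eventually-≤ x ⌊ x ⌋ (<⌊⌋+1 x)
        N , lower = eventually-≥ x ⌊ x ⌋ (⌊⌋≤ x)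
    in M ℕ.⊔ N , λ t ≤t → ∣p∣≤ (upper t (ℕ.m⊔n≤o⇒m≤o M N ≤t)) (lower t (ℕ.m⊔n≤o⇒n≤o M N ≤t))

  -- The linear coordinate α n + β.

  module Linear (f : ℕ → ℝ) (α β : ℝ) (f≃ : ∀ n .{{_ : NonZero n}} → f n ≃ α * fromℕ n + β) where

    a : ℕ → ℤ
    a n = ⌊ f n ⌋

    -- K is m + 2, where m bounds |β| and one unit each is spent on approximating f(n) and on its
    -- floor. K is uniform in n; the index from which the approximants of α obey the bound may
    -- depend on n.
    slope-near : ∃[ K ] (1 ℕ.≤ K × (∀ n → 1 ℕ.≤ n → ∃[ T ] (∀ t → T ℕ.≤ t → ℚ.∣ ν n ℚ.* seq α t ℚ.- ι (a n) ∣ ℚ.≤ ν K)))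
    slope-near = bound (cauchy-bounded {seq β} (cauchy β))
      where
      Goal = ∃[ K ] (1 ℕ.≤ K × (∀ n → 1 ℕ.≤ n → ∃[ T ] (∀ t → T ℕ.≤ t → ℚ.∣ ν n ℚ.* seq α t ℚ.- ι (a n) ∣ ℚ.≤ ν K)))
      bound : ∃[ B ] (0ℚ ℚ.< B × ∃[ N ] (∀ n → N ℕ.≤ n → ℚ.∣ seq β n ∣ ℚ.≤ B)) → Goal
      bound (B , _ , N , β≤B) = let m , B≤m = below B in 2 ℕ.+ m , s≤s z≤n , λ n 1≤n →
        near m B≤m n (f≃ n {{ℕ.>-nonZero 1≤n}} 1ℚ 0<1) (floor-near (f n))
        where
        open ℚ.≤-Reasoning
        near : ∀ m → B ℚ.≤ (+ m) ℚ./ 1 → ∀ n → ∃[ M ] (∀ t → M ℕ.≤ t → ℚ.∣ seq (f n) t ℚ.- (seq α t ℚ.* ((+ n) ℚ./ 1) ℚ.+ seq β t) ∣ ℚ.< 1ℚ) →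
          ∃[ T ] (∀ t → T ℕ.≤ t → ℚ.∣ seq (f n) t ℚ.- ι (a n) ∣ ℚ.≤ 1ℚ) →
          ∃[ T ] (∀ t → T ℕ.≤ t → ℚ.∣ ν n ℚ.* seq α t ℚ.- ι (a n) ∣ ℚ.≤ ν (2 ℕ.+ m))
        near m B≤m n (M , f-near) (T , floor-near) = (M ℕ.⊔ T) ℕ.⊔ N , λ t ≤t →
          let ≤t′ = ℕ.m⊔n≤o⇒m≤o (M ℕ.⊔ T) N ≤t
              x = ν n ℚ.* seq α t
              z = seq (f n) t
              b = seq β t
          in begin
          ℚ.∣ x ℚ.- ι (a n) ∣
            ≤⟨ ∣-∣-triangle x (x ℚ.+ b) (ι (a n)) ⟩
          ℚ.∣ x ℚ.- (x ℚ.+ b) ∣ ℚ.+ ℚ.∣ x ℚ.+ b ℚ.- ι (a n) ∣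
            ≤⟨ ℚ.+-monoʳ-≤ ℚ.∣ x ℚ.- (x ℚ.+ b) ∣ (∣-∣-triangle (x ℚ.+ b) z (ι (a n))) ⟩
          ℚ.∣ x ℚ.- (x ℚ.+ b) ∣ ℚ.+ (ℚ.∣ x ℚ.+ b ℚ.- z ∣ ℚ.+ ℚ.∣ z ℚ.- ι (a n) ∣)
            ≤⟨ ℚ.+-mono-≤
                 (ℚ.≤-trans (ℚ.≤-reflexive (trans (cong ℚ.∣_∣ (solve 2 (λ x b → x :- (x :+ b) := :- b) refl x b)) (ℚ.∣-p∣≡∣p∣ b)))
                   (ℚ.≤-trans (β≤B t (ℕ.m⊔n≤o⇒n≤o (M ℕ.⊔ T) N ≤t)) B≤m))
                 (ℚ.+-mono-≤
                   (ℚ.≤-trans (ℚ.≤-reflexive (trans (∣p-q∣≡∣q-p∣ (x ℚ.+ b) z)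
                       (cong (λ y → ℚ.∣ z ℚ.- (y ℚ.+ b) ∣) (trans (ℚ.*-comm (ν n) (seq α t)) (cong (seq α t ℚ.*_) (ι≡/1 (+ n)))))))
                     (ℚ.<⇒≤ (f-near t (ℕ.m⊔n≤o⇒m≤o M T ≤t′))))
                   (floor-near t (ℕ.m⊔n≤o⇒n≤o M T ≤t′))) ⟩
          (+ m) ℚ./ 1 ℚ.+ (1ℚ ℚ.+ 1ℚ)
            ≡⟨ cong₂ ℚ._+_ (ι≡/1 (+ m)) (trans (ν-+ 1 1) (cong₂ ℚ._+_ ν-1 ν-1)) ⟨
          ν m ℚ.+ ν 2
            ≡⟨ trans (ℚ.+-comm (ν m) (ν 2)) (sym (ν-+ 2 m)) ⟩
          ν (2 ℕ.+ m) ∎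

    K : ℕ
    K = proj₁ slope-near

    1≤K : 1 ℕ.≤ K
    1≤K = proj₁ (proj₂ slope-near)

    near-αn : ∀ n → 1 ℕ.≤ n → ∃[ T ] (∀ t → T ℕ.≤ t → ℚ.∣ ν n ℚ.* seq α t ℚ.- ι (a n) ∣ ℚ.≤ ν K)
    near-αn = proj₂ (proj₂ slope-near)

    -- aₙ m - aₘ n = n (m α - aₘ) - m (n α - aₙ), so α cancels; an approximant of α beyond both
    -- thresholds suffices.
    slope : ∀ m n → 1 ℕ.≤ m → 1 ℕ.≤ n → ℤ.∣ a n ℤ.* + m ℤ.- a m ℤ.* + n ∣ ℕ.≤ K ℕ.* (n ℕ.+ m)
    slope m n 1≤m 1≤n = ℤ.drop‿+≤+ (ι-cancel-≤ (go (near-αn m 1≤m) (near-αn n 1≤n)))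
      where
      open ℚ.≤-Reasoning
      go : ∃[ T ] (∀ t → T ℕ.≤ t → ℚ.∣ ν m ℚ.* seq α t ℚ.- ι (a m) ∣ ℚ.≤ ν K) →
           ∃[ T ] (∀ t → T ℕ.≤ t → ℚ.∣ ν n ℚ.* seq α t ℚ.- ι (a n) ∣ ℚ.≤ ν K) →
           ν ℤ.∣ a n ℤ.* + m ℤ.- a m ℤ.* + n ∣ ℚ.≤ ν (K ℕ.* (n ℕ.+ m))
      go (T , near-m) (U , near-n) = begin
        ν ℤ.∣ a n ℤ.* + m ℤ.- a m ℤ.* + n ∣
          ≡⟨ ι-∣∣ (a n ℤ.* + m ℤ.- a m ℤ.* + n) ⟩
        ℚ.∣ ι (a n ℤ.* + m ℤ.- a m ℤ.* + n) ∣
          ≡⟨ cong ℚ.∣_∣ (trans (ι-+ (a n ℤ.* + m) (ℤ.- (a m ℤ.* + n)))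
               (cong₂ ℚ._+_ (ι-* (a n) (+ m)) (trans (ι-neg (a m ℤ.* + n)) (cong (λ q → ℚ.- q) (ι-* (a m) (+ n)))))) ⟩
        ℚ.∣ ι (a n) ℚ.* ν m ℚ.- ι (a m) ℚ.* ν n ∣
          ≡⟨ cong ℚ.∣_∣ (solve 5 (λ p m q n x → p :* m :- q :* n := n :* (m :* x :- q) :- m :* (n :* x :- p))
               refl (ι (a n)) (ν m) (ι (a m)) (ν n) x) ⟩
        ℚ.∣ ν n ℚ.* em′ ℚ.- ν m ℚ.* en ∣
          ≤⟨ ℚ.∣p-q∣≤∣p∣+∣q∣ (ν n ℚ.* em′) (ν m ℚ.* en) ⟩
        ℚ.∣ ν n ℚ.* em′ ∣ ℚ.+ ℚ.∣ ν m ℚ.* en ∣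
          ≡⟨ cong₂ ℚ._+_ (∣ν*∣ n em′) (∣ν*∣ m en) ⟩
        ν n ℚ.* ℚ.∣ em′ ∣ ℚ.+ ν m ℚ.* ℚ.∣ en ∣
          ≤⟨ ℚ.+-mono-≤ (*-monoˡ (ν n) (0≤ν n) (near-m t (ℕ.m≤m⊔n T U))) (*-monoˡ (ν m) (0≤ν m) (near-n t (ℕ.m≤n⊔m T U))) ⟩
        ν n ℚ.* ν K ℚ.+ ν m ℚ.* ν K
          ≡⟨ trans (sym (ℚ.*-distribʳ-+ (ν K) (ν n) (ν m))) (ℚ.*-comm (ν n ℚ.+ ν m) (ν K)) ⟩
        ν K ℚ.* (ν n ℚ.+ ν m)
          ≡⟨ trans (ν-* K (n ℕ.+ m)) (cong (ν K ℚ.*_) (ν-+ n m)) ⟨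
        ν (K ℕ.* (n ℕ.+ m)) ∎
        where
        t = T ℕ.⊔ U
        x = seq α t
        em′ = ν m ℚ.* x ℚ.- ι (a m)
        en = ν n ℚ.* x ℚ.- ι (a n)
        ∣ν*∣ : ∀ n q → ℚ.∣ ν n ℚ.* q ∣ ≡ ν n ℚ.* ℚ.∣ q ∣
        ∣ν*∣ n q = trans (ℚ.∣p*q∣≡∣p∣*∣q∣ (ν n) q) (cong (ℚ._* ℚ.∣ q ∣) (ℚ.0≤p⇒∣p∣≡p (0≤ν n)))

    -- If Q aₙ/n were an integer for arbitrarily large n, that integer would be
    -- eventually constant, and α would equal its quotient by Q.
    module _ (irrational : Irrational α) (Q : ℕ) (1≤Q : 1 ℕ.≤ Q) where

      -- n m |p - p′| = Q |aₙ m - aₘ n| ≤ Q K (n + m), which is below n m once n and m exceed 2 Q K,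
      -- so |p - p′| < 1. Doubling both sides avoids fractions.
      same-quotient : ∀ n m p p′ → 2 ℕ.* (Q ℕ.* K) ℕ.< n → 2 ℕ.* (Q ℕ.* K) ℕ.< m →
        + Q ℤ.* a n ≡ p ℤ.* + n → + Q ℤ.* a m ≡ p′ ℤ.* + m → p ≡ p′
      same-quotient n m p p′ c<n c<m Qan≡ Qam≡ = ℤ.i-j≡0⇒i≡j p p′ (ℤ.∣i∣≡0⇒i≡0 (ℕ.n<1⇒n≡0
        (ℕ.*-cancelˡ-< (2 ℕ.* (n ℕ.* m)) _ _ (begin-strict
          2 ℕ.* (n ℕ.* m) ℕ.* ℤ.∣ p ℤ.- p′ ∣
            ≡⟨ ℕ.*-assoc 2 (n ℕ.* m) _ ⟩
          2 ℕ.* (n ℕ.* m ℕ.* ℤ.∣ p ℤ.- p′ ∣)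
            ≡⟨ cong (2 ℕ.*_) absolute ⟩
          2 ℕ.* (Q ℕ.* ℤ.∣ a n ℤ.* + m ℤ.- a m ℤ.* + n ∣)
            ≤⟨ ℕ.*-monoʳ-≤ 2 (ℕ.*-monoʳ-≤ Q (slope m n (ℕ.≤-trans (s≤s z≤n) c<m) (ℕ.≤-trans (s≤s z≤n) c<n))) ⟩
          2 ℕ.* (Q ℕ.* (K ℕ.* (n ℕ.+ m)))
            ≡⟨ regroup Q K n m ⟩
          2 ℕ.* (Q ℕ.* K) ℕ.* m ℕ.+ 2 ℕ.* (Q ℕ.* K) ℕ.* n
            <⟨ ℕ.+-mono-< (ℕ.*-monoˡ-< m {{ℕ.>-nonZero (ℕ.≤-trans (s≤s z≤n) c<m)}} c<n)
                          (ℕ.*-monoˡ-< n {{ℕ.>-nonZero (ℕ.≤-trans (s≤s z≤n) c<n)}} c<m) ⟩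
          n ℕ.* m ℕ.+ m ℕ.* n
            ≡⟨ regroup′ n m ⟩
          2 ℕ.* (n ℕ.* m) ℕ.* 1 ∎))))
        where
        open ℕ.≤-Reasoning
        regroup : ∀ Q K n m → 2 ℕ.* (Q ℕ.* (K ℕ.* (n ℕ.+ m))) ≡ 2 ℕ.* (Q ℕ.* K) ℕ.* m ℕ.+ 2 ℕ.* (Q ℕ.* K) ℕ.* n
        regroup = ℕ-Solver.solve-∀
        regroup′ : ∀ n m → n ℕ.* m ℕ.+ m ℕ.* n ≡ 2 ℕ.* (n ℕ.* m) ℕ.* 1
        regroup′ = ℕ-Solver.solve-∀
        factor : ∀ n m p p′ → n ℤ.* m ℤ.* (p ℤ.- p′) ≡ (p ℤ.* n) ℤ.* m ℤ.- (p′ ℤ.* m) ℤ.* n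
        factor = solve-∀
        factor′ : ∀ Q a m a′ n → (Q ℤ.* a) ℤ.* m ℤ.- (Q ℤ.* a′) ℤ.* n ≡ Q ℤ.* (a ℤ.* m ℤ.- a′ ℤ.* n)
        factor′ = solve-∀
        absolute : n ℕ.* m ℕ.* ℤ.∣ p ℤ.- p′ ∣ ≡ Q ℕ.* ℤ.∣ a n ℤ.* + m ℤ.- a m ℤ.* + n ∣
        absolute = begin-equality
          n ℕ.* m ℕ.* ℤ.∣ p ℤ.- p′ ∣
            ≡⟨ ℤ.abs-* (+ (n ℕ.* m)) (p ℤ.- p′) ⟨
          ℤ.∣ + (n ℕ.* m) ℤ.* (p ℤ.- p′) ∣
            ≡⟨ cong ℤ.∣_∣ (trans (cong (ℤ._* (p ℤ.- p′)) (ℤ.pos-* n m)) (factor (+ n) (+ m) p p′)) ⟩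
          ℤ.∣ (p ℤ.* + n) ℤ.* + m ℤ.- (p′ ℤ.* + m) ℤ.* + n ∣
            ≡⟨ cong₂ (λ x y → ℤ.∣ x ℤ.* + m ℤ.- y ℤ.* + n ∣) Qan≡ Qam≡ ⟨
          ℤ.∣ (+ Q ℤ.* a n) ℤ.* + m ℤ.- (+ Q ℤ.* a m) ℤ.* + n ∣
            ≡⟨ cong ℤ.∣_∣ (factor′ (+ Q) (a n) (+ m) (a m) (+ n)) ⟩
          ℤ.∣ + Q ℤ.* (a n ℤ.* + m ℤ.- a m ℤ.* + n) ∣
            ≡⟨ ℤ.abs-* (+ Q) (a n ℤ.* + m ℤ.- a m ℤ.* + n) ⟩
          Q ℕ.* ℤ.∣ a n ℤ.* + m ℤ.- a m ℤ.* + n ∣ ∎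

      Integral : ℕ → ℤ → Set
      Integral n p = + Q ℤ.* a n ≡ p ℤ.* + n

      -- |α - aₙ/n| ≤ K/n, and aₙ/n = p/Q for arbitrarily large n. Asking for K/n ≤ ε/2 makes the
      -- final inequality strict.
      α≃quotient : ∀ p → (∀ X → ∃[ n ] (X ℕ.≤ n × Integral n p)) → α ≃ fromℚ (ι p ℚ.* rcp Q {{ℕ.>-nonZero 1≤Q}})
      α≃quotient p often ε 0<ε =
        let N₀ , K≤ = archimedean (ℚ.½ ℚ.* ε) K (0<½*ε 0<ε)
            n , ≤n , Qan≡ = often (1 ℕ.⊔ N₀)
        in go n (ℕ.m⊔n≤o⇒m≤o 1 N₀ ≤n) (K≤ n (ℕ.m⊔n≤o⇒n≤o 1 N₀ ≤n)) Qan≡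
             (near-αn n (ℕ.m⊔n≤o⇒m≤o 1 N₀ ≤n))
        where
        instance
          _ = ℕ.>-nonZero 1≤Q
        q = ι p ℚ.* rcp Q
        go : ∀ n → 1 ℕ.≤ n → ν K ℚ.≤ ℚ.½ ℚ.* ε ℚ.* ν n → Integral n p →
          ∃[ T ] (∀ t → T ℕ.≤ t → ℚ.∣ ν n ℚ.* seq α t ℚ.- ι (a n) ∣ ℚ.≤ ν K) →
          ∃[ N ] (∀ t → N ℕ.≤ t → ℚ.∣ seq α t ℚ.- q ∣ ℚ.< ε)
        go n 1≤n K≤ Qan≡ (T , near) = T , λ t T≤t → ℚ.≤-<-trans
          (ℚ.*-cancelʳ-≤-pos (ν n) {{ℚ.positive 0<νn}} (begin
            ℚ.∣ seq α t ℚ.- q ∣ ℚ.* ν n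
              ≡⟨ cong (ℚ.∣ seq α t ℚ.- q ∣ ℚ.*_) (ℚ.0≤p⇒∣p∣≡p (0≤ν n)) ⟨
            ℚ.∣ seq α t ℚ.- q ∣ ℚ.* ℚ.∣ ν n ∣
              ≡⟨ ℚ.∣p*q∣≡∣p∣*∣q∣ (seq α t ℚ.- q) (ν n) ⟨
            ℚ.∣ (seq α t ℚ.- q) ℚ.* ν n ∣
              ≡⟨ cong ℚ.∣_∣ (trans (solve 3 (λ x q n → (x :- q) :* n := n :* x :- q :* n) refl (seq α t) q (ν n))
                   (cong (λ y → ν n ℚ.* seq α t ℚ.- y) q*n≡)) ⟩
            ℚ.∣ ν n ℚ.* seq α t ℚ.- ι (a n) ∣
              ≤⟨ near t T≤t ⟩
            ν K
              ≤⟨ K≤ ⟩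
            ℚ.½ ℚ.* ε ℚ.* ν n ∎))
          (subst₂ ℚ._<_ (ℚ.+-identityʳ (ℚ.½ ℚ.* ε)) (½*ε+½*ε ε) (ℚ.+-monoʳ-< (ℚ.½ ℚ.* ε) (0<½*ε 0<ε)))
          where
          open ℚ.≤-Reasoning
          0<νn : 0ℚ ℚ.< ν n
          0<νn = ℚ.<-≤-trans 0<1 (1≤ν 1≤n)
          q*n≡ : q ℚ.* ν n ≡ ι (a n)
          q*n≡ = begin-equality
            ι p ℚ.* rcp Q ℚ.* ν n      ≡⟨ solve 3 (λ p r n → p :* r :* n := r :* (p :* n)) refl (ι p) (rcp Q) (ν n) ⟩
            rcp Q ℚ.* (ι p ℚ.* ν n)    ≡⟨ cong (rcp Q ℚ.*_) (trans (sym (ι-* p (+ n))) (trans (cong ι (sym Qan≡)) (ι-* (+ Q) (a n)))) ⟩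
            rcp Q ℚ.* (ν Q ℚ.* ι (a n)) ≡⟨ solve 3 (λ r q x → r :* (q :* x) := (q :* r) :* x) refl (rcp Q) (ν Q) (ι (a n)) ⟩
            ν Q ℚ.* rcp Q ℚ.* ι (a n)  ≡⟨ cong (ℚ._* ι (a n)) (ν*rcp Q) ⟩
            1ℚ ℚ.* ι (a n)             ≡⟨ ℚ.*-identityˡ (ι (a n)) ⟩
            ι (a n)                    ∎

      private
        Divides : ℕ → Set
        Divides n = n ℕ.∣ Q ℕ.* ℤ.∣ a n ∣

      integral : ∀ n → Divides n → ∃[ p ] Integral n p
      integral n n∣ =
        let ℤ.divides p eq = ℤ.∣ᵤ⇒∣ {+ n} {+ Q ℤ.* a n} (subst (n ℕ.∣_) (sym (ℤ.abs-* (+ Q) (a n))) n∣) in p , eq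

      eventually-nonintegral : ∃[ X ] (∀ n → X ℕ.≤ n → ¬ Divides n)
      eventually-nonintegral = found em
        where
        Eventually : Set
        Eventually = ∃[ X ] (∀ n → X ℕ.≤ n → ¬ Divides n)
        module _ (none : ¬ Eventually) where
          pick : ∀ X → ∃[ n ] (X ℕ.≤ n × Divides n)
          pick X = choose em
            where
            choose : Dec (∃[ n ] (X ℕ.≤ n × Divides n)) → ∃[ n ] (X ℕ.≤ n × Divides n)
            choose (yes chosen) = chosen
            choose (no  ∄n)     = contradiction (X , λ n X≤n n∣ → ∄n (n , X≤n , n∣)) none
          X₁ n₁ : ℕ
          -- This is the threshold of `same-quotient`: everything picked beyond it shares the
          -- quotient found at `n₁`.
          X₁ = suc (2 ℕ.* (Q ℕ.* K))
          n₁ = proj₁ (pick X₁)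
          p₁ : ∃[ p ] Integral n₁ p
          p₁ = integral n₁ (proj₂ (proj₂ (pick X₁)))
          often : ∀ X → ∃[ n ] (X ℕ.≤ n × Integral n (proj₁ p₁))
          often X =
            let n , ≤n , n∣ = pick (X ℕ.⊔ X₁)
                p , eq = integral n n∣
            in n , ℕ.m⊔n≤o⇒m≤o X X₁ ≤n ,
              subst (Integral n) (same-quotient n n₁ p (proj₁ p₁) (ℕ.m⊔n≤o⇒n≤o X X₁ ≤n)
                (proj₁ (proj₂ (pick X₁))) eq (proj₂ p₁)) eq
        found : Dec Eventually → Eventually
        found (yes eventually) = eventually
        found (no  none)       = contradiction (α≃quotient (proj₁ (p₁ none)) (often none)) (irrational _)

-- Densities as o(N) statements, and the density of d ∣ Gₙ.

module Density (em : ExcludedMiddle 0ℓ) where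
  open Classical em
  open FloorProperties em

  count≡∑ : ∀ A N → count A N ≡ ∑ (λ n → ind (em {A n})) N
  count≡∑ A zero    = refl
  count≡∑ A (suc N) = begin
    length (filter A? (applyUpTo suc (suc N)))                     ≡⟨ cong (λ l → length (filter A? l)) (List.applyUpTo-∷ʳ suc N) ⟨
    length (filter A? (applyUpTo suc N ∷ʳ suc N))                  ≡⟨ cong length (List.filter-++ A? (applyUpTo suc N) (suc N ∷ [])) ⟩
    length (filter A? (applyUpTo suc N) ++ filter A? (suc N ∷ []))    ≡⟨ List.length-++ (filter A? (applyUpTo suc N)) ⟩
    count A N ℕ.+ length (filter A? (suc N ∷ []))                     ≡⟨ cong₂ ℕ._+_ (count≡∑ A N) single ⟩
    ∑ (λ n → ind (em {A n})) (suc N)                               ∎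
    where
    open ≡-Reasoning
    A? = λ n → em {A n}
    single : length (filter A? (suc N ∷ [])) ≡ ind (A? (suc N))
    single with A? (suc N)
    ... | yes _ = refl
    ... | no  _ = refl

  ⟦_⟧ : Set → ℚ
  ⟦ A ⟧ = ν (ind (em {A}))

  ⟦⟧∈ : ∀ A → 0ℚ ℚ.≤ ⟦ A ⟧ × ⟦ A ⟧ ℚ.≤ 1ℚ
  ⟦⟧∈ A = 0≤ν (ind (em {A})) , ℚ.≤-trans (ν-mono-≤ (ind≤1 (em {A}))) (ℚ.≤-reflexive ν-1)
    where
    ind≤1 : (A? : Dec A) → ind A? ℕ.≤ 1
    ind≤1 (yes _) = ℕ.≤-refl
    ind≤1 (no  _) = z≤n

  ind-cong : ∀ {A B : Set} (A? : Dec A) (B? : Dec B) → (A → B) → (B → A) → ind A? ≡ ind B?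
  ind-cong A? B? f g = ℕ.≤-antisym (ind-mono A? B? f) (ind-mono B? A? g)

  ∣gcdWithFloors⇒ : ∀ {k} d n (y : Vector ℝ k) → d ℕ.∣ ℤ.∣ gcdWithFloors n y ∣ → d ℕ.∣ n × (∀ i → d ℕ.∣ ℤ.∣ ⌊ y i ⌋ ∣)
  ∣gcdWithFloors⇒ {zero}  d n y d∣ = d∣ , λ ()
  ∣gcdWithFloors⇒ {suc k} d n y d∣ =
    let rest = gcdWithFloors n (λ i → y (suc i))
        d∣n , d∣⌊⌋ = ∣gcdWithFloors⇒ d n (λ i → y (suc i)) (ℕ.∣-trans d∣ (ℕ.gcd[m,n]∣n ℤ.∣ ⌊ y zero ⌋ ∣ ℤ.∣ rest ∣))
    in d∣n , λ { zero → ℕ.∣-trans d∣ (ℕ.gcd[m,n]∣m ℤ.∣ ⌊ y zero ⌋ ∣ ℤ.∣ rest ∣) ; (suc i) → d∣⌊⌋ i }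

  ⇒∣gcdWithFloors : ∀ {k} d n (y : Vector ℝ k) → d ℕ.∣ n → (∀ i → d ℕ.∣ ℤ.∣ ⌊ y i ⌋ ∣) → d ℕ.∣ ℤ.∣ gcdWithFloors n y ∣
  ⇒∣gcdWithFloors {zero}  d n y d∣n d∣⌊⌋ = d∣n
  ⇒∣gcdWithFloors {suc k} d n y d∣n d∣⌊⌋ =
    ℕ.gcd-greatest (d∣⌊⌋ zero) (⇒∣gcdWithFloors d n (λ i → y (suc i)) d∣n (λ i → d∣⌊⌋ (suc i)))

  -- Leaves the reals: the density of a box with rational sides is represented by a constant
  -- sequence κ, and the count becomes κ N + o(N) in ℚ.
  density-bound : ∀ {A c κ} → HasDensity A c → (∀ t → seq c t ≡ κ) →
    (λ N → ν (count A N) ℚ.- κ ℚ.* ν N) ∈o ν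
  density-bound {A} {c} {κ} dense c≡κ ε 0<ε =
    let N₀ , h = dense (fromℚ ε) (ε , 0<ε , 0 , λ _ _ → ℚ.≤-reflexive (ℚ.+-identityˡ ε))
    in 1 ℕ.⊔ N₀ , λ N ≤N → near N (ℕ.m⊔n≤o⇒m≤o 1 N₀ ≤N)
         (λ nz → h N {{nz}} (ℕ.m⊔n≤o⇒n≤o 1 N₀ ≤N))
    where
    open ℚ.≤-Reasoning
    near : ∀ N → 1 ℕ.≤ N → ((nz : NonZero N) → ∣ fromℚ (((+ count A N) ℚ./ N) {{nz}}) - c ∣ < fromℚ ε) →
      ℚ.∣ ν (count A N) ℚ.- κ ℚ.* ν N ∣ ℚ.≤ ε ℚ.* ν N
    near N 1≤N h = scale-up (h (ℕ.>-nonZero 1≤N))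
      where
      instance
        _ = ℕ.>-nonZero 1≤N
      q = (+ count A N) ℚ./ N
      q*N≡ : q ℚ.* ν N ≡ ν (count A N)
      q*N≡ = begin-equality
        q ℚ.* ν N                               ≡⟨ cong (ℚ._* ν N) (/≡*rcp (+ count A N) N) ⟩
        ν (count A N) ℚ.* rcp N ℚ.* ν N         ≡⟨ solve 3 (λ c r n → c :* r :* n := c :* (n :* r)) refl (ν (count A N)) (rcp N) (ν N) ⟩
        ν (count A N) ℚ.* (ν N ℚ.* rcp N)       ≡⟨ cong (ν (count A N) ℚ.*_) (ν*rcp N) ⟩
        ν (count A N) ℚ.* 1ℚ                    ≡⟨ ℚ.*-identityʳ _ ⟩
        ν (count A N)                           ∎
      scale-up : ∣ fromℚ q - c ∣ < fromℚ ε → ℚ.∣ ν (count A N) ℚ.- κ ℚ.* ν N ∣ ℚ.≤ ε ℚ.* ν N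
      scale-up (e , 0<e , T , h) = begin
        ℚ.∣ ν (count A N) ℚ.- κ ℚ.* ν N ∣
          ≡⟨ cong (λ x → ℚ.∣ x ℚ.- κ ℚ.* ν N ∣) q*N≡ ⟨
        ℚ.∣ q ℚ.* ν N ℚ.- κ ℚ.* ν N ∣
          ≡⟨ cong ℚ.∣_∣ (solve 3 (λ q k n → q :* n :- k :* n := (q :- k) :* n) refl q κ (ν N)) ⟩
        ℚ.∣ (q ℚ.- κ) ℚ.* ν N ∣
          ≡⟨ trans (ℚ.∣p*q∣≡∣p∣*∣q∣ (q ℚ.- κ) (ν N)) (cong (ℚ.∣ q ℚ.- κ ∣ ℚ.*_) (ℚ.0≤p⇒∣p∣≡p (0≤ν N))) ⟩
        ℚ.∣ q ℚ.- κ ∣ ℚ.* ν N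
          ≤⟨ ℚ.*-monoʳ-≤-nonNeg (ν N) {{ℚ.nonNegative (0≤ν N)}} (ℚ.≤-trans (p≤p+q {ℚ.∣ q ℚ.- κ ∣} {e} (ℚ.<⇒≤ 0<e))
               (subst (λ k → ℚ.∣ q ℚ.- k ∣ ℚ.+ e ℚ.≤ ε) (c≡κ T) (h T ℕ.≤-refl))) ⟩
        ε ℚ.* ν N ∎

  fromℚ-mono-≤ : ∀ {p q} → p ℚ.≤ q → fromℚ p ≤ fromℚ q
  fromℚ-mono-≤ {p} {q} p≤q (ε , 0<ε , N , h) = ℚ.<-irrefl refl (ℚ.<-≤-trans
    (subst (ℚ._< q ℚ.+ ε) (ℚ.+-identityʳ q) (ℚ.+-monoʳ-< q 0<ε)) (ℚ.≤-trans (h N ℕ.≤-refl) p≤q))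

  box-volume : ∀ k q t → seq (foldr _*_ 1ℝ {k} (λ _ → fromℚ q - 0ℝ)) t ≡ q ^ℚ k
  box-volume zero    q t = refl
  box-volume (suc k) q t = cong₂ ℚ._*_ (ℚ.+-identityʳ q) (box-volume k q t)

  module Sequence {k : ℕ} (f : Fin k → ℕ → ℝ) (equidistributed : TotallyHomogeneouslyEquidistributed (λ n i → f i n)) where

    G : ℕ → ℕ
    G n = ℤ.∣ gcdWithFloors n (λ i → f i n) ∣

    FloorsDivisible : ℕ → ℕ → Set
    FloorsDivisible d n = ∀ i → d ℕ.∣ ℤ.∣ ⌊ f i n ⌋ ∣

    Box : ℕ → ℚ → ℕ → Set
    Box d q n = ∀ i → 0ℝ ≤ frac (fromℚ q * f i (d ℕ.* n ℕ.+ d)) × frac (fromℚ q * f i (d ℕ.* n ℕ.+ d)) < fromℚ q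

    -- Both parameters of the equidistribution hypothesis are d. The indices dn + d are multiples of
    -- d, so the box has to express only the k conditions on the floors. The side is a variable with
    -- an equation so that `rcp d` can be supplied.
    box-density : ∀ d .{{nz : NonZero d}} q → q ≡ ℚ._/_ (+ 1) d {{nz}} → 0ℚ ℚ.≤ q → q ℚ.≤ 1ℚ →
      HasDensity (Box d q) (foldr _*_ 1ℝ {k} (λ _ → fromℚ q - 0ℝ))
    box-density d {{nz}} q q≡ 0≤q q≤1 = rescaled q q≡ (λ _ → 0ℝ) (λ _ → fromℚ q) λ _ →
      fromℚ-mono-≤ {0ℚ} {0ℚ} ℚ.≤-refl , fromℚ-mono-≤ {0ℚ} {q} 0≤q , fromℚ-mono-≤ {q} {1ℚ} q≤1
      where
      rescaled : ∀ q → q ≡ ℚ._/_ (+ 1) d {{nz}} → Equidistributed (λ n i → fromℚ q * f i (d ℕ.* n ℕ.+ d))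
      rescaled q refl = equidistributed d d {{nz}} {{nz}}

    module _ (d : ℕ) (1≤d : 1 ℕ.≤ d) .{{nonZero-d : NonZero d}} where
      private
        q = rcp d
        κ = q ^ℚ k

        0≤q : 0ℚ ℚ.≤ q
        0≤q = ℚ.<⇒≤ (0<rcp d)
        q≤1 : q ℚ.≤ 1ℚ
        q≤1 = rcp≤1 d

      -- Indexed by the multiple dm. As n runs through 1, 2, ..., the index dn + d gives m = 2, 3,
      -- ... and misses m = 1; hence the `ψ (suc n)` below and the correction `ends`.
      ψ : ℕ → ℚ
      ψ m = ⟦ FloorsDivisible d (d ℕ.* m) ⟧

      shifted : ∀ n → d ℕ.* suc n ≡ d ℕ.* n ℕ.+ d
      shifted n = trans (ℕ.*-suc d n) (ℕ.+-comm d (d ℕ.* n))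

      ψ-suc : ∀ n → ν (ind (em {Box d q n})) ≡ ψ (suc n)
      ψ-suc n = cong ν (ind-cong em em
        (λ box i → subst (λ m → d ℕ.∣ ℤ.∣ ⌊ f i m ⌋ ∣) (sym (shifted n)) (frac<⇒∣⌊⌋ d (f i (d ℕ.* n ℕ.+ d)) (proj₂ (box i))))
        (λ div i → ∣⌊⌋⇒frac∈ d (f i (d ℕ.* n ℕ.+ d)) (subst (λ m → d ℕ.∣ ℤ.∣ ⌊ f i m ⌋ ∣) (shifted n) (div i))))

      ψ-mean : (λ M → ∑ℚ (λ n → ψ (suc n)) M ℚ.- κ ℚ.* ν M) ∈o ν
      ψ-mean = o-cong (λ M → cong (ℚ._- κ ℚ.* ν M)
          (trans (cong ν (count≡∑ (Box d q) M)) (trans (sym (∑ℚ-ν (λ n → ind (em {Box d q n})) M)) (∑ℚ-cong M λ n _ → ψ-suc n))))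
        (density-bound {Box d q} {foldr _*_ 1ℝ {k} (λ _ → fromℚ q - 0ℝ)} {κ} (box-density d {{nonZero-d}} q (rcp≡1/ d {{nonZero-d}}) 0≤q q≤1) (box-volume k q))

      -- The factor `dvd d n` selects the multiples of d, which puts the sum in the form required by
      -- `∑ℚ-multiples`.
      dvd-G : ∀ n → dvd d (G n) ≡ dvd d n ℚ.* ⟦ FloorsDivisible d n ⟧
      dvd-G n = go (d ℕ.∣? n)
        where
        go : Dec (d ℕ.∣ n) → dvd d (G n) ≡ dvd d n ℚ.* ⟦ FloorsDivisible d n ⟧
        go (no d∤n)  = trans (dvd-no λ d∣G → d∤n (proj₁ (∣gcdWithFloors⇒ {k = k} d n (λ i → f i n) d∣G)))
          (sym (trans (cong (ℚ._* ⟦ FloorsDivisible d n ⟧) (dvd-no d∤n)) (ℚ.*-zeroˡ ⟦ FloorsDivisible d n ⟧)))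
        go (yes d∣n) = trans (cong ν (ind-cong (d ℕ.∣? G n) em
            (λ d∣G → proj₂ (∣gcdWithFloors⇒ {k = k} d n (λ i → f i n) d∣G)) (⇒∣gcdWithFloors {k = k} d n (λ i → f i n) d∣n)))
          (sym (trans (cong (ℚ._* ⟦ FloorsDivisible d n ⟧) (dvd-yes d∣n)) (ℚ.*-identityˡ ⟦ FloorsDivisible d n ⟧)))

      module _ .{{_ : ℕ.NonTrivial (suc k)}} where
        open Zeta (suc k) using (τ; ν*τ; 0≤τ)

        κ*rcp : κ ℚ.* rcp d ≡ τ d
        κ*rcp = inverse-unique (ν (d ℕ.^ suc k)) _ _ (begin
          ν (d ℕ.* d ℕ.^ k) ℚ.* (κ ℚ.* rcp d)                ≡⟨ cong (ℚ._* (κ ℚ.* rcp d)) (ν-* d (d ℕ.^ k)) ⟩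
          ν d ℚ.* ν (d ℕ.^ k) ℚ.* (κ ℚ.* rcp d)              ≡⟨ solve 4 (λ a b c e → a :* b :* (c :* e) := (a :* e) :* (b :* c)) refl (ν d) (ν (d ℕ.^ k)) κ (rcp d) ⟩
          ν d ℚ.* rcp d ℚ.* (ν (d ℕ.^ k) ℚ.* κ)              ≡⟨ cong₂ ℚ._*_ (ν*rcp d) (ν^*q^ k) ⟩
          1ℚ                                                 ∎) (ν*τ d 1≤d)
          where
          open ≡-Reasoning
          ν^*q^ : ∀ k → ν (d ℕ.^ k) ℚ.* q ^ℚ k ≡ 1ℚ
          ν^*q^ zero    = cong (ℚ._* 1ℚ) ν-1
          ν^*q^ (suc k) = begin
            ν (d ℕ.* d ℕ.^ k) ℚ.* (q ℚ.* q ^ℚ k)             ≡⟨ cong (ℚ._* (q ℚ.* q ^ℚ k)) (ν-* d (d ℕ.^ k)) ⟩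
            ν d ℚ.* ν (d ℕ.^ k) ℚ.* (q ℚ.* q ^ℚ k)           ≡⟨ solve 4 (λ a b c e → a :* b :* (c :* e) := (a :* c) :* (b :* e)) refl (ν d) (ν (d ℕ.^ k)) q (q ^ℚ k) ⟩
            ν d ℚ.* q ℚ.* (ν (d ℕ.^ k) ℚ.* q ^ℚ k)           ≡⟨ cong₂ ℚ._*_ (ν*rcp d) (ν^*q^ k) ⟩
            1ℚ                                               ∎

        0≤κ : 0ℚ ℚ.≤ κ
        0≤κ = go k
          where
          go : ∀ k → 0ℚ ℚ.≤ q ^ℚ k
          go zero    = ℚ.<⇒≤ 0<1
          go (suc k) = 0≤* 0≤q (go k)

        κ≤1 : κ ℚ.≤ 1ℚ
        κ≤1 = go k
          where
          go : ∀ k → q ^ℚ k ℚ.≤ 1ℚ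
          go zero    = ℚ.≤-refl
          go (suc k) = ℚ.≤-trans (*-monoˡ q 0≤q (go k)) (ℚ.≤-trans (ℚ.≤-reflexive (ℚ.*-identityʳ q)) q≤1)

        -- N exceeds d ⌊N/d⌋ by less than d.
        rounding : (λ N → κ ℚ.* ν (quot N d) ℚ.- τ d ℚ.* ν N) ∈o ν
        rounding = bounded∈o 1 λ N → bound N
          where
          open ℚ.≤-Reasoning
          bound : ∀ N → ℚ.∣ κ ℚ.* ν (quot N d) ℚ.- τ d ℚ.* ν N ∣ ℚ.≤ ν 1
          bound N = begin
            ℚ.∣ κ ℚ.* ν M ℚ.- τ d ℚ.* ν N ∣
              ≡⟨ ∣p-q∣≡∣q-p∣ (κ ℚ.* ν M) (τ d ℚ.* ν N) ⟩
            ℚ.∣ τ d ℚ.* ν N ℚ.- κ ℚ.* ν M ∣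
              ≤⟨ close {κ ℚ.* ν M} {κ} lower upper ℚ.≤-refl (p≤p+q 0≤κ) ⟩
            κ
              ≤⟨ κ≤1 ⟩
            1ℚ
              ≡⟨ ν-1 ⟨
            ν 1 ∎
            where
            M = quot N d
            τ*d : ∀ m → τ d ℚ.* ν (m ℕ.* d) ≡ κ ℚ.* ν m
            τ*d m = begin-equality
              τ d ℚ.* ν (m ℕ.* d)                     ≡⟨ cong₂ ℚ._*_ (sym κ*rcp) (ν-* m d) ⟩
              κ ℚ.* rcp d ℚ.* (ν m ℚ.* ν d)           ≡⟨ solve 4 (λ k r m d → k :* r :* (m :* d) := (k :* m) :* (d :* r)) refl κ (rcp d) (ν m) (ν d) ⟩
              κ ℚ.* ν m ℚ.* (ν d ℚ.* rcp d)           ≡⟨ cong (κ ℚ.* ν m ℚ.*_) (ν*rcp d) ⟩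
              κ ℚ.* ν m ℚ.* 1ℚ                        ≡⟨ ℚ.*-identityʳ _ ⟩
              κ ℚ.* ν m                               ∎
            lower : κ ℚ.* ν M ℚ.≤ τ d ℚ.* ν N
            lower = ℚ.≤-trans (ℚ.≤-reflexive (sym (τ*d M))) (*-monoˡ (τ d) (0≤τ d) (ν-mono-≤ (quot*≤ N d)))
            upper : τ d ℚ.* ν N ℚ.≤ κ ℚ.* ν M ℚ.+ κ
            upper = begin
              τ d ℚ.* ν N                 ≤⟨ *-monoˡ (τ d) (0≤τ d) (ν-mono-≤ (ℕ.<⇒≤ (<suc-quot* N 1≤d))) ⟩
              τ d ℚ.* ν (suc M ℕ.* d)     ≡⟨ τ*d (suc M) ⟩
              κ ℚ.* ν (1 ℕ.+ M)           ≡⟨ cong (κ ℚ.*_) (trans (ν-+ 1 M) (cong (ℚ._+ ν M) ν-1)) ⟩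
              κ ℚ.* (1ℚ ℚ.+ ν M)          ≡⟨ trans (ℚ.*-distribˡ-+ κ 1ℚ (ν M)) (cong (ℚ._+ κ ℚ.* ν M) (ℚ.*-identityʳ κ)) ⟩
              κ ℚ.+ κ ℚ.* ν M             ≡⟨ ℚ.+-comm κ (κ ℚ.* ν M) ⟩
              κ ℚ.* ν M ℚ.+ κ             ∎

        -- The sums of ψ(n+1) and of ψ(n) over n ≤ M differ in their end terms only.
        ends : (λ N → ψ 1 ℚ.- ψ (suc (quot N d))) ∈o ν
        ends = bounded∈o 1 λ N → ℚ.≤-trans (close {0ℚ} {1ℚ} (proj₁ (ψ∈ 1)) (0+ (proj₂ (ψ∈ 1)))
            (proj₁ (ψ∈ (suc (quot N d)))) (0+ (proj₂ (ψ∈ (suc (quot N d))))))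
          (ℚ.≤-reflexive (sym ν-1))
          where
          ψ∈ : ∀ m → 0ℚ ℚ.≤ ψ m × ψ m ℚ.≤ 1ℚ
          ψ∈ m = ⟦⟧∈ (FloorsDivisible d (d ℕ.* m))
          0+ : ∀ {p} → p ℚ.≤ 1ℚ → p ℚ.≤ 0ℚ ℚ.+ 1ℚ
          0+ p≤1 = ℚ.≤-trans p≤1 (ℚ.≤-reflexive (sym (ℚ.+-identityˡ 1ℚ)))

        regroup : ∀ S S′ x a b y T → a ℚ.+ S′ ≡ S ℚ.+ b → T ≡ S →
          (S′ ℚ.- x) ℚ.+ (a ℚ.- b) ℚ.+ (x ℚ.- y) ≡ T ℚ.- y
        regroup S S′ x a b y T a+S′≡S+b refl = begin
          (S′ ℚ.- x) ℚ.+ (a ℚ.- b) ℚ.+ (x ℚ.- y)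
            ≡⟨ solve 5 (λ s x a b y → (s :- x) :+ (a :- b) :+ (x :- y) := (a :+ s) :- b :- y) refl S′ x a b y ⟩
          (a ℚ.+ S′) ℚ.- b ℚ.- y
            ≡⟨ cong (λ s → s ℚ.- b ℚ.- y) a+S′≡S+b ⟩
          (S ℚ.+ b) ℚ.- b ℚ.- y
            ≡⟨ cong (ℚ._- y) (solve 2 (λ s b → s :+ b :- b := s) refl S b) ⟩
          S ℚ.- y ∎
          where open ≡-Reasoning

        sum-multiples : ∀ N → ∑ℚ (λ n → dvd d (G n)) N ≡ ∑ℚ ψ (quot N d)
        sum-multiples N = trans (∑ℚ-cong N (λ n _ → dvd-G n))
          (∑ℚ-multiples d 1≤d (λ n → ⟦ FloorsDivisible d n ⟧) N)

        -- Three errors, each o(N): equidistribution at ⌊N/d⌋, the shift of the index by one, and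
        -- the passage from d⁻ᵏ ⌊N/d⌋ to d⁻ˢ N.
        divisible-mean : (λ N → ∑ℚ (λ n → dvd d (G n)) N ℚ.- τ d ℚ.* ν N) ∈o ν
        divisible-mean = o-cong pointwise (o-+ (o-+ (o-quot d 1≤d ψ-mean) ends) rounding)
          where
          pointwise : ∀ N →
            (∑ℚ (λ n → ψ (suc n)) (quot N d) ℚ.- κ ℚ.* ν (quot N d)) ℚ.+ (ψ 1 ℚ.- ψ (suc (quot N d)))
              ℚ.+ (κ ℚ.* ν (quot N d) ℚ.- τ d ℚ.* ν N)
            ≡ ∑ℚ (λ n → dvd d (G n)) N ℚ.- τ d ℚ.* ν N
          pointwise N = regroup (∑ℚ ψ (quot N d)) (∑ℚ (λ n → ψ (suc n)) (quot N d)) (κ ℚ.* ν (quot N d))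
            (ψ 1) (ψ (suc (quot N d))) (τ d ℚ.* ν N) (∑ℚ (λ n → dvd d (G n)) N)
            (∑ℚ-shift ψ (quot N d)) (sum-multiples N)

-- From rational estimates to the real number 1/ζ(s).

module Reciprocal (em : ExcludedMiddle 0ℓ) where
  open Classical em

  -- Six copies are rounded up to eight, which are three doublings.
  sixfold-≤ : ∀ {r e} → 0ℚ ℚ.≤ r → r ℚ.≤ ℚ.½ ℚ.* (ℚ.½ ℚ.* (ℚ.½ ℚ.* e)) →
    r ℚ.+ r ℚ.+ r ℚ.+ r ℚ.+ r ℚ.+ r ℚ.≤ e
  sixfold-≤ {r} {e} 0≤r r≤ = begin
    r ℚ.+ r ℚ.+ r ℚ.+ r ℚ.+ r ℚ.+ r
      ≤⟨ p≤p+q (ℚ.+-mono-≤ 0≤r 0≤r) ⟩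
    r ℚ.+ r ℚ.+ r ℚ.+ r ℚ.+ r ℚ.+ r ℚ.+ (r ℚ.+ r)
      ≡⟨ solve 1 (λ r → r :+ r :+ r :+ r :+ r :+ r :+ (r :+ r) := ((r :+ r) :+ (r :+ r)) :+ ((r :+ r) :+ (r :+ r))) refl r ⟩
    ((r ℚ.+ r) ℚ.+ (r ℚ.+ r)) ℚ.+ ((r ℚ.+ r) ℚ.+ (r ℚ.+ r))
      ≤⟨ double (double (double r≤)) ⟩
    e ∎
    where
    open ℚ.≤-Reasoning
    double : ∀ {p q} → p ℚ.≤ ℚ.½ ℚ.* q → p ℚ.+ p ℚ.≤ q
    double {p} {q} p≤ = ℚ.≤-trans (ℚ.+-mono-≤ p≤ p≤) (ℚ.≤-reflexive (½*ε+½*ε q))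

  module _ (s : ℕ) .{{_ : ℕ.NonTrivial s}} where
    open Zeta s using (Z; Z≡; 1≤Z)

    NearReciprocal : (ℕ → ℕ) → (h : ℕ) .{{_ : NonZero h}} → Set
    NearReciprocal C h = ∃[ N₀ ] ∃[ X₀ ] (∀ N X u → 1 ℕ.≤ N → N₀ ℕ.≤ N → X₀ ℕ.≤ X → u ℚ.* Z X ≡ 1ℚ →
      ℚ.∣ ν (C N) ℚ.- u ℚ.* ν N ∣ ℚ.≤ (rcp h ℚ.+ rcp h ℚ.+ rcp h ℚ.+ rcp h ℚ.+ rcp h ℚ.+ rcp h) ℚ.* ν N)

    inverse-Z : ∀ X → 1 ℕ.≤ X → inverse (ζ-partial s X) ℚ.* Z X ≡ 1ℚ
    inverse-Z X 1≤X = trans (cong (inverse (ζ-partial s X) ℚ.*_) (Z≡ X))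
      (*-inverse (subst (0ℚ ℚ.<_) (Z≡ X) (ℚ.<-≤-trans 0<1 (1≤Z X 1≤X))))

    -- The X-th approximant of `recip (ζ s)` is the inverse of the X-th partial sum, so X becomes
    -- the index at which the reals are compared. `N₀` does not depend on X, as the definition of
    -- density demands.
    reciprocal-density : ∀ A C → (∀ N → count A N ≡ C N) → (∀ h .{{nz : NonZero h}} → NearReciprocal C h {{nz}}) →
      HasDensity A (recip (ζ s) (0<ζ s))
    reciprocal-density A C count≡C near ε (e , 0<e , T , e≤ε) =
      -- Four halvings: three absorb the factor six, and the fourth keeps e/2 in reserve as the
      -- positive gap that `<` on reals asks for.
      let m , r< = rcp-small (0<½*ε (0<½*ε (0<½*ε (0<½*ε 0<e))))
          N₀ , X₀ , near-h = near (suc m)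
      in N₀ , λ N {{nz}} N₀≤N →
        ℚ.½ ℚ.* e , 0<½*ε 0<e , (1 ℕ.⊔ X₀) ℕ.⊔ T , λ X ≤X →
          let ≤X′ = ℕ.m⊔n≤o⇒m≤o (1 ℕ.⊔ X₀) T ≤X
              1≤X = ℕ.m⊔n≤o⇒m≤o 1 X₀ ≤X′
              u   = inverse (ζ-partial s X)
          in within N {{nz}} u X (sixfold-≤ (ℚ.<⇒≤ (0<rcp (suc m))) (ℚ.<⇒≤ r<))
            (near-h N X u (ℕ.>-nonZero⁻¹ N {{nz}}) N₀≤N (ℕ.m⊔n≤o⇒n≤o 1 X₀ ≤X′) (inverse-Z X 1≤X))
            (ℚ.≤-trans (ℚ.≤-reflexive (sym (ℚ.+-identityˡ e))) (e≤ε X (ℕ.m⊔n≤o⇒n≤o (1 ℕ.⊔ X₀) T ≤X)))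
      where
      open ℚ.≤-Reasoning
      within : ∀ N .{{_ : NonZero N}} u X {r} → r ℚ.≤ ℚ.½ ℚ.* e →
        ℚ.∣ ν (C N) ℚ.- u ℚ.* ν N ∣ ℚ.≤ r ℚ.* ν N → e ℚ.≤ seq ε X →
        ℚ.∣ (+ count A N) ℚ./ N ℚ.- u ∣ ℚ.+ ℚ.½ ℚ.* e ℚ.≤ seq ε X
      within N u X {r} r≤ near-u e≤ε = begin
        ℚ.∣ (+ count A N) ℚ./ N ℚ.- u ∣ ℚ.+ ℚ.½ ℚ.* e    ≤⟨ ℚ.+-monoˡ-≤ (ℚ.½ ℚ.* e) (ℚ.≤-trans quotient-near r≤) ⟩
        ℚ.½ ℚ.* e ℚ.+ ℚ.½ ℚ.* e                          ≡⟨ ½*ε+½*ε e ⟩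
        e                                                ≤⟨ e≤ε ⟩
        seq ε X                                          ∎
        where
        quotient-near : ℚ.∣ (+ count A N) ℚ./ N ℚ.- u ∣ ℚ.≤ r
        quotient-near = begin
          ℚ.∣ (+ count A N) ℚ./ N ℚ.- u ∣
            ≡⟨ cong (λ x → ℚ.∣ x ℚ.- u ∣) (trans (/≡*rcp (+ count A N) N) (cong (λ c → ν c ℚ.* rcp N) (count≡C N))) ⟩
          ℚ.∣ ν (C N) ℚ.* rcp N ℚ.- u ∣
            ≡⟨ cong (λ x → ℚ.∣ ν (C N) ℚ.* rcp N ℚ.- x ∣) (trans (cong (u ℚ.*_) (ν*rcp N)) (ℚ.*-identityʳ u)) ⟨
          ℚ.∣ ν (C N) ℚ.* rcp N ℚ.- u ℚ.* (ν N ℚ.* rcp N) ∣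
            ≡⟨ cong ℚ.∣_∣ (solve 4 (λ c r u n → c :* r :- u :* (n :* r) := (c :- u :* n) :* r) refl (ν (C N)) (rcp N) u (ν N)) ⟩
          ℚ.∣ (ν (C N) ℚ.- u ℚ.* ν N) ℚ.* rcp N ∣
            ≡⟨ ℚ.∣p*q∣≡∣p∣*∣q∣ (ν (C N) ℚ.- u ℚ.* ν N) (rcp N) ⟩
          ℚ.∣ ν (C N) ℚ.- u ℚ.* ν N ∣ ℚ.* ℚ.∣ rcp N ∣
            ≡⟨ cong (ℚ.∣ ν (C N) ℚ.- u ℚ.* ν N ∣ ℚ.*_) (ℚ.0≤p⇒∣p∣≡p (ℚ.<⇒≤ (0<rcp N))) ⟩
          ℚ.∣ ν (C N) ℚ.- u ℚ.* ν N ∣ ℚ.* rcp N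
            ≤⟨ ℚ.*-monoʳ-≤-nonNeg (rcp N) {{ℚ.nonNegative (ℚ.<⇒≤ (0<rcp N))}} near-u ⟩
          r ℚ.* ν N ℚ.* rcp N
            ≡⟨ trans (ℚ.*-assoc r (ν N) (rcp N)) (trans (cong (r ℚ.*_) (ν*rcp N)) (ℚ.*-identityʳ r)) ⟩
          r ∎

theorem1p1 : (em : ExcludedMiddle 0ℓ) → let open Classical em in
    (k-1 : ℕ) → let k = suc k-1 in
    (f : Fin k → ℕ → ℝ) →
    TotallyHomogeneouslyEquidistributed (λ n i → f i n) →
    (∃[ α ] ∃[ β ] (Irrational α × (∀ n .{{_ : NonZero n}} → f zero n ≃ α * fromℕ n + β))) →
    HasDensity (λ n → gcdWithFloors n (λ i → f i n) ≡ 1ℤ) (recip (ζ (suc k)) (0<ζ (suc k)))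
theorem1p1 em k-1 f equidistributed (α , β , irrational , f≃) =
  reciprocal-density (suc k) Coprime (C 1≤G rare) count≡C
    λ h {{nz}} → density-near 1≤G rare h (ℕ.>-nonZero⁻¹ h {{nz}})
  where
  open Classical em
  open FloorProperties em
  open Density em
  open Reciprocal em
  k = suc k-1
  open Sequence f equidistributed
  open Zeta.Sieve (suc k) G (λ d 1≤d → divisible-mean d 1≤d {{ℕ.>-nonZero 1≤d}})
  open Linear (f zero) α β f≃
  open LargeDivisors a K 1≤K slope (eventually-nonintegral irrational)

  Coprime : Pred ℕ 0ℓ
  Coprime n = gcdWithFloors n (λ i → f i n) ≡ 1ℤ

  G∣ : ∀ n → G n ℕ.∣ n × FloorsDivisible (G n) n
  G∣ n = ∣gcdWithFloors⇒ (G n) n (λ i → f i n) ℕ.∣-refl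

  1≤G : ∀ n → 1 ℕ.≤ n → 1 ℕ.≤ G n
  1≤G n 1≤n = ℕ.n≢0⇒n>0 λ G≡0 → ℕ.m<n⇒n≢0 1≤n (ℕ.0∣⇒≡0 (subst (ℕ._∣ n) G≡0 (proj₁ (G∣ n))))

  -- Gₙ divides both n and the floor of `f zero`, the linear coordinate, hence their gcd. This
  -- carries the rarity of large values over to Gₙ.
  G≤g : ∀ n → 1 ℕ.≤ n → G n ℕ.≤ g n
  G≤g n 1≤n = ℕ.∣⇒≤ {{ℕ.>-nonZero (1≤g n 1≤n)}} (ℕ.gcd-greatest (proj₁ (G∣ n)) (proj₂ (G∣ n) zero))

  rare : ∀ h → 1 ℕ.≤ h → ∃[ D ] (h ℕ.≤ D ×
    ∃[ N₀ ] (∀ N → 1 ℕ.≤ N → N₀ ℕ.≤ N → h ℕ.* ∑ (λ n → ind (D ℕ.<? G n)) N ℕ.≤ 3 ℕ.* N))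
  rare h 1≤h =
    let D , h≤D , N₀ , few = large-gcd-rare h 1≤h
    in D , h≤D , N₀ , λ N 1≤N N₀≤N → ℕ.≤-trans
      (ℕ.*-monoʳ-≤ h (∑-mono N λ n 1≤n _ → ind-mono (D ℕ.<? G n) (large? D n) λ D<G → ℕ.<-≤-trans D<G (G≤g n 1≤n)))
      (few N 1≤N N₀≤N)

  count≡C : ∀ N → count Coprime N ≡ C 1≤G rare N
  -- `count` decides by excluded middle and `C` by comparing natural numbers, so the two indicators
  -- are compared in both directions.
  count≡C N = trans (count≡∑ Coprime N) (ℕ.≤-antisym
    (∑-mono N λ n _ _ → ind-mono em (G n ℕ.≟ 1) (cong ℤ.∣_∣))
    (∑-mono N λ n _ _ → ind-mono (G n ℕ.≟ 1) em (cong (λ m → + m))))
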